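{- Let $0 < \varepsilon < 1/2$ and let $W \geq 1$ be an integer. Set $\lambda = \frac{\varepsilon}{100W}$. Let $\beta \geq \beta^- + 2$ (with $\beta \geq 3$) be integers such that $\frac{\beta + 6W}{\log(\beta + 6W)} \geq 2 W^2\lambda^{ -2}$ and $\beta^- - 6W \geq (1 - \lambda) \cdot (\beta + 6W)$. Let $G=(V,E)$ be an edge-weighted multi-graph with integer edge weights in $\{1,\dots,W\}$, together with capacities $\{b_v\}_{v\in V}$. Then any $(\beta, \beta^-)$-$w$-$b$-EDCS $H$ of $G$ contains a $b$-matching $M_H$ such that $\left(2 - \frac{1}{2W} + \varepsilon\right)\cdot w(M_H) \geq w(M_G)$, where $M_G$ is a maximum weight $b$-matching of $G$.
   Context: A weighted multi-graph $G=(V,E)$ has a multi-set $E$ of weighted edges $(u,v,k)$ with $u\neq v$ (no self-loops) and weight $w(e)=k\in\{1,\dots,W\}$; parallel edges, possibly of equal weight, are allowed. Each vertex $v$ has a capacity $b_v$, a positive integer, and it is assumed that the number of edges between any two vertices $u,v$ is at most $\min(b_u,b_v)$. For a subgraph (sub-multiset of edges) $H$, $\delta_H(v)$ is the multi-set of edges of $H$ incident to $v$, $\deg_H(v)=|\delta_H(v)|$, and $\mathbf{w}\!\deg_H(v)=\sum_{e\in\delta_H(v)} w(e)$. A $b$-matching is a multi-set of edges $M$ with at most $b_v$ edges of $M$ incident to each $v$; its weight $w(M)$ is the sum of its edge weights. For integers $\beta\geq 3$ and $\beta^-\leq \beta-2$, a subgraph $H$ of $G$ is a $(\beta,\beta^-)$-$w$-$b$-EDCS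 of $G$ if (i) for every edge $(u,v,w_{uv})\in H$, $\frac{\mathbf{w}\!\deg_H(u)}{b_u}+\frac{\mathbf{w}\!\deg_H(v)}{b_v}\leq \beta\cdot w_{uv}$, and (ii) for every edge $(u,v,w_{uv})\in G\setminus H$, $\frac{\mathbf{w}\!\deg_H(u)}{b_u}+\frac{\mathbf{w}\!\deg_H(v)}{b_v}\geq \beta^-\cdot w_{uv}$. -}

module Defs where

open import Data.Nat as ℕ using (ℕ; zero; suc; _⊓_)
open import Data.Fin using (Fin; _≟_) renaming (zero to fzero; suc to fsuc)
open import Data.Fin.Subset using (Subset)
open import Data.Vec using (lookup)
open import Data.Bool using (Bool; true; false; if_then_else_; _∧_; _∨_)
open import Relation.Nullary.Decidable using (⌊_⌋)
open import Relation.Binary.PropositionalEquality using (_≡_; _≢_)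
open import Data.Integer using (+_)
open import Data.Rational using (ℚ; _/_; _+_; _*_; _≤_)
open import Data.Product using (_×_; ∃)
open import Function using (_∘_)

toℚ : ℕ → ℚ
toℚ n = + n / 1

-- a / d as a rational (only used with d ≥ 1, where it is genuine division).
ratio : ℕ → ℕ → ℚ
ratio a zero    = + 0 / 1
ratio a (suc d) = + a / suc d

record Edge (n : ℕ) : Set where
  constructor edge
  field
    src    : Fin n
    tgt    : Fin n
    weight : ℕ
open Edge public

-- A weighted multigraph with vertex set Fin n is given by a multiset of m edges,
-- presented as a family E : Fin m → Edge n (parallel edges = distinct indices).
-- A subgraph (sub-multiset of edges) is a Subset m of edge indices.

sumFin : ∀ m → (Fin m → ℕ) → ℕ
sumFin zero    f = 0
sumFin (suc m) f = f fzero ℕ.+ sumFin m (f ∘ fsuc)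

incident : ∀ {n} → Edge n → Fin n → Bool
incident e v = ⌊ src e ≟ v ⌋ ∨ ⌊ tgt e ≟ v ⌋

joins : ∀ {n} → Edge n → Fin n → Fin n → Bool
joins e u v = (⌊ src e ≟ u ⌋ ∧ ⌊ tgt e ≟ v ⌋) ∨ (⌊ src e ≟ v ⌋ ∧ ⌊ tgt e ≟ u ⌋)

module _ {n m : ℕ} (E : Fin m → Edge n) where

  deg : Subset m → Fin n → ℕ
  deg H v = sumFin m (λ i → if lookup H i ∧ incident (E i) v then 1 else 0)

  wdeg : Subset m → Fin n → ℕ
  wdeg H v = sumFin m (λ i → if lookup H i ∧ incident (E i) v then weight (E i) else 0)

  totalWeight : Subset m → ℕ
  totalWeight M = sumFin m (λ i → if lookup M i then weight (E i) else 0)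

  multiplicity : Fin n → Fin n → ℕ
  multiplicity u v = sumFin m (λ i → if joins (E i) u v then 1 else 0)

  IsWeightedMultiGraph : (W : ℕ) (b : Fin n → ℕ) → Set
  IsWeightedMultiGraph W b =
    (∀ i → src (E i) ≢ tgt (E i)) ×
    (∀ i → 1 ℕ.≤ weight (E i) × weight (E i) ℕ.≤ W) ×
    (∀ v → 1 ℕ.≤ b v) ×
    (∀ u v → multiplicity u v ℕ.≤ b u ⊓ b v)

  IsBMatching : (b : Fin n → ℕ) → Subset m → Set
  IsBMatching b M = ∀ v → deg M v ℕ.≤ b v

  IsMaxWeightBMatching : (b : Fin n → ℕ) → Subset m → Set
  IsMaxWeightBMatching b M =
    IsBMatching b M × (∀ M' → IsBMatching b M' → totalWeight M' ℕ.≤ totalWeight M)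

  load : (b : Fin n → ℕ) → Subset m → Fin m → ℚ
  load b H i = ratio (wdeg H (src (E i))) (b (src (E i)))
             + ratio (wdeg H (tgt (E i))) (b (tgt (E i)))

  IsEDCS : (β β⁻ : ℕ) (b : Fin n → ℕ) → Subset m → Set
  IsEDCS β β⁻ b H =
    (∀ i → lookup H i ≡ true → load b H i ≤ toℚ (β ℕ.* weight (E i))) ×
    (∀ i → lookup H i ≡ false → toℚ (β⁻ ℕ.* weight (E i)) ≤ load b H i)

expTerm : ℚ → ℕ → ℚ
expTerm x zero    = + 1 / 1
expTerm x (suc i) = expTerm x i * x * (+ 1 / suc i)

expPartial : ℚ → ℕ → ℚ
expPartial x zero    = + 0 / 1
expPartial x (suc k) = expPartial x k + expTerm x k

-- "ln y ≤ t" (natural logarithm), for rational t ≥ 0 and rational y > 0: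
-- equivalent to y ≤ e^t; since the partial sums increase to e^t and e^t is
-- irrational for rational t > 0 (and e^0 = 1 is reached at k = 1), this holds
-- iff some partial sum of the exponential series is ≥ y.
LnLe : ℚ → ℚ → Set
LnLe y t = ∃ λ k → y ≤ expPartial t k

module Submission where

-- Split every vertex v into b v copies of capacity one: the edges of a maximum b-matching M go to
-- distinct copies, and the remaining edges of H are distributed greedily, neighbour by neighbour.
-- Every copy of v then has H-weight d within W of wdeg(v)/b(v), and total weight at most 4W towards
-- any other copy.  With B = β + 6W the EDCS conditions become d(u) + d(v) ≤ B w on the edges of H and,
-- up to a factor 1 - λ, d(u) + d(v) ≥ B w on the others.
--
-- Choose a bipartition of the copies separating the ends of each edge of M, with signs picked one at a
-- time so that a weighted sum of squares of the deviations |2 dᶜ(u) - d(u)| stays below its average;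
-- here dᶜ(u) is the H-weight at u that crosses the bipartition.  Only these averages are needed, so
-- neither concentration bounds nor the local lemma appear.  A heaviest matching in the crossing part
-- of H has the weight Y of an integral vertex cover y of the crossing edges.
--
-- Put g(u) = d(u) - B y(u).  Then g(u) + g(x) ≤ 0 on crossing edges of H, whereas an edge of M whose
-- weight exceeds its cover by s ≥ 1 has g(u) + g(v) ≥ B s up to the error.  Double counting the
-- crossing edges at the vertices with g > 0, weighted by g, and completing squares on both sides shows
-- that the total excess is at most (1 - 1/(2W)) Y up to the error, hence w(M) ≤ (2 - 1/(2W)) Y + error.

open import Data.Nat
open import Data.Nat.Properties
open import Data.Nat.DivMod
open import Data.Nat.Divisibility using (∣-refl)
open import Data.Nat.Tactic.RingSolver using (solve-∀)
open import Data.Bool using (Bool; true; false; if_then_else_; _∧_; _xor_; not)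
import Data.Bool.Properties as Bool
open import Data.Fin using (Fin; toℕ; opposite; combine; remQuot; inject≤) renaming (zero to fzero; suc to fsuc)
import Data.Fin as Fin
open import Data.Fin.Permutation using (reverse)
import Data.Fin.Properties as Fin
open import Data.Fin.Subset using (Subset; _⊆_; ⊥)
open import Data.Fin.Subset.Properties using (anySubset?)
open import Data.Integer as ℤ using (ℤ; -[1+_]; ∣_∣)
import Data.Integer.Properties as ℤ
import Data.Integer.Tactic.RingSolver as ℤ-Solver
open import Data.Rational as ℚ using (ℚ; mkℚ)
import Data.Rational.Properties as ℚ
import Data.Rational.Solver as ℚ-Solver
open import Data.Rational.Unnormalised as ℚᵘ using (mkℚᵘ)
import Data.Rational.Unnormalised.Properties as ℚᵘ
open import Data.Product using (Σ; ∃; _×_; _,_; proj₁; proj₂)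
open import Data.Sum using (_⊎_; inj₁; inj₂)
open import Data.Vec using (lookup; tabulate)
open import Data.Vec.Properties using (lookup∘tabulate; lookup-replicate; []=⇒lookup; lookup⇒[]=)
open import Function using (_∘_)
open import Relation.Nullary using (¬_; Dec; yes; no; contradiction; ¬?; _×-dec_)
open import Relation.Nullary.Decidable using (⌊_⌋)
open import Relation.Binary.PropositionalEquality
open import Algebra.Properties.Semiring.Sum +-*-semiring
  using (sum; sum-cong-≗; ∑-distrib-+; ∑-comm; *-distribˡ-sum; *-distribʳ-sum; sum-permute)
import Algebra.Properties.Semiring.Sum ℤ.+-*-semiring as ℤ-Sum
open import Defs
open ℚ-Solver.+-*-Solver using (solve; _:+_; _:*_; _:-_; _:=_)

-- Finite sums and multigraphs

-- The gain `1/(2W)` comes from the integrality of the cover: an uncovered edge of M has excess at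
-- least 1, so there are at most as many such edges as the total excess E. Up to errors the argument
-- ends in `4W²E ≤ (2W-1)²Y + 2WE`, that is `2WE ≤ (2W-1)Y`; the last term is the price of
-- linearising `g²` at both ends of each uncovered edge. Counting with weight `g` alone would bound
-- the sum at a vertex of price y only by `B²y²/8`, quadratic in y. Adding `(W-1)B` to the weight of
-- each overloaded vertex and using `y ≤ W` turns this into `(2W-1)²B²y/(8W)`, which is linear and
-- sums to a multiple of Y. The deviations must be charged to `w(M)`, whatever the size of the
-- graph. They are counted at the ends of M and at the H-neighbours of these, with weights that are
-- fixed before the bipartition is chosen and total at most `6WB w(M)`. Under these weights the mean
-- square deviation is at most `4W²B`, while the hypothesis on β yields `λ²B ≥ 2W²`; so the
-- deviations are of order `λB` on average.

sumFin≡sum : ∀ {m} (f : Fin m → ℕ) → sumFin m f ≡ sum f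
sumFin≡sum {zero}  f = refl
sumFin≡sum {suc m} f = cong (f fzero +_) (sumFin≡sum (f ∘ fsuc))

sum-mono : ∀ {n} {f g : Fin n → ℕ} → (∀ i → f i ≤ g i) → sum f ≤ sum g
sum-mono {zero}  f≤g = z≤n
sum-mono {suc n} f≤g = +-mono-≤ (f≤g fzero) (sum-mono (f≤g ∘ fsuc))

sum-zero : ∀ {n} {f : Fin n → ℕ} → (∀ i → f i ≡ 0) → sum f ≡ 0
sum-zero {zero}  f≡0 = refl
sum-zero {suc n} f≡0 = cong₂ _+_ (f≡0 fzero) (sum-zero (f≡0 ∘ fsuc))

sum-const : ∀ n c → sum {n} (λ _ → c) ≡ n * c
sum-const zero    c = refl
sum-const (suc n) c = cong (c +_) (sum-const n c)

term≤sum : ∀ {n} (f : Fin n → ℕ) i → f i ≤ sum f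
term≤sum f fzero    = m≤m+n _ _
term≤sum f (fsuc i) = ≤-trans (term≤sum (f ∘ fsuc) i) (m≤n+m _ _)

sum-pos : ∀ {n} (f : Fin n → ℕ) → 0 < sum f → ∃ λ i → 0 < f i
sum-pos {suc n} f 0<Σ with f fzero in eq
... | suc k = fzero , subst (0 <_) (sym eq) z<s
... | zero with sum-pos (f ∘ fsuc) 0<Σ
...   | i , 0<fi = fsuc i , 0<fi

sum-linear : ∀ {n} (f g : Fin n → ℕ) a b → sum (λ i → a * f i + b * g i) ≡ a * sum f + b * sum g
sum-linear f g a b = trans (∑-distrib-+ (λ i → a * f i) (λ i → b * g i))
  (sym (cong₂ _+_ (*-distribˡ-sum a f) (*-distribˡ-sum b g)))

δ : ∀ {n} → Fin n → Fin n → ℕ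
δ i j = if ⌊ i Fin.≟ j ⌋ then 1 else 0

δ-refl : ∀ {n} (i : Fin n) → δ i i ≡ 1
δ-refl i with i Fin.≟ i
... | yes _  = refl
... | no i≢i = contradiction refl i≢i

δ-≢ : ∀ {n} {i j : Fin n} → i ≢ j → δ i j ≡ 0
δ-≢ {i = i} {j} i≢j with i Fin.≟ j
... | yes i≡j = contradiction i≡j i≢j
... | no _    = refl

δ≤1 : ∀ {n} (i j : Fin n) → δ i j ≤ 1
δ≤1 i j with i Fin.≟ j
... | yes _ = ≤-refl
... | no _  = z≤n

δ-pos : ∀ {n} {i j : Fin n} → 0 < δ i j → i ≡ j
δ-pos {i = i} {j} 0<δ with i Fin.≟ j
... | yes i≡j = i≡j

δ-suc : ∀ {n} (i j : Fin n) → δ (fsuc i) (fsuc j) ≡ δ i j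
δ-suc i j with i Fin.≟ j
... | yes _ = refl
... | no _  = refl

sum-δ : ∀ {n} (i : Fin n) (f : Fin n → ℕ) → sum (λ v → δ i v * f v) ≡ f i
sum-δ fzero    f = trans (cong₂ _+_ (*-identityˡ (f fzero)) (sum-zero {f = λ v → δ fzero (fsuc v) * f (fsuc v)} λ _ → refl)) (+-identityʳ _)
sum-δ (fsuc i) f = trans (sum-cong-≗ λ v → cong (_* f (fsuc v)) (δ-suc i v)) (sum-δ i (f ∘ fsuc))

fibre-sum : ∀ {N m} (q : Fin m → Fin N) (φ : Fin m → ℕ) → sum (λ u → sum λ f → δ (q f) u * φ f) ≡ sum φ
fibre-sum q φ = trans (∑-comm (λ u f → δ (q f) u * φ f)) (sum-cong-≗ λ f → sum-δ (q f) (λ _ → φ f))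

module Multigraph {N m : ℕ} (s t : Fin m → Fin N) where

  -- A loop at `u` would count twice both in `star μ u` and in `adj μ u u`, so `handshake` and
  -- `adj-row` hold for arbitrary ends.
  star : (Fin m → ℕ) → Fin N → ℕ
  star μ u = sum λ f → μ f * (δ (s f) u + δ (t f) u)

  adj : (Fin m → ℕ) → Fin N → Fin N → ℕ
  adj μ u v = sum λ f → μ f * (δ (s f) u * δ (t f) v + δ (t f) u * δ (s f) v)

  adj-sym : ∀ μ u v → adj μ u v ≡ adj μ v u
  adj-sym μ u v = sum-cong-≗ λ f → lemma (μ f) (δ (s f) u) (δ (t f) v) (δ (t f) u) (δ (s f) v)
    where
    lemma : ∀ μ a b c d → μ * (a * b + c * d) ≡ μ * (d * c + b * a)
    lemma = solve-∀

  handshake : ∀ μ (φ : Fin N → ℕ) → sum (λ u → star μ u * φ u) ≡ sum (λ f → μ f * (φ (s f) + φ (t f)))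
  handshake μ φ = begin
    sum (λ u → star μ u * φ u)
      ≡⟨ sum-cong-≗ (λ u → *-distribʳ-sum (φ u) (λ f → μ f * (δ (s f) u + δ (t f) u))) ⟩
    sum (λ u → sum λ f → μ f * (δ (s f) u + δ (t f) u) * φ u)
      ≡⟨ ∑-comm (λ u f → μ f * (δ (s f) u + δ (t f) u) * φ u) ⟩
    sum (λ f → sum λ u → μ f * (δ (s f) u + δ (t f) u) * φ u)
      ≡⟨ sum-cong-≗ edgewise ⟩
    sum (λ f → μ f * (φ (s f) + φ (t f))) ∎
    where
    open ≡-Reasoning
    rearrange : ∀ μ a b c → μ * (a + b) * c ≡ μ * (a * c) + μ * (b * c)
    rearrange = solve-∀
    edgewise : ∀ f → sum (λ u → μ f * (δ (s f) u + δ (t f) u) * φ u) ≡ μ f * (φ (s f) + φ (t f))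
    edgewise f = begin
      sum (λ u → μ f * (δ (s f) u + δ (t f) u) * φ u)
        ≡⟨ sum-cong-≗ (λ u → rearrange (μ f) (δ (s f) u) (δ (t f) u) (φ u)) ⟩
      sum (λ u → μ f * (δ (s f) u * φ u) + μ f * (δ (t f) u * φ u))
        ≡⟨ sum-linear (λ u → δ (s f) u * φ u) (λ u → δ (t f) u * φ u) (μ f) (μ f) ⟩
      μ f * sum (λ u → δ (s f) u * φ u) + μ f * sum (λ u → δ (t f) u * φ u)
        ≡⟨ cong₂ (λ a b → μ f * a + μ f * b) (sum-δ (s f) φ) (sum-δ (t f) φ) ⟩
      μ f * φ (s f) + μ f * φ (t f)
        ≡⟨ *-distribˡ-+ (μ f) (φ (s f)) (φ (t f)) ⟨
      μ f * (φ (s f) + φ (t f)) ∎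

  adj-row : ∀ μ u → sum (adj μ u) ≡ star μ u
  adj-row μ u = begin
    sum (λ v → sum λ f → μ f * (δ (s f) u * δ (t f) v + δ (t f) u * δ (s f) v))
      ≡⟨ ∑-comm (λ v f → μ f * (δ (s f) u * δ (t f) v + δ (t f) u * δ (s f) v)) ⟩
    sum (λ f → sum λ v → μ f * (δ (s f) u * δ (t f) v + δ (t f) u * δ (s f) v))
      ≡⟨ sum-cong-≗ edgewise ⟩
    star μ u ∎
    where
    open ≡-Reasoning
    rearrange : ∀ μ a b c d → μ * (a * b + c * d) ≡ (μ * a) * (b * 1) + (μ * c) * (d * 1)
    rearrange = solve-∀
    collect : ∀ μ a c → (μ * a) * 1 + (μ * c) * 1 ≡ μ * (a + c)
    collect = solve-∀
    edgewise : ∀ f → sum (λ v → μ f * (δ (s f) u * δ (t f) v + δ (t f) u * δ (s f) v)) ≡ μ f * (δ (s f) u + δ (t f) u)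
    edgewise f = begin
      sum (λ v → μ f * (δ (s f) u * δ (t f) v + δ (t f) u * δ (s f) v))
        ≡⟨ sum-cong-≗ (λ v → rearrange (μ f) (δ (s f) u) (δ (t f) v) (δ (t f) u) (δ (s f) v)) ⟩
      sum (λ v → (μ f * δ (s f) u) * (δ (t f) v * 1) + (μ f * δ (t f) u) * (δ (s f) v * 1))
        ≡⟨ sum-linear (λ v → δ (t f) v * 1) (λ v → δ (s f) v * 1) (μ f * δ (s f) u) (μ f * δ (t f) u) ⟩
      (μ f * δ (s f) u) * sum (λ v → δ (t f) v * 1) + (μ f * δ (t f) u) * sum (λ v → δ (s f) v * 1)
        ≡⟨ cong₂ (λ a b → (μ f * δ (s f) u) * a + (μ f * δ (t f) u) * b) (sum-δ (t f) (λ _ → 1)) (sum-δ (s f) (λ _ → 1)) ⟩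
      (μ f * δ (s f) u) * 1 + (μ f * δ (t f) u) * 1
        ≡⟨ collect (μ f) (δ (s f) u) (δ (t f) u) ⟩
      μ f * (δ (s f) u + δ (t f) u) ∎

  star-mono : ∀ {μ ν} → (∀ f → μ f ≤ ν f) → ∀ u → star μ u ≤ star ν u
  star-mono μ≤ν u = sum-mono λ f → *-monoˡ-≤ _ (μ≤ν f)

  adj-mono : ∀ {μ ν} → (∀ f → μ f ≤ ν f) → ∀ u v → adj μ u v ≤ adj ν u v
  adj-mono μ≤ν u v = sum-mono λ f → *-monoˡ-≤ _ (μ≤ν f)

-- Weighted degrees against a vertex cover

2ab≤a²+b² : ∀ a b → 2 * (a * b) ≤ a * a + b * b
2ab≤a²+b² a b with ≤-total a b
... | inj₁ a≤b with k , refl ← m≤n⇒∃[o]m+o≡n a≤b =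
  ≤-trans (m≤m+n _ (k * k)) (≤-reflexive (square a k))
  where
  square : ∀ a k → 2 * (a * (a + k)) + k * k ≡ a * a + (a + k) * (a + k)
  square = solve-∀
... | inj₂ b≤a with k , refl ← m≤n⇒∃[o]m+o≡n b≤a =
  ≤-trans (m≤m+n _ (k * k)) (≤-reflexive (square b k))
  where
  square : ∀ b k → 2 * ((b + k) * b) + k * k ≡ (b + k) * (b + k) + b * b
  square = solve-∀

-- Multiplied by y, the difference of the two sides is at least ((2W-1)By - 4Wc)², where W = V + 1.
priced-vertex-bound : ∀ V B T c d y e → let W = suc V in
  T + c * d ≤ c * (B * y) → 2 * c ≤ d + e → c ≤ d → y ≤ W →
  8 * W * T + 8 * W * V * B * c ≤ (2 * V + 1) * (2 * V + 1) * (B * B) * y + 8 * W * W * (c * e)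
-- For `y = 0` there is no factor to cancel; there `T + c * d ≤ 0`, and `c ≤ d` makes both terms on
-- the left vanish.
priced-vertex-bound V B T c d zero e T+cd≤ 2c≤ c≤d y≤W = begin
  8 * W * T + 8 * W * V * B * c ≡⟨ cong₂ (λ a b → 8 * W * a + 8 * W * V * B * b) T≡0 c≡0 ⟩
  8 * W * 0 + 8 * W * V * B * 0 ≡⟨ cong₂ _+_ (*-zeroʳ (8 * W)) (*-zeroʳ (8 * W * V * B)) ⟩
  0                             ≤⟨ z≤n ⟩
  _                             ∎
  where
  open ≤-Reasoning
  W = suc V
  T+cd≡0 : T + c * d ≡ 0
  T+cd≡0 = n≤0⇒n≡0 (≤-trans T+cd≤ (≤-reflexive (trans (cong (c *_) (*-zeroʳ B)) (*-zeroʳ c))))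
  T≡0 : T ≡ 0
  T≡0 = m+n≡0⇒m≡0 T T+cd≡0
  c≡0 : c ≡ 0
  c≡0 with m*n≡0⇒m≡0∨n≡0 c (m+n≡0⇒n≡0 T T+cd≡0)
  ... | inj₁ c≡0 = c≡0
  ... | inj₂ d≡0 = n≤0⇒n≡0 (≤-trans c≤d (≤-reflexive d≡0))
priced-vertex-bound V B T c d y@(suc y-1) e T+cd≤ 2c≤ c≤d y≤W =
  *-cancelˡ-≤ y (+-cancelʳ-≤ (16 * (W * W) * (c * c)) _ _ (begin
    y * (8 * W * T + 8 * W * V * B * c) + 16 * (W * W) * (c * c)
      ≡⟨ eq₁ W y T V B c ⟩
    8 * W * T * y + (8 * W * V * B * c * y + 8 * W * W * (c * (2 * c)))
      -- Trading `y` for `W` on `T` alone gives `T` and `c * d` the same coefficient, so the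
      -- hypothesis on `T + c * d` returns a factor `y`.
      ≤⟨ +-mono-≤ (*-monoʳ-≤ (8 * W * T) y≤W) (+-monoʳ-≤ (8 * W * V * B * c * y) (*-monoʳ-≤ (8 * W * W) (*-monoʳ-≤ c 2c≤))) ⟩
    8 * W * T * W + (8 * W * V * B * c * y + 8 * W * W * (c * (d + e)))
      ≡⟨ eq₂ W y T V B c d e ⟩
    8 * W * W * (T + c * d) + (8 * W * V * B * c * y + 8 * W * W * (c * e) * 1)
      ≤⟨ +-mono-≤ (*-monoʳ-≤ (8 * W * W) T+cd≤) (+-monoʳ-≤ (8 * W * V * B * c * y) (*-monoʳ-≤ (8 * W * W * (c * e)) (s≤s z≤n))) ⟩
    8 * W * W * (c * (B * y)) + (8 * W * V * B * c * y + 8 * W * W * (c * e) * y)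
      ≡⟨ eq₃ V y B c e ⟩
    2 * ((2 * V + 1) * B * y * (4 * W * c)) + 8 * W * W * (c * e) * y
      ≤⟨ +-monoˡ-≤ (8 * W * W * (c * e) * y) (2ab≤a²+b² ((2 * V + 1) * B * y) (4 * W * c)) ⟩
    ((2 * V + 1) * B * y * ((2 * V + 1) * B * y) + 4 * W * c * (4 * W * c)) + 8 * W * W * (c * e) * y
      ≡⟨ eq₄ V W y B c e ⟩
    y * ((2 * V + 1) * (2 * V + 1) * (B * B) * y + 8 * W * W * (c * e)) + 16 * (W * W) * (c * c) ∎))
  where
  open ≤-Reasoning
  W = suc V
  eq₁ : ∀ W y T V B c → y * (8 * W * T + 8 * W * V * B * c) + 16 * (W * W) * (c * c)
    ≡ 8 * W * T * y + (8 * W * V * B * c * y + 8 * W * W * (c * (2 * c)))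
  eq₁ = solve-∀
  eq₂ : ∀ W y T V B c d e → 8 * W * T * W + (8 * W * V * B * c * y + 8 * W * W * (c * (d + e)))
    ≡ 8 * W * W * (T + c * d) + (8 * W * V * B * c * y + 8 * W * W * (c * e) * 1)
  eq₂ = solve-∀
  eq₃ : ∀ V y B c e → 8 * suc V * suc V * (c * (B * y)) + (8 * suc V * V * B * c * y + 8 * suc V * suc V * (c * e) * y)
    ≡ 2 * ((2 * V + 1) * B * y * (4 * suc V * c)) + 8 * suc V * suc V * (c * e) * y
  eq₃ = solve-∀
  eq₄ : ∀ V W y B c e → ((2 * V + 1) * B * y * ((2 * V + 1) * B * y) + 4 * W * c * (4 * W * c)) + 8 * W * W * (c * e) * y
    ≡ y * ((2 * V + 1) * (2 * V + 1) * (B * B) * y + 8 * W * W * (c * e)) + 16 * (W * W) * (c * c)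
  eq₄ = solve-∀

pos : ℕ → ℕ
pos zero    = 0
pos (suc _) = 1

pos≤1 : ∀ n → pos n ≤ 1
pos≤1 zero    = z≤n
pos≤1 (suc _) = ≤-refl

-- Linearises g² by 4g² + B² ≥ 4Bg.
overloaded-vertex-bound : ∀ V B g c d e μ → let W = suc V in
  g ≤ d → d ≤ 2 * c + e → d ≤ B * W → μ ≤ 1 →
  4 * W * W * B * (μ * g) ≤ 8 * W * (μ * g * c) + 8 * W * V * B * (μ * pos g * c)
    + 4 * W * (2 * V + 1) * B * (μ * pos g * e) + W * (B * B) * μ
overloaded-vertex-bound V B g c d e zero _ _ _ _ =
  ≤-trans (≤-reflexive (*-zeroʳ (4 * suc V * suc V * B))) z≤n
overloaded-vertex-bound V B zero c d e μ@(suc _) _ _ _ _ =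
  ≤-trans (≤-reflexive (trans (cong (4 * suc V * suc V * B *_) (*-zeroʳ μ)) (*-zeroʳ (4 * suc V * suc V * B)))) z≤n
overloaded-vertex-bound V B (suc _) c d e (suc (suc _)) _ _ _ (s≤s ())
overloaded-vertex-bound V B g@(suc _) c d e (suc zero) g≤d d≤ d≤BW _ = begin
  4 * W * W * B * (1 * g)
    ≡⟨ eq₁ V B g ⟩
  4 * W * V * B * g + W * (2 * (2 * g * B))
    ≤⟨ +-monoʳ-≤ (4 * W * V * B * g) (*-monoʳ-≤ W (2ab≤a²+b² (2 * g) B)) ⟩
  4 * W * V * B * g + W * (2 * g * (2 * g) + B * B)
    ≡⟨ eq₂ W V B g ⟩
  4 * W * (g + V * B) * g + W * (B * B)
    -- One factor `g` is bounded through `d` by twice the crossing degree; the other factor,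
    -- `g + V * B`, is the weight used in the double counting, so the terms in `c` agree with those
    -- on the left of `priced-vertex-bound`.
    ≤⟨ +-monoˡ-≤ (W * (B * B)) (*-monoʳ-≤ (4 * W * (g + V * B)) (≤-trans g≤d d≤)) ⟩
  4 * W * (g + V * B) * (2 * c + e) + W * (B * B)
    ≡⟨ eq₃ W V B g c e ⟩
  (8 * W * (1 * g * c) + 8 * W * V * B * (1 * 1 * c)) + 4 * W * e * (g + V * B) + W * (B * B) * 1
    ≤⟨ +-monoˡ-≤ (W * (B * B) * 1) (+-monoʳ-≤ (8 * W * (1 * g * c) + 8 * W * V * B * (1 * 1 * c))
         (*-monoʳ-≤ (4 * W * e) (+-monoˡ-≤ (V * B) (≤-trans g≤d d≤BW)))) ⟩
  (8 * W * (1 * g * c) + 8 * W * V * B * (1 * 1 * c)) + 4 * W * e * (B * W + V * B) + W * (B * B) * 1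
    ≡⟨ cong (λ z → (8 * W * (1 * g * c) + 8 * W * V * B * (1 * 1 * c)) + z + W * (B * B) * 1) (eq₄ V B e) ⟩
  _ ∎
  where
  open ≤-Reasoning
  W = suc V
  eq₁ : ∀ V B g → 4 * suc V * suc V * B * (1 * g) ≡ 4 * suc V * V * B * g + suc V * (2 * (2 * g * B))
  eq₁ = solve-∀
  eq₂ : ∀ W V B g → 4 * W * V * B * g + W * (2 * g * (2 * g) + B * B) ≡ 4 * W * (g + V * B) * g + W * (B * B)
  eq₂ = solve-∀
  eq₃ : ∀ W V B g c e → 4 * W * (g + V * B) * (2 * c + e) + W * (B * B)
    ≡ (8 * W * (1 * g * c) + 8 * W * V * B * (1 * 1 * c)) + 4 * W * e * (g + V * B) + W * (B * B) * 1
  eq₃ = solve-∀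
  eq₄ : ∀ V B e → 4 * suc V * e * (B * suc V + V * B) ≡ 4 * suc V * (2 * V + 1) * B * (1 * 1 * e)
  eq₄ = solve-∀

sum-linear₄ : ∀ {n} (f g h k : Fin n → ℕ) a b c d →
  sum (λ i → a * f i + b * g i + c * h i + d * k i) ≡ a * sum f + b * sum g + c * sum h + d * sum k
sum-linear₄ f g h k a b c d = begin
  sum (λ i → a * f i + b * g i + c * h i + d * k i)
    ≡⟨ ∑-distrib-+ (λ i → a * f i + b * g i + c * h i) (λ i → d * k i) ⟩
  sum (λ i → a * f i + b * g i + c * h i) + sum (λ i → d * k i)
    ≡⟨ cong₂ _+_ (∑-distrib-+ (λ i → a * f i + b * g i) (λ i → c * h i)) (sym (*-distribˡ-sum d k)) ⟩
  sum (λ i → a * f i + b * g i) + sum (λ i → c * h i) + d * sum k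
    ≡⟨ cong (_+ d * sum k) (cong₂ _+_ (sum-linear f g a b) (sym (*-distribˡ-sum c h))) ⟩
  a * sum f + b * sum g + c * sum h + d * sum k ∎
  where open ≡-Reasoning

-- hw and cw are the weights of the edges of H, and of those of H that cross the bipartition; the edges
-- of M are given by the indicator Mk, and y covers the crossing edges of H.  In the proof the edges of
-- M with slack > 0 are the uncovered ones, and the overloaded vertices are their ends with d > By.
module CoverBound {N m : ℕ} (s t : Fin m → Fin N) (V B B⁻ : ℕ)
  (hw cw Mk w : Fin m → ℕ) (y e : Fin N → ℕ) where

  open Multigraph s t

  W = suc V
  d = star hw
  dᶜ = star cw
  h = λ x → sum λ u → adj hw x u * star Mk u
  wM = sum λ i → Mk i * w i
  gap = B ∸ B⁻

  module _
    (cw≤hw : ∀ f → cw f ≤ hw f)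
    (M-disjoint : ∀ u → star Mk u ≤ 1)
    (crossing : ∀ u v → 0 < adj cw u v → d u + d v ≤ B * (y u + y v))
    (d≤BW : ∀ u → d u ≤ B * W) (y≤W : ∀ u → y u ≤ W)
    (d≤2dᶜ+e : ∀ u → d u ≤ 2 * dᶜ u + e u) (2dᶜ≤d+e : ∀ u → 2 * dᶜ u ≤ d u + e u)
    (M-edges : ∀ i → 0 < Mk i → w i ≤ y (s i) + y (t i) ⊎ B⁻ * w i ≤ d (s i) + d (t i))
    where

    slack = λ i → w i ∸ (y (s i) + y (t i))
    U = λ i → Mk i * pos (slack i)
    μ = star U
    g = λ u → d u ∸ B * y u
    G = λ u → μ u * g u
    π = λ u → μ u * pos (g u)
    -- Since `μ ≤ 1`, `π` is the indicator of the overloaded vertices and `G` is `g` restricted to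
    -- them. `T` and `c` collect them over the crossing edges at `x`.
    T = λ x → sum λ u → adj cw x u * G u
    c = λ x → sum λ u → adj cw x u * π u

    U≤Mk : ∀ i → U i ≤ Mk i
    U≤Mk i = ≤-trans (*-monoʳ-≤ (Mk i) (pos≤1 (slack i))) (≤-reflexive (*-identityʳ (Mk i)))

    μ≤star : ∀ u → μ u ≤ star Mk u
    μ≤star = star-mono U≤Mk

    π≤star : ∀ u → π u ≤ star Mk u
    π≤star u = ≤-trans (*-mono-≤ (μ≤star u) (pos≤1 (g u))) (≤-reflexive (*-identityʳ _))

    π≤1 : ∀ u → π u ≤ 1
    π≤1 u = ≤-trans (π≤star u) (M-disjoint u)

    c≤dᶜ : ∀ x → c x ≤ dᶜ x
    c≤dᶜ x = begin
      sum (λ u → adj cw x u * π u) ≤⟨ sum-mono (λ u → *-monoʳ-≤ (adj cw x u) (π≤1 u)) ⟩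
      sum (λ u → adj cw x u * 1)   ≡⟨ sum-cong-≗ (λ u → *-identityʳ (adj cw x u)) ⟩
      sum (adj cw x)               ≡⟨ adj-row cw x ⟩
      dᶜ x                         ∎
      where open ≤-Reasoning

    -- `c` depends on the bipartition and on the cover, `h` on neither. Only because of this
    -- replacement can the weights of the deviations be fixed before the bipartition is chosen.
    c≤h : ∀ x → c x ≤ h x
    c≤h x = sum-mono λ u → *-mono-≤ (adj-mono cw≤hw x u) (π≤star u)

    -- Across each crossing edge from `x` to an overloaded `u`, the bound on `d u + d x` becomes
    -- `g u + d x ≤ B * y x`: the truncated subtraction in `g u` is exact there, so `B * y u`
    -- cancels.
    T+cd≤cBy : ∀ x → T x + c x * d x ≤ c x * (B * y x)
    T+cd≤cBy x = begin
      T x + c x * d x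
        ≡⟨ cong (T x +_) (*-distribʳ-sum (d x) (λ u → adj cw x u * π u)) ⟩
      T x + sum (λ u → adj cw x u * π u * d x)
        ≡⟨ ∑-distrib-+ (λ u → adj cw x u * G u) (λ u → adj cw x u * π u * d x) ⟨
      sum (λ u → adj cw x u * G u + adj cw x u * π u * d x)
        ≤⟨ sum-mono termwise ⟩
      sum (λ u → adj cw x u * π u * (B * y x))
        ≡⟨ *-distribʳ-sum (B * y x) (λ u → adj cw x u * π u) ⟨
      c x * (B * y x) ∎
      where
      open ≤-Reasoning
      termwise : ∀ u → adj cw x u * G u + adj cw x u * π u * d x ≤ adj cw x u * π u * (B * y x)
      termwise u with adj cw x u in adj≡ | d u ∸ B * y u in g≡
      ... | zero  | _    = z≤n
      ... | a@(suc _) | zero = ≤-reflexive (eq a (μ u) (d x) (B * y x))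
        where
        eq : ∀ a μ d b → a * (μ * 0) + a * (μ * 0) * d ≡ a * (μ * 0) * b
        eq = solve-∀
      ... | a@(suc _) | k@(suc _) = begin
        a * (μ u * k) + a * (μ u * 1) * d x ≡⟨ eq a (μ u) k (d x) ⟩
        a * (μ u * 1) * (k + d x)           ≤⟨ *-monoʳ-≤ (a * (μ u * 1)) k+d≤ ⟩
        a * (μ u * 1) * (B * y x)           ∎
        where
        eq : ∀ a μ k d → a * (μ * k) + a * (μ * 1) * d ≡ a * (μ * 1) * (k + d)
        eq = solve-∀
        By<d : B * y u ≤ d u
        By<d = <⇒≤ (m∸n≢0⇒n<m λ z → 0≢1+n (trans (sym z) g≡))
        k+d≤ : k + d x ≤ B * y x
        k+d≤ = +-cancelˡ-≤ (B * y u) _ _ (begin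
          B * y u + (k + d x) ≡⟨ +-assoc (B * y u) k (d x) ⟨
          B * y u + k + d x   ≡⟨ cong (λ z → B * y u + z + d x) (sym g≡) ⟩
          B * y u + (d u ∸ B * y u) + d x ≡⟨ cong (_+ d x) (m+[n∸m]≡n By<d) ⟩
          d u + d x           ≡⟨ +-comm (d u) (d x) ⟩
          d x + d u           ≤⟨ crossing x u (subst (0 <_) (sym adj≡) z<s) ⟩
          B * (y x + y u)     ≡⟨ *-distribˡ-+ B (y x) (y u) ⟩
          B * y x + B * y u   ≡⟨ +-comm (B * y x) (B * y u) ⟩
          B * y u + B * y x   ∎)

    double-count : ∀ (φ : Fin N → ℕ) → sum (λ x → sum λ u → adj cw x u * φ u) ≡ sum (λ u → φ u * dᶜ u)
    double-count φ = begin
      sum (λ x → sum λ u → adj cw x u * φ u) ≡⟨ ∑-comm (λ x u → adj cw x u * φ u) ⟩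
      sum (λ u → sum λ x → adj cw x u * φ u) ≡⟨ sum-cong-≗ (λ u → *-distribʳ-sum (φ u) (λ x → adj cw x u)) ⟨
      sum (λ u → sum (λ x → adj cw x u) * φ u)
        ≡⟨ sum-cong-≗ (λ u → cong (_* φ u) (trans (sum-cong-≗ λ x → adj-sym cw x u) (adj-row cw u))) ⟩
      sum (λ u → dᶜ u * φ u)                 ≡⟨ sum-cong-≗ (λ u → *-comm (dᶜ u) (φ u)) ⟩
      sum (λ u → φ u * dᶜ u)                 ∎
      where open ≡-Reasoning

    Y = sum y
    S = sum G
    Eʰ = sum λ x → h x * e x
    Eᴹ = sum λ u → star Mk u * e u
    #U = sum U
    Slack = sum λ i → U i * slack i

    priced-vertices : 8 * W * sum T + 8 * W * V * B * sum c ≤ (2 * V + 1) * (2 * V + 1) * (B * B) * Y + 8 * W * W * Eʰ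
    priced-vertices = begin
      8 * W * sum T + 8 * W * V * B * sum c
        ≡⟨ sum-linear T c (8 * W) (8 * W * V * B) ⟨
      sum (λ x → 8 * W * T x + 8 * W * V * B * c x)
        ≤⟨ sum-mono (λ x → priced-vertex-bound V B (T x) (c x) (d x) (y x) (e x) (T+cd≤cBy x)
             (≤-trans (*-monoʳ-≤ 2 (c≤dᶜ x)) (2dᶜ≤d+e x)) (≤-trans (c≤dᶜ x) (star-mono cw≤hw x)) (y≤W x)) ⟩
      sum (λ x → (2 * V + 1) * (2 * V + 1) * (B * B) * y x + 8 * W * W * (c x * e x))
        ≡⟨ sum-linear y (λ x → c x * e x) ((2 * V + 1) * (2 * V + 1) * (B * B)) (8 * W * W) ⟩
      (2 * V + 1) * (2 * V + 1) * (B * B) * Y + 8 * W * W * sum (λ x → c x * e x)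
        ≤⟨ +-monoʳ-≤ ((2 * V + 1) * (2 * V + 1) * (B * B) * Y) (*-monoʳ-≤ (8 * W * W) (sum-mono λ x → *-monoˡ-≤ (e x) (c≤h x))) ⟩
      (2 * V + 1) * (2 * V + 1) * (B * B) * Y + 8 * W * W * Eʰ ∎
      where open ≤-Reasoning

    sum-μ : sum μ ≡ 2 * #U
    sum-μ = begin
      sum μ                   ≡⟨ sum-cong-≗ (λ u → *-identityʳ (μ u)) ⟨
      sum (λ u → μ u * 1)     ≡⟨ handshake U (λ _ → 1) ⟩
      sum (λ i → U i * 2)     ≡⟨ *-distribʳ-sum 2 U ⟨
      #U * 2                  ≡⟨ *-comm #U 2 ⟩
      2 * #U                  ∎
      where open ≡-Reasoning

    overloaded-vertices : 4 * W * W * B * S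
      ≤ 8 * W * sum T + 8 * W * V * B * sum c + 4 * W * (2 * V + 1) * B * Eᴹ + W * (B * B) * (2 * #U)
    overloaded-vertices = begin
      4 * W * W * B * S
        ≡⟨ *-distribˡ-sum (4 * W * W * B) G ⟩
      sum (λ u → 4 * W * W * B * G u)
        ≤⟨ sum-mono (λ u → overloaded-vertex-bound V B (g u) (dᶜ u) (d u) (e u) (μ u) (m∸n≤m (d u) (B * y u))
             (d≤2dᶜ+e u) (d≤BW u) (≤-trans (μ≤star u) (M-disjoint u))) ⟩
      sum (λ u → 8 * W * (G u * dᶜ u) + 8 * W * V * B * (π u * dᶜ u) + 4 * W * (2 * V + 1) * B * (π u * e u) + W * (B * B) * μ u)
        ≡⟨ sum-linear₄ (λ u → G u * dᶜ u) (λ u → π u * dᶜ u) (λ u → π u * e u) μ (8 * W) (8 * W * V * B) (4 * W * (2 * V + 1) * B) (W * (B * B)) ⟩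
      8 * W * sum (λ u → G u * dᶜ u) + 8 * W * V * B * sum (λ u → π u * dᶜ u) + 4 * W * (2 * V + 1) * B * sum (λ u → π u * e u) + W * (B * B) * sum μ
        ≡⟨ cong₂ (λ a b → 8 * W * a + 8 * W * V * B * b + 4 * W * (2 * V + 1) * B * sum (λ u → π u * e u) + W * (B * B) * sum μ) (sym (double-count G)) (sym (double-count π)) ⟩
      8 * W * sum T + 8 * W * V * B * sum c + 4 * W * (2 * V + 1) * B * sum (λ u → π u * e u) + W * (B * B) * sum μ
        ≤⟨ +-mono-≤ (+-monoʳ-≤ (8 * W * sum T + 8 * W * V * B * sum c) (*-monoʳ-≤ (4 * W * (2 * V + 1) * B) (sum-mono λ u → *-monoˡ-≤ (e u) (π≤star u))))
             (≤-reflexive (cong (W * (B * B) *_) sum-μ)) ⟩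
      8 * W * sum T + 8 * W * V * B * sum c + 4 * W * (2 * V + 1) * B * Eᴹ + W * (B * B) * (2 * #U) ∎
      where open ≤-Reasoning

    -- Integrality at work: weights and cover are natural numbers, so a positive slack is at least
    -- 1.
    #U≤Slack : #U ≤ Slack
    #U≤Slack = sum-mono termwise
      where
      termwise : ∀ i → U i ≤ U i * slack i
      termwise i with slack i
      ... | zero  = ≤-reflexive (trans (*-zeroʳ (Mk i)) (sym (*-zeroʳ (Mk i * 0))))
      ... | suc k = ≤-trans (≤-reflexive (sym (*-identityʳ (Mk i * 1)))) (*-monoʳ-≤ (Mk i * 1) (s≤s z≤n))

    -- An uncovered edge of M satisfies the lower degree condition; replacing `B⁻` by `B` in it
    -- costs `gap * w i`. Truncation in `g` is harmless, since only `d ≤ B * y + g` is used.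
    BSlack≤S+gap : B * Slack ≤ S + gap * wM
    BSlack≤S+gap = begin
      B * Slack                           ≡⟨ *-distribˡ-sum B (λ i → U i * slack i) ⟩
      sum (λ i → B * (U i * slack i))     ≤⟨ sum-mono termwise ⟩
      sum (λ i → U i * (g (s i) + g (t i)) + gap * (Mk i * w i))
        ≡⟨ ∑-distrib-+ (λ i → U i * (g (s i) + g (t i))) (λ i → gap * (Mk i * w i)) ⟩
      sum (λ i → U i * (g (s i) + g (t i))) + sum (λ i → gap * (Mk i * w i))
        ≡⟨ cong₂ _+_ (handshake U g) (*-distribˡ-sum gap (λ i → Mk i * w i)) ⟨
      S + gap * wM ∎
      where
      open ≤-Reasoning
      uncovered : ∀ i → 0 < Mk i → y (s i) + y (t i) ≤ w i → w i ≰ y (s i) + y (t i) →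
        B * slack i ≤ (g (s i) + g (t i)) + gap * w i
      uncovered i 0<Mk y≤w w≰y with M-edges i 0<Mk
      ... | inj₁ w≤y = contradiction w≤y w≰y
      ... | inj₂ B⁻w≤d = +-cancelʳ-≤ (B * (ys + yt)) _ _ (begin
        B * slack i + B * (ys + yt)       ≡⟨ *-distribˡ-+ B (slack i) (ys + yt) ⟨
        B * (slack i + (ys + yt))         ≡⟨ cong (B *_) (m∸n+n≡m y≤w) ⟩
        B * w i                           ≤⟨ *-monoˡ-≤ (w i) (m≤n+m∸n B B⁻) ⟩
        (B⁻ + gap) * w i                  ≡⟨ *-distribʳ-+ (w i) B⁻ gap ⟩
        B⁻ * w i + gap * w i              ≤⟨ +-monoˡ-≤ (gap * w i) B⁻w≤d ⟩
        d (s i) + d (t i) + gap * w i     ≤⟨ +-monoˡ-≤ (gap * w i) (+-mono-≤ (m≤n+m∸n (d (s i)) (B * ys)) (m≤n+m∸n (d (t i)) (B * yt))) ⟩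
        B * ys + g (s i) + (B * yt + g (t i)) + gap * w i ≡⟨ eq B ys yt (g (s i)) (g (t i)) (gap * w i) ⟩
        g (s i) + g (t i) + gap * w i + B * (ys + yt) ∎)
        where
        ys = y (s i)
        yt = y (t i)
        eq : ∀ B a b c d e → B * a + c + (B * b + d) + e ≡ c + d + e + B * (a + b)
        eq = solve-∀
      termwise : ∀ i → B * (U i * slack i) ≤ U i * (g (s i) + g (t i)) + gap * (Mk i * w i)
      termwise i with Mk i in Mk≡ | w i ∸ (y (s i) + y (t i)) in slack≡
      ... | zero  | _    = ≤-trans (≤-reflexive (*-zeroʳ B)) z≤n
      ... | k@(suc _) | zero = ≤-trans (≤-reflexive (trans (cong (B *_) (*-zeroʳ (k * 0))) (*-zeroʳ B))) z≤n
      ... | k@(suc _) | l@(suc _) = begin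
        B * (k * 1 * l)                               ≡⟨ eq₁ B k l ⟩
        k * (B * l)                                   ≤⟨ *-monoʳ-≤ k (subst (λ z → B * z ≤ g (s i) + g (t i) + gap * w i) slack≡
                                                           (uncovered i (subst (0 <_) (sym Mk≡) z<s) (<⇒≤ y<w) (<⇒≱ y<w))) ⟩
        k * ((g (s i) + g (t i)) + gap * w i)         ≡⟨ eq₂ k (g (s i) + g (t i)) gap (w i) ⟩
        k * 1 * (g (s i) + g (t i)) + gap * (k * w i) ∎
        where
        y<w : y (s i) + y (t i) < w i
        y<w = m∸n≢0⇒n<m λ z → 0≢1+n (trans (sym z) slack≡)
        eq₁ : ∀ B k l → B * (k * 1 * l) ≡ k * (B * l)
        eq₁ = solve-∀
        eq₂ : ∀ k x b w → k * (x + b * w) ≡ k * 1 * x + b * (k * w)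
        eq₂ = solve-∀

    slack-bound : 2 * W * (B * B) * Slack
      ≤ (2 * V + 1) * (B * B) * Y + 8 * W * Eʰ + 4 * W * B * Eᴹ + 4 * W * B * (gap * wM)
    -- With `W = V + 1`, `4W² - 2W = (2W-1) * 2W`: once the term from `#U` is absorbed, one factor
    -- `2W - 1 = 2V + 1` of the square in `priced-vertices` cancels.
    slack-bound = *-cancelˡ-≤ (suc (2 * V)) (+-cancelʳ-≤ (2 * W * (B * B) * Slack) _ _ (begin
      suc (2 * V) * (2 * W * (B * B) * Slack) + 2 * W * (B * B) * Slack
        ≡⟨ eq₁ V B Slack ⟩
      4 * W * W * B * (B * Slack)
        ≤⟨ *-monoʳ-≤ (4 * W * W * B) BSlack≤S+gap ⟩
      4 * W * W * B * (S + gap * wM)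
        ≡⟨ *-distribˡ-+ (4 * W * W * B) S (gap * wM) ⟩
      4 * W * W * B * S + 4 * W * W * B * (gap * wM)
        ≤⟨ +-monoˡ-≤ _ overloaded-vertices ⟩
      8 * W * sum T + 8 * W * V * B * sum c + 4 * W * (2 * V + 1) * B * Eᴹ + W * (B * B) * (2 * #U) + 4 * W * W * B * (gap * wM)
        ≤⟨ +-mono-≤ (+-mono-≤ (+-monoˡ-≤ (4 * W * (2 * V + 1) * B * Eᴹ) priced-vertices) (*-monoʳ-≤ (W * (B * B)) (*-monoʳ-≤ 2 #U≤Slack))) ≤-refl ⟩
      (2 * V + 1) * (2 * V + 1) * (B * B) * Y + 8 * W * W * Eʰ + 4 * W * (2 * V + 1) * B * Eᴹ + W * (B * B) * (2 * Slack) + 4 * W * W * B * (gap * wM)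
        -- The padding raises the error coefficients from multiples of `W` to multiples of
        -- `W + V = 2V + 1`, so that they share the factor to be cancelled.
        ≤⟨ ≤-trans (m≤m+n _ (8 * W * V * Eʰ + 4 * W * V * B * (gap * wM))) (≤-reflexive (eq₂ V B Y Eʰ Eᴹ Slack (gap * wM))) ⟩
      suc (2 * V) * ((2 * V + 1) * (B * B) * Y + 8 * W * Eʰ + 4 * W * B * Eᴹ + 4 * W * B * (gap * wM)) + 2 * W * (B * B) * Slack ∎))
      where
      open ≤-Reasoning
      eq₁ : ∀ V B S → suc (2 * V) * (2 * suc V * (B * B) * S) + 2 * suc V * (B * B) * S ≡ 4 * suc V * suc V * B * (B * S)
      eq₁ = solve-∀
      eq₂ : ∀ V B Y H M S Δ →
        (2 * V + 1) * (2 * V + 1) * (B * B) * Y + 8 * suc V * suc V * H + 4 * suc V * (2 * V + 1) * B * M + suc V * (B * B) * (2 * S) + 4 * suc V * suc V * B * Δ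
          + (8 * suc V * V * H + 4 * suc V * V * B * Δ)
        ≡ suc (2 * V) * ((2 * V + 1) * (B * B) * Y + 8 * suc V * H + 4 * suc V * B * M + 4 * suc V * B * Δ) + 2 * suc V * (B * B) * S
      eq₂ = solve-∀

    -- Each edge of M is paid for by the prices of its ends plus its slack; M being a matching,
    -- every vertex price is spent at most once.
    wM≤Y+Slack : wM ≤ Y + Slack
    wM≤Y+Slack = begin
      wM ≤⟨ sum-mono termwise ⟩
      sum (λ i → Mk i * (y (s i) + y (t i)) + U i * slack i)
        ≡⟨ ∑-distrib-+ (λ i → Mk i * (y (s i) + y (t i))) (λ i → U i * slack i) ⟩
      sum (λ i → Mk i * (y (s i) + y (t i))) + Slack
        ≡⟨ cong (_+ Slack) (handshake Mk y) ⟨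
      sum (λ u → star Mk u * y u) + Slack
        ≤⟨ +-monoˡ-≤ Slack (sum-mono λ u → ≤-trans (*-monoˡ-≤ (y u) (M-disjoint u)) (≤-reflexive (*-identityˡ (y u)))) ⟩
      Y + Slack ∎
      where
      open ≤-Reasoning
      pos-absorb : ∀ k → pos k * k ≡ k
      pos-absorb zero    = refl
      pos-absorb (suc k) = *-identityˡ (suc k)
      termwise : ∀ i → Mk i * w i ≤ Mk i * (y (s i) + y (t i)) + U i * slack i
      termwise i = begin
        Mk i * w i ≤⟨ *-monoʳ-≤ (Mk i) (m≤n+m∸n (w i) (y (s i) + y (t i))) ⟩
        Mk i * (y (s i) + y (t i) + slack i) ≡⟨ *-distribˡ-+ (Mk i) (y (s i) + y (t i)) (slack i) ⟩
        Mk i * (y (s i) + y (t i)) + Mk i * slack i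
          ≡⟨ cong (λ z → Mk i * (y (s i) + y (t i)) + Mk i * z) (pos-absorb (slack i)) ⟨
        Mk i * (y (s i) + y (t i)) + Mk i * (pos (slack i) * slack i)
          ≡⟨ cong (Mk i * (y (s i) + y (t i)) +_) (*-assoc (Mk i) (pos (slack i)) (slack i)) ⟨
        Mk i * (y (s i) + y (t i)) + U i * slack i ∎

    cover-bound : 2 * W * (B * B) * wM
      ≤ (4 * V + 3) * (B * B) * Y + 8 * W * Eʰ + 4 * W * B * Eᴹ + 4 * W * B * (gap * wM)
    cover-bound = begin
      2 * W * (B * B) * wM
        ≤⟨ *-monoʳ-≤ (2 * W * (B * B)) wM≤Y+Slack ⟩
      2 * W * (B * B) * (Y + Slack)
        ≡⟨ *-distribˡ-+ (2 * W * (B * B)) Y Slack ⟩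
      2 * W * (B * B) * Y + 2 * W * (B * B) * Slack
        ≤⟨ +-monoʳ-≤ (2 * W * (B * B) * Y) slack-bound ⟩
      2 * W * (B * B) * Y + ((2 * V + 1) * (B * B) * Y + 8 * W * Eʰ + 4 * W * B * Eᴹ + 4 * W * B * (gap * wM))
        ≡⟨ eq V (B * B) Y (8 * W * Eʰ) (4 * W * B * Eᴹ) (4 * W * B * (gap * wM)) ⟩
      (4 * V + 3) * (B * B) * Y + 8 * W * Eʰ + 4 * W * B * Eᴹ + 4 * W * B * (gap * wM) ∎
      where
      open ≤-Reasoning
      eq : ∀ V b Y h m Δ → 2 * suc V * b * Y + ((2 * V + 1) * b * Y + h + m + Δ) ≡ (4 * V + 3) * b * Y + h + m + Δ
      eq = solve-∀

-- Integral duality in bipartite multigraphs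

argmax : ∀ {m} {P : Fin m → Set} → (∀ i → Dec (P i)) → (φ : Fin m → ℕ) →
  ∃ P → ∃ λ i → P i × (∀ j → P j → φ j ≤ φ i)
argmax {zero}  P? φ (() , _)
argmax {suc m} {P} P? φ ∃P with Fin.any? (λ i → P? (fsuc i))
argmax {suc m} {P} P? φ (fzero , P0) | no ∄P = fzero , P0 , max
  where
  max : ∀ j → P j → φ j ≤ φ fzero
  max fzero    _  = ≤-refl
  max (fsuc j) Pj = contradiction (j , Pj) ∄P
argmax {suc m} {P} P? φ (fsuc i , Pi) | no ∄P = contradiction (i , Pi) ∄P
argmax {suc m} {P} P? φ _ | yes ∃P with argmax (λ i → P? (fsuc i)) (φ ∘ fsuc) ∃P | P? fzero
... | i , Pi , max | no ¬P0 = fsuc i , Pi , max′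
  where
  max′ : ∀ j → P j → φ j ≤ φ (fsuc i)
  max′ fzero    P0 = contradiction P0 ¬P0
  max′ (fsuc j) Pj = max j Pj
... | i , Pi , max | yes P0 with ≤-total (φ fzero) (φ (fsuc i))
...   | inj₁ φ0≤ = fsuc i , Pi , λ { fzero _ → φ0≤ ; (fsuc j) Pj → max j Pj }
...   | inj₂ ≤φ0 = fzero , P0 , λ { fzero _ → ≤-refl ; (fsuc j) Pj → ≤-trans (max j Pj) ≤φ0 }

ι : Bool → ℕ
ι true  = 1
ι false = 0

ι≤1 : ∀ b → ι b ≤ 1
ι≤1 true  = ≤-refl
ι≤1 false = z≤n

module Auction {N m : ℕ} (F : Fin m → Bool) (l r : Fin m → Fin N) (v : Fin m → ℕ) where

  -- l f is the bidder and r f the item of f; content is complementary slackness up to one unit.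
  record State : Set where
    field
      A       : Fin m → Bool
      p       : Fin N → ℕ
      A⊆F     : ∀ {f} → A f ≡ true → F f ≡ true
      l-inj   : ∀ {f g} → A f ≡ true → A g ≡ true → l f ≡ l g → f ≡ g
      r-inj   : ∀ {f g} → A f ≡ true → A g ≡ true → r f ≡ r g → f ≡ g
      sold    : ∀ {x} → 0 < p x → ∃ λ f → A f ≡ true × r f ≡ x
      p≤v     : ∀ {f} → A f ≡ true → p (r f) ≤ v f
      content : ∀ {f g} → A f ≡ true → F g ≡ true → l g ≡ l f → v g + p (r f) ≤ v f + p (r g) + 1

  open State

  Terminal : State → Set
  Terminal S = ∀ {f} → F f ≡ true → (∃ λ g → A S g ≡ true × l g ≡ l f) ⊎ v f ≤ p S (r f)

  initial : State
  initial = record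
    { A = λ _ → false ; p = λ _ → 0 ; A⊆F = λ () ; l-inj = λ () ; r-inj = λ () ; sold = λ () ; p≤v = λ () ; content = λ () }

  Bids : State → Fin m → Set
  Bids S f = F f ≡ true × p S (r f) < v f × ¬ ∃ λ g → A S g ≡ true × l g ≡ l f

  bids? : ∀ S f → Dec (Bids S f)
  bids? S f = (F f Bool.≟ true) ×-dec (p S (r f) <? v f) ×-dec ¬? (Fin.any? λ g → (A S g Bool.≟ true) ×-dec (l g Fin.≟ l f))

  module _ (S : State) {f₀ : Fin m} (bid : Bids S f₀) where

    -- `f₀` only witnesses that its bidder still has a profitable item. The bid is placed on a most
    -- profitable one, as `content` demands of the new assignment.
    best : ∃ λ f → (F f ≡ true × l f ≡ l f₀) × (∀ g → F g ≡ true × l g ≡ l f₀ → v g ∸ p S (r g) ≤ v f ∸ p S (r f))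
    best = argmax (λ f → (F f Bool.≟ true) ×-dec (l f Fin.≟ l f₀)) (λ f → v f ∸ p S (r f)) (f₀ , proj₁ bid , refl)

    private
      f⁺ = proj₁ best
      Ff⁺ = proj₁ (proj₁ (proj₂ best))
      lf⁺ = proj₂ (proj₁ (proj₂ best))
      x⁺ = r f⁺

    p<v⁺ : p S x⁺ < v f⁺
    p<v⁺ = m∸n≢0⇒n<m λ z → <⇒≢ (m<n⇒0<n∸m (proj₁ (proj₂ bid)))
      (sym (n≤0⇒n≡0 (≤-trans (proj₂ (proj₂ best) f₀ (proj₁ bid , refl)) (≤-reflexive z))))

    best-margin : ∀ {g} → F g ≡ true → l g ≡ l f⁺ → v g + p S x⁺ ≤ v f⁺ + p S (r g)
    best-margin {g} Fg lg = begin
      v g + p S x⁺                               ≤⟨ +-monoˡ-≤ (p S x⁺) (m≤n+m∸n (v g) (p S (r g))) ⟩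
      p S (r g) + (v g ∸ p S (r g)) + p S x⁺     ≤⟨ +-monoˡ-≤ (p S x⁺) (+-monoʳ-≤ (p S (r g)) (proj₂ (proj₂ best) g (Fg , trans lg lf⁺))) ⟩
      p S (r g) + (v f⁺ ∸ p S x⁺) + p S x⁺       ≡⟨ +-assoc (p S (r g)) _ _ ⟩
      p S (r g) + (v f⁺ ∸ p S x⁺ + p S x⁺)       ≡⟨ cong (p S (r g) +_) (m∸n+n≡m (<⇒≤ p<v⁺)) ⟩
      p S (r g) + v f⁺                           ≡⟨ +-comm (p S (r g)) (v f⁺) ⟩
      v f⁺ + p S (r g)                           ∎
      where open ≤-Reasoning

    -- The winner takes `x⁺`, and the previous buyer of that item, if any, becomes unassigned.
    A′ : Fin m → Bool
    A′ f with f Fin.≟ f⁺ | r f Fin.≟ x⁺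
    ... | yes _ | _     = true
    ... | no _  | yes _ = false
    ... | no _  | no _  = A S f

    A′-cases : ∀ f → A′ f ≡ true → f ≡ f⁺ ⊎ (A S f ≡ true × r f ≢ x⁺)
    A′-cases f A′f with f Fin.≟ f⁺ | r f Fin.≟ x⁺
    ... | yes f≡ | _      = inj₁ f≡
    ... | no _   | no r≢ = inj₂ (A′f , r≢)

    A′-new : A′ f⁺ ≡ true
    A′-new with f⁺ Fin.≟ f⁺ | r f⁺ Fin.≟ x⁺
    ... | yes _ | _ = refl
    ... | no ≢  | _ = contradiction refl ≢

    A′-old : ∀ {f} → A S f ≡ true → r f ≢ x⁺ → A′ f ≡ true
    A′-old {f} Af r≢ with f Fin.≟ f⁺ | r f Fin.≟ x⁺
    ... | yes _ | _      = refl
    ... | no _  | yes r≡ = contradiction r≡ r≢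
    ... | no _  | no _   = Af

    p′ : Fin N → ℕ
    p′ x = δ x⁺ x + p S x

    p′-new : p′ x⁺ ≡ suc (p S x⁺)
    p′-new = cong (_+ p S x⁺) (δ-refl x⁺)

    p′-old : ∀ {x} → x ≢ x⁺ → p′ x ≡ p S x
    p′-old x≢ = cong (_+ _) (δ-≢ (x≢ ∘ sym))

    p≤p′ : ∀ x → p S x ≤ p′ x
    p≤p′ x = m≤n+m (p S x) (δ x⁺ x)

    unserved : ∀ {f} → A S f ≡ true → l f ≢ l f⁺
    unserved Af lf≡ = proj₂ (proj₂ bid) (_ , Af , trans lf≡ lf⁺)

    -- The new assignment is optimal for its bidder before the price rise, so the rise by one uses
    -- up exactly the tolerance in `content`. For the other assigned bidders prices elsewhere only
    -- increase, and their own item keeps its price.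
    auction-step : Σ State λ S′ → sum (p S′) ≡ suc (sum (p S))
    auction-step = record
      { A = A′ ; p = p′ ; A⊆F = A⊆F′ ; l-inj = l-inj′ ; r-inj = r-inj′ ; sold = sold′ ; p≤v = p≤v′ ; content = content′ }
      , sum-p′
      where
      open ≤-Reasoning
      sum-p′ : sum p′ ≡ suc (sum (p S))
      sum-p′ = trans (∑-distrib-+ (δ x⁺) (p S))
        (cong (_+ sum (p S)) (trans (sum-cong-≗ λ x → sym (*-identityʳ (δ x⁺ x))) (sum-δ x⁺ (λ _ → 1))))
      A⊆F′ : ∀ {f} → A′ f ≡ true → F f ≡ true
      A⊆F′ {f} A′f with A′-cases f A′f
      ... | inj₁ refl     = Ff⁺
      ... | inj₂ (Af , _) = A⊆F S Af
      l-inj′ : ∀ {f g} → A′ f ≡ true → A′ g ≡ true → l f ≡ l g → f ≡ g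
      l-inj′ {f} {g} A′f A′g l≡ with A′-cases f A′f | A′-cases g A′g
      ... | inj₁ refl     | inj₁ refl     = refl
      ... | inj₁ refl     | inj₂ (Ag , _) = contradiction (sym l≡) (unserved Ag)
      ... | inj₂ (Af , _) | inj₁ refl     = contradiction l≡ (unserved Af)
      ... | inj₂ (Af , _) | inj₂ (Ag , _) = l-inj S Af Ag l≡
      r-inj′ : ∀ {f g} → A′ f ≡ true → A′ g ≡ true → r f ≡ r g → f ≡ g
      r-inj′ {f} {g} A′f A′g r≡ with A′-cases f A′f | A′-cases g A′g
      ... | inj₁ refl      | inj₁ refl      = refl
      ... | inj₁ refl      | inj₂ (_ , rg≢) = contradiction (sym r≡) rg≢
      ... | inj₂ (_ , rf≢) | inj₁ refl      = contradiction r≡ rf≢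
      ... | inj₂ (Af , _)  | inj₂ (Ag , _)  = r-inj S Af Ag r≡
      sold′ : ∀ {x} → 0 < p′ x → ∃ λ f → A′ f ≡ true × r f ≡ x
      sold′ {x} 0<p′ with x Fin.≟ x⁺
      ... | yes refl = f⁺ , A′-new , refl
      ... | no x≢ with sold S (subst (0 <_) (p′-old x≢) 0<p′)
      ...   | f , Af , refl = f , A′-old Af x≢ , refl
      p≤v′ : ∀ {f} → A′ f ≡ true → p′ (r f) ≤ v f
      p≤v′ {f} A′f with A′-cases f A′f
      ... | inj₁ refl      = ≤-trans (≤-reflexive p′-new) p<v⁺
      ... | inj₂ (Af , r≢) = ≤-trans (≤-reflexive (p′-old r≢)) (p≤v S Af)
      content′ : ∀ {f g} → A′ f ≡ true → F g ≡ true → l g ≡ l f → v g + p′ (r f) ≤ v f + p′ (r g) + 1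
      content′ {f} {g} A′f Fg lg with A′-cases f A′f
      ... | inj₁ refl = begin
        v g + p′ x⁺              ≡⟨ cong (v g +_) p′-new ⟩
        v g + suc (p S x⁺)       ≡⟨ trans (+-suc (v g) (p S x⁺)) (+-comm 1 _) ⟩
        v g + p S x⁺ + 1         ≤⟨ +-monoˡ-≤ 1 (best-margin Fg lg) ⟩
        v f⁺ + p S (r g) + 1     ≤⟨ +-monoˡ-≤ 1 (+-monoʳ-≤ (v f⁺) (p≤p′ (r g))) ⟩
        v f⁺ + p′ (r g) + 1      ∎
      ... | inj₂ (Af , r≢) = begin
        v g + p′ (r f)           ≡⟨ cong (v g +_) (p′-old r≢) ⟩
        v g + p S (r f)          ≤⟨ content S Af Fg lg ⟩
        v f + p S (r g) + 1      ≤⟨ +-monoˡ-≤ 1 (+-monoʳ-≤ (v f) (p≤p′ (r g))) ⟩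
        v f + p′ (r g) + 1       ∎

  -- Gives termination: each step raises the total price by one, whereas an item with a positive
  -- price is sold and so costs at most the value of the edge that buys it.
  revenue-bound : ∀ S → sum (p S) ≤ N * sum v
  revenue-bound S = ≤-trans (sum-mono price) (≤-reflexive (sum-const N (sum v)))
    where
    price : ∀ x → p S x ≤ sum v
    price x with p S x in p≡
    ... | zero  = z≤n
    ... | suc k with sold S (subst (0 <_) (sym p≡) z<s)
    ...   | f , Af , refl = ≤-trans (≤-reflexive (sym p≡)) (≤-trans (p≤v S Af) (term≤sum v f))

  auction : ∃ Terminal
  auction = run (suc (N * sum v)) initial (m≤n+m _ (sum (p initial)))
    where
    run : ∀ k S → N * sum v < sum (p S) + k → ∃ Terminal
    run zero S bound = contradiction (revenue-bound S) (<⇒≱ (subst (_ <_) (+-identityʳ _) bound))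
    run (suc k) S bound with Fin.any? (bids? S)
    ... | yes (f , bid) with auction-step S bid
    ...   | S′ , sum≡ = run k S′ (subst (N * sum v <_) (trans (+-suc _ k) (cong (_+ k) (sym sum≡))) bound)
    run (suc k) S bound | no none = S , λ {f} Ff → terminal f Ff
      where
      terminal : ∀ f → F f ≡ true → (∃ λ g → A S g ≡ true × l g ≡ l f) ⊎ v f ≤ p S (r f)
      terminal f Ff with Fin.any? (λ g → (A S g Bool.≟ true) ×-dec (l g Fin.≟ l f))
      ... | yes served = inj₁ served
      ... | no unserved with p S (r f) <? v f
      ...   | yes p<v = contradiction (f , Ff , p<v , unserved) none
      ...   | no p≮v  = inj₂ (≮⇒≥ p≮v)

  module _ (S : State) (terminal : Terminal S) where

    -- The dual variable of a bidder. An assigned bidder gets its margin plus one, which absorbs the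
    -- tolerance in `content`; an unassigned one gets 0, since at a terminal state all its items are
    -- priced out. The sum has the form needed to exchange bidders for assigned edges.
    profit : ∀ u → ∃ λ y → (∀ {f} → F f ≡ true → l f ≡ u → v f ≤ y + p S (r f))
                         × y ≤ sum λ f → δ (l f) u * (ι (A S f) * (v f ∸ p S (r f) + 1))
    profit u with Fin.any? (λ g → (A S g Bool.≟ true) ×-dec (l g Fin.≟ u))
    ... | no unserved = 0 , cover , z≤n
      where
      cover : ∀ {f} → F f ≡ true → l f ≡ u → v f ≤ p S (r f)
      cover Ff refl with terminal Ff
      ... | inj₁ served = contradiction served unserved
      ... | inj₂ v≤p    = v≤p
    ... | yes (g , Ag , refl) = v g ∸ p S (r g) + 1 , cover , ≤-trans (≤-reflexive unit) (term≤sum _ g)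
      where
      unit : v g ∸ p S (r g) + 1 ≡ δ (l g) (l g) * (ι (A S g) * (v g ∸ p S (r g) + 1))
      unit = sym (trans (cong₂ (λ a b → a * (ι b * (v g ∸ p S (r g) + 1))) (δ-refl (l g)) Ag)
        (trans (*-identityˡ _) (*-identityˡ _)))
      cover : ∀ {f} → F f ≡ true → l f ≡ l g → v f ≤ v g ∸ p S (r g) + 1 + p S (r f)
      cover {f} Ff lf = +-cancelʳ-≤ (p S (r g)) _ _ (begin
        v f + p S (r g)            ≤⟨ content S Ag Ff lf ⟩
        v g + p S (r f) + 1        ≡⟨ cong (λ z → z + p S (r f) + 1) (m∸n+n≡m (p≤v S Ag)) ⟨
        v g ∸ p S (r g) + p S (r g) + p S (r f) + 1 ≡⟨ eq (v g ∸ p S (r g)) (p S (r g)) (p S (r f)) ⟩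
        v g ∸ p S (r g) + 1 + p S (r f) + p S (r g) ∎)
        where
        open ≤-Reasoning
        eq : ∀ a b c → a + b + c + 1 ≡ a + 1 + c + b
        eq = solve-∀

    price-paid : ∀ x → p S x ≤ sum λ f → δ (r f) x * (ι (A S f) * p S (r f))
    price-paid x with p S x in p≡
    ... | zero  = z≤n
    ... | suc k with sold S (subst (0 <_) (sym p≡) z<s)
    ...   | f , Af , refl = ≤-trans (≤-reflexive unit) (term≤sum _ f)
      where
      unit : suc k ≡ δ (r f) (r f) * (ι (A S f) * p S (r f))
      unit = sym (trans (cong₂ (λ a b → a * (ι b * p S (r f))) (δ-refl (r f)) Af)
        (trans (*-identityˡ _) (trans (*-identityˡ _) p≡)))

    -- On an assigned edge, margin and price add up to the value, so the cover exceeds the value of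
    -- the assignment by at most one unit per edge.
    total-price : sum (λ u → proj₁ (profit u)) + sum (p S) ≤ sum (λ f → ι (A S f) * (v f + 1))
    total-price = begin
      sum (λ u → proj₁ (profit u)) + sum (p S)
        ≤⟨ +-mono-≤ (sum-mono λ u → proj₂ (proj₂ (profit u))) (sum-mono price-paid) ⟩
      sum (λ u → sum λ f → δ (l f) u * (ι (A S f) * (v f ∸ p S (r f) + 1))) + sum (λ x → sum λ f → δ (r f) x * (ι (A S f) * p S (r f)))
        ≡⟨ cong₂ _+_ (fibre-sum l _) (fibre-sum r _) ⟩
      sum (λ f → ι (A S f) * (v f ∸ p S (r f) + 1)) + sum (λ f → ι (A S f) * p S (r f))
        ≡⟨ ∑-distrib-+ _ (λ f → ι (A S f) * p S (r f)) ⟨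
      sum (λ f → ι (A S f) * (v f ∸ p S (r f) + 1) + ι (A S f) * p S (r f))
        ≡⟨ sum-cong-≗ termwise ⟩
      sum (λ f → ι (A S f) * (v f + 1)) ∎
      where
      open ≤-Reasoning
      eq : ∀ x q → 1 * (x + 1) + 1 * q ≡ 1 * (x + q + 1)
      eq = solve-∀
      termwise : ∀ f → ι (A S f) * (v f ∸ p S (r f) + 1) + ι (A S f) * p S (r f) ≡ ι (A S f) * (v f + 1)
      termwise f with A S f in Af
      ... | false = refl
      ... | true  = trans (eq (v f ∸ p S (r f)) (p S (r f))) (cong (λ z → 1 * (z + 1)) (m∸n+n≡m (p≤v S Af)))

-- Rounding scaled prices to an integral cover

telescope : ∀ n (φ : ℕ → ℕ) → sum {n} (λ j → φ (suc (toℕ j))) + φ 0 ≡ sum {n} (λ j → φ (toℕ j)) + φ n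
telescope zero    φ = refl
telescope (suc n) φ = begin
  φ 1 + sum {n} (λ j → φ (suc (suc (toℕ j)))) + φ 0   ≡⟨ eq (φ 1) (sum {n} λ j → φ (suc (suc (toℕ j)))) (φ 0) ⟩
  φ 0 + (sum {n} (λ j → φ (suc (suc (toℕ j)))) + φ 1) ≡⟨ cong (φ 0 +_) (telescope n (φ ∘ suc)) ⟩
  φ 0 + (sum {n} (λ j → φ (suc (toℕ j))) + φ (suc n)) ≡⟨ +-assoc (φ 0) _ _ ⟨
  φ 0 + sum {n} (λ j → φ (suc (toℕ j))) + φ (suc n)   ∎
  where
  open ≡-Reasoning
  eq : ∀ a b c → a + b + c ≡ c + (b + a)
  eq = solve-∀

-- Hermite's identity. Raising `a` by one shifts the window of `k + 1` consecutive numerators, which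
-- replaces the quotient of `a` by that of `a + k + 1`, larger by one.
hermite : ∀ k a → sum {suc k} (λ j → (a + toℕ j) / suc k) ≡ a
hermite k zero    = sum-zero {suc k} λ j → m<n⇒m/n≡0 {n = suc k} (Fin.toℕ<n j)
hermite k (suc a) = +-cancelʳ-≡ (φ 0) _ _ (begin
  sum {suc k} (λ j → (suc a + toℕ j) / suc k) + φ 0
    ≡⟨ cong (_+ φ 0) (sum-cong-≗ {suc k} λ j → cong (_/ suc k) (sym (+-suc a (toℕ j)))) ⟩
  sum {suc k} (λ j → φ (suc (toℕ j))) + φ 0
    ≡⟨ telescope (suc k) φ ⟩
  sum {suc k} (λ j → φ (toℕ j)) + φ (suc k)
    ≡⟨ cong₂ _+_ (hermite k a) (trans (+-distrib-/-∣ʳ a (∣-refl {suc k}))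
         (trans (+-comm (a / suc k) _) (cong₂ _+_ (n/n≡1 (suc k)) (cong (_/ suc k) (sym (+-identityʳ a)))))) ⟩
  a + suc (φ 0) ≡⟨ +-suc a (φ 0) ⟩
  suc a + φ 0 ∎)
  where
  open ≡-Reasoning
  φ : ℕ → ℕ
  φ j = (a + j) / suc k

hermite-reversed : ∀ k a → sum {suc k} (λ j → (a + (k ∸ toℕ j)) / suc k) ≡ a
hermite-reversed k a = begin
  sum {suc k} (λ j → (a + (k ∸ toℕ j)) / suc k)
    ≡⟨ sum-cong-≗ (λ j → cong (λ z → (a + z) / suc k) (sym (Fin.opposite-prop j))) ⟩
  sum {suc k} (λ j → (a + toℕ (opposite j)) / suc k)
    ≡⟨ sum-permute (λ j → (a + toℕ j) / suc k) reverse ⟨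
  sum {suc k} (λ j → (a + toℕ j) / suc k)
    ≡⟨ hermite k a ⟩
  a ∎
  where open ≡-Reasoning

-- The offsets are complementary: the two remainders total at most `2 * k`, and the offsets repay
-- `k` of that, so less than one unit of `w` is lost.
round-cover : ∀ k j a b w → j ≤ k → suc k * w ≤ a + b → w ≤ (a + j) / suc k + (b + (k ∸ j)) / suc k
round-cover k j a b w j≤k Kw≤ = s≤s⁻¹ (*-cancelˡ-< K w (suc (q₁ + q₂)) (begin-strict
  K * w               ≤⟨ Kw≤ ⟩
  a + b               ≤⟨ +-cancelʳ-≤ k _ _ (begin
    a + b + k                     ≡⟨ cong (a + b +_) (m+[n∸m]≡n j≤k) ⟨
    a + b + (j + (k ∸ j))         ≡⟨ eq₁ a b j (k ∸ j) ⟩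
    a + j + (b + (k ∸ j))         ≤⟨ +-mono-≤ (below (a + j)) (below (b + (k ∸ j))) ⟩
    k + q₁ * K + (k + q₂ * K)     ≡⟨ eq₂ k (q₁ * K) (q₂ * K) ⟩
    k + (q₁ * K + q₂ * K) + k     ∎) ⟩
  k + (q₁ * K + q₂ * K) <⟨ ≤-refl ⟩
  suc k + (q₁ * K + q₂ * K) ≡⟨ eq₃ k q₁ q₂ ⟩
  K * suc (q₁ + q₂)   ∎))
  where
  open ≤-Reasoning
  K = suc k
  q₁ = (a + j) / K
  q₂ = (b + (k ∸ j)) / K
  below : ∀ n → n ≤ k + n / K * K
  below n = ≤-trans (≤-reflexive (m≡m%n+[m/n]*n n K)) (+-monoˡ-≤ (n / K * K) (s≤s⁻¹ (m%n<n n K)))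
  eq₁ : ∀ a b c d → a + b + (c + d) ≡ a + c + (b + d)
  eq₁ = solve-∀
  eq₂ : ∀ k a b → k + a + (k + b) ≡ k + (a + b) + k
  eq₂ = solve-∀
  eq₃ : ∀ k a b → suc k + (a * suc k + b * suc k) ≡ suc k * suc (a + b)
  eq₃ = solve-∀

below-average : ∀ k (Y : Fin (suc k) → ℕ) c → sum Y < suc k * suc c → ∃ λ j → Y j ≤ c
below-average k Y c ΣY< with Fin.any? (λ j → Y j ≤? c)
... | yes found = found
... | no none   = contradiction
  (≤-trans (≤-reflexive (sym (sum-const (suc k) (suc c)))) (sum-mono λ j → ≰⇒> λ Yj≤c → none (j , Yj≤c)))
  (<⇒≱ ΣY<)

-- An optimality certificate: together with `cover`, the inequality `tight` forces equality, since
-- by weak duality no matching within `F` outweighs a cover.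
record MatchedCover {N m : ℕ} (F : Fin m → Bool) (l r : Fin m → Fin N) (w : Fin m → ℕ) : Set where
  field
    A     : Fin m → Bool
    A⊆F   : ∀ {f} → A f ≡ true → F f ≡ true
    l-inj : ∀ {f g} → A f ≡ true → A g ≡ true → l f ≡ l g → f ≡ g
    r-inj : ∀ {f g} → A f ≡ true → A g ≡ true → r f ≡ r g → f ≡ g
    yˡ yʳ : Fin N → ℕ
    cover : ∀ {f} → F f ≡ true → w f ≤ yˡ (l f) + yʳ (r f)
    tight : sum yˡ + sum yʳ ≤ sum λ f → ι (A f) * w f

-- The auction loses at most 1 per assigned edge; with all weights scaled by m + 1 this is less than
-- one unit in total, so a suitable rounding of the prices is tight.
egerváry : ∀ {N m} (F : Fin m → Bool) (l r : Fin m → Fin N) (w : Fin m → ℕ) → MatchedCover F l r w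
egerváry {N} {m} F l r w = record
  { A = A S ; A⊆F = A⊆F S ; l-inj = l-inj S ; r-inj = r-inj S
  ; yˡ = λ u → (a u + toℕ j) / K ; yʳ = λ x → (p S x + (m ∸ toℕ j)) / K
  ; cover = λ {f} Ff → round-cover m (toℕ j) (a (l f)) (p S (r f)) (w f) (Fin.toℕ≤pred[n] j)
      (proj₁ (proj₂ (profit S (proj₂ auction) (l f))) Ff refl)
  ; tight = proj₂ rounding }
  where
  K = suc m
  open Auction F l r (λ f → K * w f)
  open State
  S = proj₁ auction
  a : Fin N → ℕ
  a u = proj₁ (profit S (proj₂ auction) u)
  wA = sum λ f → ι (A S f) * w f
  Y : Fin K → ℕ
  Y j = sum (λ u → (a u + toℕ j) / K) + sum (λ x → (p S x + (m ∸ toℕ j)) / K)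
  -- Over all `K` offsets the rounded covers sum to exactly the scaled cover, so some offset does no
  -- worse than the average.
  ΣY : sum Y ≡ sum a + sum (p S)
  ΣY = begin
    sum Y
      ≡⟨ ∑-distrib-+ {K} (λ j → sum (λ u → (a u + toℕ j) / K)) (λ j → sum (λ x → (p S x + (m ∸ toℕ j)) / K)) ⟩
    sum {K} (λ j → sum (λ u → (a u + toℕ j) / K)) + sum {K} (λ j → sum (λ x → (p S x + (m ∸ toℕ j)) / K))
      ≡⟨ cong₂ _+_ (∑-comm (λ (j : Fin K) u → (a u + toℕ j) / K)) (∑-comm (λ (j : Fin K) x → (p S x + (m ∸ toℕ j)) / K)) ⟩
    sum (λ u → sum {K} (λ j → (a u + toℕ j) / K)) + sum (λ x → sum {K} (λ j → (p S x + (m ∸ toℕ j)) / K))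
      ≡⟨ cong₂ _+_ (sum-cong-≗ λ u → hermite m (a u)) (sum-cong-≗ λ x → hermite-reversed m (p S x)) ⟩
    sum a + sum (p S) ∎
    where open ≡-Reasoning
  eq : ∀ i k w → i * (k * w + 1) ≡ k * (i * w) + 1 * i
  eq = solve-∀
  ΣY<K : sum Y < K * suc wA
  ΣY<K = begin-strict
    sum Y                                       ≡⟨ ΣY ⟩
    sum a + sum (p S)                           ≤⟨ total-price S (proj₂ auction) ⟩
    sum (λ f → ι (A S f) * (K * w f + 1))       ≡⟨ sum-cong-≗ (λ f → eq (ι (A S f)) K (w f)) ⟩
    sum (λ f → K * (ι (A S f) * w f) + 1 * ι (A S f)) ≡⟨ sum-linear (λ f → ι (A S f) * w f) (λ f → ι (A S f)) K 1 ⟩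
    K * wA + 1 * sum (λ f → ι (A S f))          ≤⟨ +-monoʳ-≤ (K * wA) (*-monoʳ-≤ 1 (sum-mono λ f → ι≤1 (A S f))) ⟩
    K * wA + 1 * sum {m} (λ _ → 1)              ≡⟨ cong (λ z → K * wA + 1 * z) (sum-const m 1) ⟩
    K * wA + 1 * (m * 1)                        ≡⟨ cong (K * wA +_) (trans (*-identityˡ (m * 1)) (*-identityʳ m)) ⟩
    K * wA + m                                  <⟨ +-monoʳ-< (K * wA) ≤-refl ⟩
    K * wA + K                                  ≡⟨ trans (+-comm (K * wA) K) (sym (*-suc K wA)) ⟩
    K * suc wA                                  ∎
    where open ≤-Reasoning
  rounding = below-average m Y wA ΣY<K
  j = proj₁ rounding

-- A balanced bipartition separating the edges of a matching

sq : ℤ → ℕ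
sq i = ∣ i ∣ * ∣ i ∣

+sq : ∀ i → ℤ.+ sq i ≡ i ℤ.* i
+sq (ℤ.+ n)    = ℤ.pos-* n n
+sq -[1+ n ] = refl

parallelogram : ∀ a c → sq (a ℤ.+ c) + sq (a ℤ.+ ℤ.- c) ≡ 2 * (sq a + sq c)
parallelogram a c = ℤ.+-injective (begin
  ℤ.+ (sq (a ℤ.+ c) + sq (a ℤ.+ ℤ.- c))   ≡⟨ ℤ.pos-+ (sq (a ℤ.+ c)) (sq (a ℤ.+ ℤ.- c)) ⟩
  ℤ.+ sq (a ℤ.+ c) ℤ.+ ℤ.+ sq (a ℤ.+ ℤ.- c) ≡⟨ cong₂ ℤ._+_ (+sq (a ℤ.+ c)) (+sq (a ℤ.+ ℤ.- c)) ⟩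
  (a ℤ.+ c) ℤ.* (a ℤ.+ c) ℤ.+ (a ℤ.+ ℤ.- c) ℤ.* (a ℤ.+ ℤ.- c) ≡⟨ eq a c ⟩
  ℤ.+ 2 ℤ.* (a ℤ.* a ℤ.+ c ℤ.* c)         ≡⟨ cong (ℤ.+ 2 ℤ.*_) (cong₂ ℤ._+_ (+sq a) (+sq c)) ⟨
  ℤ.+ 2 ℤ.* (ℤ.+ sq a ℤ.+ ℤ.+ sq c)           ≡⟨ ℤ.pos-* 2 (sq a + sq c) ⟨
  ℤ.+ (2 * (sq a + sq c))                 ∎)
  where
  open ≡-Reasoning
  eq : ∀ a c → (a ℤ.+ c) ℤ.* (a ℤ.+ c) ℤ.+ (a ℤ.+ ℤ.- c) ℤ.* (a ℤ.+ ℤ.- c) ≡ ℤ.+ 2 ℤ.* (a ℤ.* a ℤ.+ c ℤ.* c)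
  eq = ℤ-Solver.solve-∀

signed : Bool → ℤ → ℤ
signed true  x = x
signed false x = ℤ.- x

-- Choosing each sign so that the weighted norm does not exceed its average over both choices.
balancing : ∀ {N} k (κ : Fin N → ℕ) (a : Fin N → ℤ) (c : Fin k → Fin N → ℤ) → ∃ λ (ε : Fin k → Bool) →
  sum (λ u → κ u * sq (a u ℤ.+ ℤ-Sum.sum (λ i → signed (ε i) (c i u))))
    ≤ sum (λ u → κ u * sq (a u)) + sum (λ i → sum λ u → κ u * sq (c i u))
balancing zero κ a c = (λ ()) ,
  ≤-reflexive (trans (sum-cong-≗ λ u → cong (λ z → κ u * sq z) (ℤ.+-identityʳ (a u))) (sym (+-identityʳ _)))
balancing {N} (suc k) κ a c = (λ { fzero → b ; (fsuc i) → ε i }) , (begin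
  sum (λ u → κ u * sq (a u ℤ.+ (signed b (c₀ u) ℤ.+ rest u)))
    ≡⟨ sum-cong-≗ (λ u → cong (λ z → κ u * sq z) (ℤ.+-assoc (a u) (signed b (c₀ u)) (rest u))) ⟨
  sum (λ u → κ u * sq (a′ u ℤ.+ rest u))
    ≤⟨ proj₂ tail-signs ⟩
  sum (λ u → κ u * sq (a′ u)) + sum (λ i → sum λ u → κ u * sq (c (fsuc i) u))
    ≤⟨ +-monoˡ-≤ _ (proj₂ head-sign) ⟩
  sum (λ u → κ u * sq (a u)) + sum (λ u → κ u * sq (c₀ u)) + sum (λ i → sum λ u → κ u * sq (c (fsuc i) u))
    ≡⟨ +-assoc (sum (λ u → κ u * sq (a u))) _ _ ⟩
  sum (λ u → κ u * sq (a u)) + (sum (λ u → κ u * sq (c₀ u)) + sum (λ i → sum λ u → κ u * sq (c (fsuc i) u))) ∎)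
  where
  open ≤-Reasoning
  c₀ : Fin N → ℤ
  c₀ = c fzero
  Q : (Fin N → ℤ) → ℕ
  Q x = sum λ u → κ u * sq (x u)
  average : Q (λ u → a u ℤ.+ c₀ u) + Q (λ u → a u ℤ.+ ℤ.- c₀ u) ≡ 2 * (Q a + Q c₀)
  average = begin-equality
    Q (λ u → a u ℤ.+ c₀ u) + Q (λ u → a u ℤ.+ ℤ.- c₀ u)
      ≡⟨ ∑-distrib-+ (λ u → κ u * sq (a u ℤ.+ c₀ u)) (λ u → κ u * sq (a u ℤ.+ ℤ.- c₀ u)) ⟨
    sum (λ u → κ u * sq (a u ℤ.+ c₀ u) + κ u * sq (a u ℤ.+ ℤ.- c₀ u))
      ≡⟨ sum-cong-≗ (λ u → trans (sym (*-distribˡ-+ (κ u) _ _)) (trans (cong (κ u *_) (parallelogram (a u) (c₀ u))) (eq (κ u) (sq (a u)) (sq (c₀ u))))) ⟩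
    sum (λ u → 2 * (κ u * sq (a u)) + 2 * (κ u * sq (c₀ u)))
      ≡⟨ sum-linear (λ u → κ u * sq (a u)) (λ u → κ u * sq (c₀ u)) 2 2 ⟩
    2 * Q a + 2 * Q c₀
      ≡⟨ *-distribˡ-+ 2 (Q a) (Q c₀) ⟨
    2 * (Q a + Q c₀) ∎
    where
    eq : ∀ k x y → k * (2 * (x + y)) ≡ 2 * (k * x) + 2 * (k * y)
    eq = solve-∀
  head-sign : ∃ λ b → Q (λ u → a u ℤ.+ signed b (c₀ u)) ≤ Q a + Q c₀
  head-sign with Q (λ u → a u ℤ.+ c₀ u) ≤? Q a + Q c₀
  ... | yes ≤avg = true , ≤avg
  ... | no ≰avg = false , +-cancelˡ-≤ (Q a + Q c₀) _ _ (begin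
    Q a + Q c₀ + Q (λ u → a u ℤ.+ ℤ.- c₀ u)             ≤⟨ +-monoˡ-≤ _ (<⇒≤ (≰⇒> ≰avg)) ⟩
    Q (λ u → a u ℤ.+ c₀ u) + Q (λ u → a u ℤ.+ ℤ.- c₀ u) ≡⟨ average ⟩
    2 * (Q a + Q c₀)                                   ≡⟨ cong (Q a + Q c₀ +_) (+-identityʳ _) ⟩
    Q a + Q c₀ + (Q a + Q c₀)                          ∎)
  b = proj₁ head-sign
  a′ : Fin N → ℤ
  a′ u = a u ℤ.+ signed b (c₀ u)
  tail-signs = balancing k κ a′ (λ i → c (fsuc i))
  ε = proj₁ tail-signs
  rest : Fin N → ℤ
  rest u = ℤ-Sum.sum (λ i → signed (ε i) (c (fsuc i) u))

signed-sum : ∀ {k} (ε : Fin k → Bool) (x y : Fin k → ℕ) →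
  ℤ-Sum.sum (λ i → signed (ε i) (ℤ.+ x i ℤ.- ℤ.+ y i))
    ≡ ℤ.+ sum (λ i → ι (ε i) * x i + ι (not (ε i)) * y i) ℤ.- ℤ.+ sum (λ i → ι (not (ε i)) * x i + ι (ε i) * y i)
signed-sum {zero}  ε x y = refl
signed-sum {suc k} ε x y = trans (cong₂ ℤ._+_ (head≡ (ε fzero) (x fzero) (y fzero)) (signed-sum (ε ∘ fsuc) (x ∘ fsuc) (y ∘ fsuc)))
  (trans (eq (ℤ.+ p₀) (ℤ.+ n₀) (ℤ.+ ps) (ℤ.+ ns)) (cong₂ ℤ._-_ (sym (ℤ.pos-+ p₀ ps)) (sym (ℤ.pos-+ n₀ ns))))
  where
  p₀ = ι (ε fzero) * x fzero + ι (not (ε fzero)) * y fzero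
  n₀ = ι (not (ε fzero)) * x fzero + ι (ε fzero) * y fzero
  ps = sum (λ i → ι (ε (fsuc i)) * x (fsuc i) + ι (not (ε (fsuc i))) * y (fsuc i))
  ns = sum (λ i → ι (not (ε (fsuc i))) * x (fsuc i) + ι (ε (fsuc i)) * y (fsuc i))
  eq : ∀ a b c d → (a ℤ.- b) ℤ.+ (c ℤ.- d) ≡ (a ℤ.+ c) ℤ.- (b ℤ.+ d)
  eq = ℤ-Solver.solve-∀
  swap : ∀ a b → ℤ.- (a ℤ.- b) ≡ b ℤ.- a
  swap = ℤ-Solver.solve-∀
  head≡ : ∀ b m n → signed b (ℤ.+ m ℤ.- ℤ.+ n) ≡ ℤ.+ (ι b * m + ι (not b) * n) ℤ.- ℤ.+ (ι (not b) * m + ι b * n)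
  head≡ true m n = cong₂ (λ p q → ℤ.+ p ℤ.- ℤ.+ q) (sym (trans (+-identityʳ _) (*-identityˡ m))) (sym (*-identityˡ n))
  head≡ false m n = trans (swap (ℤ.+ m) (ℤ.+ n))
    (cong₂ (λ p q → ℤ.+ p ℤ.- ℤ.+ q) (sym (*-identityˡ n)) (sym (trans (+-identityʳ _) (*-identityˡ m))))

-- One factor of the square is bounded by the largest single weight, the other by the sum. The
-- contributions of all signs at a vertex therefore total at most `P` times its degree.
sq-diff≤ : ∀ {P} m n → m ≤ P → n ≤ P → sq (ℤ.+ m ℤ.- ℤ.+ n) ≤ P * (m + n)
sq-diff≤ {P} m n m≤P n≤P = *-mono-≤ (≤-trans abs≤ (⊔-lub m≤P n≤P)) (≤-trans abs≤ (m⊔n≤m+n m n))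
  where
  abs≤ : ∣ ℤ.+ m ℤ.- ℤ.+ n ∣ ≤ m ⊔ n
  abs≤ = ≤-trans (≤-reflexive (cong ∣_∣ (ℤ.m-n≡m⊖n m n))) (ℤ.∣m⊝n∣≤m⊔n m n)

two-terms≤sum : ∀ {n} (f : Fin n → ℕ) {i j} → i ≢ j → f i + f j ≤ sum f
two-terms≤sum f {fzero}  {fzero}  i≢j = contradiction refl i≢j
two-terms≤sum f {fzero}  {fsuc j} i≢j = +-monoʳ-≤ (f fzero) (term≤sum (f ∘ fsuc) j)
two-terms≤sum f {fsuc i} {fzero}  i≢j = ≤-trans (≤-reflexive (+-comm (f (fsuc i)) (f fzero))) (+-monoʳ-≤ (f fzero) (term≤sum (f ∘ fsuc) i))
two-terms≤sum f {fsuc i} {fsuc j} i≢j = ≤-trans (two-terms≤sum (f ∘ fsuc) (i≢j ∘ cong fsuc)) (m≤n+m _ (f fzero))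

δ-transport : ∀ {n} (i u : Fin n) (φ : Fin n → ℕ) → δ i u * φ i ≡ δ i u * φ u
δ-transport i u φ with i Fin.≟ u
... | yes refl = refl
... | no _     = refl

module Sides {N m : ℕ} (s t : Fin m → Fin N) (hw : Fin m → ℕ) (M : Fin m → Bool) (P : ℕ) (κ : Fin N → ℕ) where

  open Multigraph s t

  degᴹ = star (λ i → ι (M i))

  module _ (M-disjoint : ∀ u → degᴹ u ≤ 1) (adj≤P : ∀ u v → adj hw u v ≤ P) where

    meets : Fin m → Fin N → ℕ
    meets i v = δ (s i) v + δ (t i) v

    M-unique : ∀ {i j v} → M i ≡ true → M j ≡ true → 0 < meets i v → 0 < meets j v → i ≡ j
    M-unique {i} {j} {v} Mi Mj mi mj with i Fin.≟ j
    ... | yes i≡j = i≡j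
    ... | no i≢j  = contradiction (≤-trans (+-mono-≤ (counted Mi mi) (counted Mj mj))
      (≤-trans (two-terms≤sum (λ f → ι (M f) * meets f v) i≢j) (M-disjoint v))) λ { (s≤s ()) }
      where
      counted : ∀ {f} → M f ≡ true → 0 < meets f v → 1 ≤ ι (M f) * meets f v
      counted {f} Mf 0<m rewrite Mf = ≤-trans 0<m (≤-reflexive (sym (*-identityˡ _)))

    meets-s : ∀ i → 0 < meets i (s i)
    meets-s i rewrite δ-refl (s i) = z<s

    meets-t : ∀ i → 0 < meets i (t i)
    meets-t i rewrite δ-refl (t i) = ≤-trans (s≤s z≤n) (m≤n+m 1 (δ (s i) (t i)))

    M-loopless : ∀ {i} → M i ≡ true → s i ≢ t i
    M-loopless {i} Mi s≡t = contradiction (≤-trans double (M-disjoint (t i))) λ { (s≤s ()) }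
      where
      double : 2 ≤ degᴹ (t i)
      double = ≤-trans (≤-reflexive (sym (cong₂ (λ b k → ι b * k) Mi
        (cong₂ _+_ (trans (cong (λ z → δ z (t i)) s≡t) (δ-refl (t i))) (δ-refl (t i))))))
        (term≤sum (λ f → ι (M f) * meets f (t i)) i)

    -- The coefficient of each sign in the imbalance at `u` is a difference `x - y`. A sign of an
    -- edge of M sends its two ends to opposite sides; the factor `1 ∸ degᴹ v` in `x₂` selects the
    -- unmatched vertices, each with a sign of its own.
    x₁ y₁ : Fin N → Fin m → ℕ
    x₁ u i = ι (M i) * adj hw u (s i)
    y₁ u i = ι (M i) * adj hw u (t i)

    x₂ y₂ : Fin N → Fin N → ℕ
    x₂ u v = (1 ∸ degᴹ v) * adj hw u v
    y₂ u v = 0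

    first-signs = balancing m κ (λ _ → ℤ.+ 0) (λ i u → ℤ.+ x₁ u i ℤ.- ℤ.+ y₁ u i)
    ε₁ = proj₁ first-signs

    imbalance₁ : Fin N → ℤ
    imbalance₁ u = ℤ.+ 0 ℤ.+ ℤ-Sum.sum (λ i → signed (ε₁ i) (ℤ.+ x₁ u i ℤ.- ℤ.+ y₁ u i))

    second-signs = balancing N κ imbalance₁ (λ v u → ℤ.+ x₂ u v ℤ.- ℤ.+ y₂ u v)
    ε₂ = proj₁ second-signs

    imbalance : Fin N → ℤ
    imbalance u = imbalance₁ u ℤ.+ ℤ-Sum.sum (λ v → signed (ε₂ v) (ℤ.+ x₂ u v ℤ.- ℤ.+ y₂ u v))

    e : Fin N → ℕ
    e u = ∣ imbalance u ∣

    -- The two ends of an edge of M share a sign variable, with opposite orientations.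
    σ : Fin N → Bool
    σ v with Fin.any? (λ i → (M i Bool.≟ true) ×-dec (s i Fin.≟ v)) | Fin.any? (λ i → (M i Bool.≟ true) ×-dec (t i Fin.≟ v))
    ... | yes (i , _) | _           = ε₁ i
    ... | no _        | yes (i , _) = not (ε₁ i)
    ... | no _        | no _        = ε₂ v

    σ-s : ∀ {i} → M i ≡ true → σ (s i) ≡ ε₁ i
    σ-s {i} Mi with Fin.any? (λ j → (M j Bool.≟ true) ×-dec (s j Fin.≟ s i)) | Fin.any? (λ j → (M j Bool.≟ true) ×-dec (t j Fin.≟ s i))
    ... | yes (j , Mj , sj≡) | _ = cong ε₁ (M-unique Mj Mi (subst (λ v → 0 < meets j v) sj≡ (meets-s j)) (meets-s i))
    ... | no none | _ = contradiction (i , Mi , refl) none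

    σ-t : ∀ {i} → M i ≡ true → σ (t i) ≡ not (ε₁ i)
    σ-t {i} Mi with Fin.any? (λ j → (M j Bool.≟ true) ×-dec (s j Fin.≟ t i)) | Fin.any? (λ j → (M j Bool.≟ true) ×-dec (t j Fin.≟ t i))
    ... | yes (j , Mj , sj≡) | _ with M-unique Mj Mi (subst (λ v → 0 < meets j v) sj≡ (meets-s j)) (meets-t i)
    ...   | refl = contradiction sj≡ (M-loopless Mi)
    σ-t {i} Mi | no _ | yes (j , Mj , tj≡) = cong (not ∘ ε₁) (M-unique Mj Mi (subst (λ v → 0 < meets j v) tj≡ (meets-t j)) (meets-t i))
    σ-t {i} Mi | no _ | no none = contradiction (i , Mi , refl) none

    M-covers : ∀ {i v} → M i ≡ true → 0 < meets i v → degᴹ v ≢ 0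
    M-covers {i} {v} Mi mi deg≡0 = <⇒≱ mi (≤-trans (≤-reflexive (sym (trans (cong (λ b → ι b * meets i v) Mi) (*-identityˡ _))))
      (≤-trans (term≤sum (λ f → ι (M f) * meets f v) i) (≤-reflexive deg≡0)))

    σ-free : ∀ {v} → degᴹ v ≡ 0 → σ v ≡ ε₂ v
    σ-free {v} deg≡0 with Fin.any? (λ i → (M i Bool.≟ true) ×-dec (s i Fin.≟ v)) | Fin.any? (λ i → (M i Bool.≟ true) ×-dec (t i Fin.≟ v))
    ... | yes (i , Mi , refl) | _                   = contradiction deg≡0 (M-covers Mi (meets-s i))
    ... | no _                | yes (i , Mi , refl) = contradiction deg≡0 (M-covers Mi (meets-t i))
    ... | no _                | no _                = refl

    M-crosses : ∀ {i} → M i ≡ true → σ (t i) ≡ not (σ (s i))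
    M-crosses Mi = trans (σ-t Mi) (cong not (sym (σ-s Mi)))

    split-by-M : ∀ (φ : Fin N → ℕ) → sum φ ≡ sum (λ i → ι (M i) * (φ (s i) + φ (t i))) + sum (λ v → (1 ∸ degᴹ v) * φ v)
    split-by-M φ = begin
      sum φ
        ≡⟨ sum-cong-≗ (λ v → trans (sym (*-identityˡ (φ v))) (trans (cong (_* φ v) (sym (m+[n∸m]≡n (M-disjoint v)))) (*-distribʳ-+ (φ v) (degᴹ v) _))) ⟩
      sum (λ v → degᴹ v * φ v + (1 ∸ degᴹ v) * φ v)
        ≡⟨ ∑-distrib-+ (λ v → degᴹ v * φ v) (λ v → (1 ∸ degᴹ v) * φ v) ⟩
      sum (λ v → degᴹ v * φ v) + sum (λ v → (1 ∸ degᴹ v) * φ v)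
        ≡⟨ cong (_+ sum (λ v → (1 ∸ degᴹ v) * φ v)) (handshake (λ i → ι (M i)) φ) ⟩
      sum (λ i → ι (M i) * (φ (s i) + φ (t i))) + sum (λ v → (1 ∸ degᴹ v) * φ v) ∎
      where open ≡-Reasoning

    side-sum : ∀ (h : Bool → Bool) u → sum (λ v → ι (h (σ v)) * adj hw u v)
      ≡ sum (λ i → ι (h (ε₁ i)) * x₁ u i + ι (h (not (ε₁ i))) * y₁ u i)
      + sum (λ v → ι (h (ε₂ v)) * x₂ u v + ι (h (not (ε₂ v))) * y₂ u v)
    side-sum h u = trans (split-by-M _) (cong₂ _+_ (sum-cong-≗ matched) (sum-cong-≗ free))
      where
      eq : ∀ k a b c d → k * (a * b + c * d) ≡ a * (k * b) + c * (k * d)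
      eq = solve-∀
      eq′ : ∀ a b x → 1 * (a * x) ≡ a * (1 * x) + b * 0
      eq′ = solve-∀
      matched : ∀ i → ι (M i) * (ι (h (σ (s i))) * adj hw u (s i) + ι (h (σ (t i))) * adj hw u (t i))
        ≡ ι (h (ε₁ i)) * x₁ u i + ι (h (not (ε₁ i))) * y₁ u i
      matched i with M i in Mi
      ... | false = sym (cong₂ _+_ (*-zeroʳ (ι (h (ε₁ i)))) (*-zeroʳ (ι (h (not (ε₁ i))))))
      ... | true  = trans (cong₂ (λ a b → 1 * (ι (h a) * adj hw u (s i) + ι (h b) * adj hw u (t i))) (σ-s Mi) (σ-t Mi))
        (eq 1 (ι (h (ε₁ i))) (adj hw u (s i)) (ι (h (not (ε₁ i)))) (adj hw u (t i)))
      free : ∀ v → (1 ∸ degᴹ v) * (ι (h (σ v)) * adj hw u v) ≡ ι (h (ε₂ v)) * x₂ u v + ι (h (not (ε₂ v))) * 0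
      free v with degᴹ v in deg≡
      ... | zero  = trans (cong (λ a → 1 * (ι (h a) * adj hw u v)) (σ-free deg≡))
        (eq′ (ι (h (ε₂ v))) (ι (h (not (ε₂ v)))) (adj hw u v))
      ... | suc k rewrite 0∸n≡0 k = sym (cong₂ _+_ (*-zeroʳ (ι (h (ε₂ v)))) (*-zeroʳ (ι (h (not (ε₂ v))))))

    -- The crossing degree of `u` is one of these two, depending on the side of `u`. In either case
    -- `|2dᶜ - d| = |d⁺ - d⁻|`, and the difference on the right is linear in the signs, as
    -- `balancing` requires.
    d⁺ d⁻ : Fin N → ℕ
    d⁺ u = sum λ v → ι (σ v) * adj hw u v
    d⁻ u = sum λ v → ι (not (σ v)) * adj hw u v

    imbalance≡ : ∀ u → imbalance u ≡ ℤ.+ d⁺ u ℤ.- ℤ.+ d⁻ u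
    imbalance≡ u = begin
      imbalance u
        ≡⟨ cong₂ ℤ._+_ (trans (ℤ.+-identityˡ _) (signed-sum ε₁ (x₁ u) (y₁ u))) (signed-sum ε₂ (x₂ u) (y₂ u)) ⟩
      (ℤ.+ p₁ ℤ.- ℤ.+ n₁) ℤ.+ (ℤ.+ p₂ ℤ.- ℤ.+ n₂)
        ≡⟨ eq (ℤ.+ p₁) (ℤ.+ n₁) (ℤ.+ p₂) (ℤ.+ n₂) ⟩
      (ℤ.+ p₁ ℤ.+ ℤ.+ p₂) ℤ.- (ℤ.+ n₁ ℤ.+ ℤ.+ n₂)
        ≡⟨ cong₂ ℤ._-_ (ℤ.pos-+ p₁ p₂) (ℤ.pos-+ n₁ n₂) ⟨
      ℤ.+ (p₁ + p₂) ℤ.- ℤ.+ (n₁ + n₂)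
        ≡⟨ cong₂ (λ p n → ℤ.+ p ℤ.- ℤ.+ n) (sym (side-sum (λ b → b) u)) (sym (trans (side-sum not u)
             (cong₂ _+_ (sum-cong-≗ λ i → cong (λ b → ι (not (ε₁ i)) * x₁ u i + ι b * y₁ u i) (Bool.not-involutive (ε₁ i)))
               (sum-cong-≗ λ v → cong (λ b → ι (not (ε₂ v)) * x₂ u v + ι b * y₂ u v) (Bool.not-involutive (ε₂ v)))))) ⟩
      ℤ.+ d⁺ u ℤ.- ℤ.+ d⁻ u ∎
      where
      open ≡-Reasoning
      p₁ = sum (λ i → ι (ε₁ i) * x₁ u i + ι (not (ε₁ i)) * y₁ u i)
      n₁ = sum (λ i → ι (not (ε₁ i)) * x₁ u i + ι (ε₁ i) * y₁ u i)
      p₂ = sum (λ v → ι (ε₂ v) * x₂ u v + ι (not (ε₂ v)) * y₂ u v)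
      n₂ = sum (λ v → ι (not (ε₂ v)) * x₂ u v + ι (ε₂ v) * y₂ u v)
      eq : ∀ a b c d → (a ℤ.- b) ℤ.+ (c ℤ.- d) ≡ (a ℤ.+ c) ℤ.- (b ℤ.+ d)
      eq = ℤ-Solver.solve-∀

    cw : Fin m → ℕ
    cw f = ι (σ (s f) xor σ (t f)) * hw f

    star-cw : ∀ u → star cw u ≡ sum (λ v → ι (σ u xor σ v) * adj hw u v)
    star-cw u = trans (sym (adj-row cw u)) (sum-cong-≗ entry)
      where
      χ : Fin N → Fin N → ℕ
      χ u v = ι (σ u xor σ v)
      χ-sym : ∀ u v → χ u v ≡ χ v u
      χ-sym u v = cong ι (Bool.xor-comm (σ u) (σ v))
      eq₁ : ∀ χ w a b c d → χ * w * (a * b + c * d) ≡ w * (b * (a * χ) + d * (c * χ))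
      eq₁ = solve-∀
      eq₂ : ∀ χ w a b c d → w * (a * (b * χ) + c * (d * χ)) ≡ χ * (w * (a * b + c * d))
      eq₂ = solve-∀
      entry : ∀ v → adj cw u v ≡ χ u v * adj hw u v
      entry v = trans (sum-cong-≗ edgewise) (sym (*-distribˡ-sum (χ u v) (λ f → hw f * (δ (s f) u * δ (t f) v + δ (t f) u * δ (s f) v))))
        where
        edgewise : ∀ f → χ (s f) (t f) * hw f * (δ (s f) u * δ (t f) v + δ (t f) u * δ (s f) v)
          ≡ χ u v * (hw f * (δ (s f) u * δ (t f) v + δ (t f) u * δ (s f) v))
        edgewise f = begin
          χ (s f) (t f) * hw f * (δ (s f) u * δ (t f) v + δ (t f) u * δ (s f) v)
            ≡⟨ eq₁ (χ (s f) (t f)) (hw f) (δ (s f) u) (δ (t f) v) (δ (t f) u) (δ (s f) v) ⟩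
          hw f * (δ (t f) v * (δ (s f) u * χ (s f) (t f)) + δ (s f) v * (δ (t f) u * χ (s f) (t f)))
            ≡⟨ cong₂ (λ a b → hw f * (δ (t f) v * a + δ (s f) v * b))
                 (δ-transport (s f) u (λ z → χ z (t f)))
                 (trans (cong (δ (t f) u *_) (χ-sym (s f) (t f))) (δ-transport (t f) u (λ z → χ z (s f)))) ⟩
          hw f * (δ (t f) v * (δ (s f) u * χ u (t f)) + δ (s f) v * (δ (t f) u * χ u (s f)))
            ≡⟨ cong₂ (λ a b → hw f * (a + b)) (swap (δ (t f) v) (δ (s f) u) (χ u (t f))) (swap (δ (s f) v) (δ (t f) u) (χ u (s f))) ⟩
          hw f * (δ (s f) u * (δ (t f) v * χ u (t f)) + δ (t f) u * (δ (s f) v * χ u (s f)))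
            ≡⟨ cong₂ (λ a b → hw f * (δ (s f) u * a + δ (t f) u * b)) (δ-transport (t f) v (χ u)) (δ-transport (s f) v (χ u)) ⟩
          hw f * (δ (s f) u * (δ (t f) v * χ u v) + δ (t f) u * (δ (s f) v * χ u v))
            ≡⟨ eq₂ (χ u v) (hw f) (δ (s f) u) (δ (t f) v) (δ (t f) u) (δ (s f) v) ⟩
          χ u v * (hw f * (δ (s f) u * δ (t f) v + δ (t f) u * δ (s f) v)) ∎
          where
          open ≡-Reasoning
          swap : ∀ a b c → a * (b * c) ≡ b * (a * c)
          swap = solve-∀

    d≡d⁺+d⁻ : ∀ u → star hw u ≡ d⁺ u + d⁻ u
    d≡d⁺+d⁻ u = trans (sym (adj-row hw u)) (trans (sum-cong-≗ λ v → split (σ v) (adj hw u v))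
      (∑-distrib-+ (λ v → ι (σ v) * adj hw u v) (λ v → ι (not (σ v)) * adj hw u v)))
      where
      split : ∀ b x → x ≡ ι b * x + ι (not b) * x
      split true  x = sym (trans (+-identityʳ _) (*-identityˡ x))
      split false x = sym (*-identityˡ x)

    near : ∀ {i} a b → i ≡ ℤ.+ a ℤ.- ℤ.+ b → a ≤ b + ∣ i ∣
    near a b refl with ≤-total a b
    ... | inj₁ a≤b = ≤-trans a≤b (m≤m+n b _)
    ... | inj₂ b≤a = ≤-trans (m≤n+m∸n a b)
      (≤-reflexive (cong (b +_) (sym (cong ∣_∣ (trans (ℤ.m-n≡m⊖n a b) (ℤ.⊖-≥ b≤a))))))

    near⁻ : ∀ {i} a b → i ≡ ℤ.+ a ℤ.- ℤ.+ b → b ≤ a + ∣ i ∣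
    near⁻ a b refl = ≤-trans (near b a refl) (≤-reflexive (cong (a +_) (ℤ.∣i-j∣≡∣j-i∣ (ℤ.+ b) (ℤ.+ a))))

    halves : ∀ a b e {d c} → d ≡ a + b → c ≡ b → a ≤ b + e → b ≤ a + e → d ≤ 2 * c + e × 2 * c ≤ d + e
    halves a b e refl refl a≤ b≤ = ≤-trans (+-monoˡ-≤ b a≤) (≤-reflexive (eq₁ b e)) , ≤-trans (≤-reflexive (cong (b +_) (+-identityʳ b)))
      (≤-trans (+-monoʳ-≤ b b≤) (≤-reflexive (eq₂ a b e)))
      where
      eq₁ : ∀ b e → b + e + b ≡ 2 * b + e
      eq₁ = solve-∀
      eq₂ : ∀ a b e → b + (a + e) ≡ a + b + e
      eq₂ = solve-∀

    star-cw-side : ∀ {u b} → σ u ≡ b → star cw u ≡ (if b then d⁻ u else d⁺ u)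
    star-cw-side {u} {true}  σu≡ = trans (star-cw u) (sum-cong-≗ λ v → cong (λ b → ι (b xor σ v) * adj hw u v) σu≡)
    star-cw-side {u} {false} σu≡ = trans (star-cw u) (sum-cong-≗ λ v → cong (λ b → ι (b xor σ v) * adj hw u v) σu≡)

    balanced : ∀ u → star hw u ≤ 2 * star cw u + e u × 2 * star cw u ≤ star hw u + e u
    balanced u = by-side (σ u) refl
      where
      by-side : ∀ b → σ u ≡ b → star hw u ≤ 2 * star cw u + e u × 2 * star cw u ≤ star hw u + e u
      by-side true  σu≡ = halves (d⁺ u) (d⁻ u) (e u) (d≡d⁺+d⁻ u) (star-cw-side σu≡)
        (near (d⁺ u) (d⁻ u) (imbalance≡ u)) (near⁻ (d⁺ u) (d⁻ u) (imbalance≡ u))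
      by-side false σu≡ = halves (d⁻ u) (d⁺ u) (e u) (trans (d≡d⁺+d⁻ u) (+-comm (d⁺ u) (d⁻ u))) (star-cw-side σu≡)
        (near⁻ (d⁺ u) (d⁻ u) (imbalance≡ u)) (near (d⁺ u) (d⁻ u) (imbalance≡ u))

    adj≤P₁ : ∀ b u v → ι b * adj hw u v ≤ P
    adj≤P₁ b u v = ≤-trans (*-mono-≤ (ι≤1 b) (adj≤P u v)) (≤-reflexive (*-identityˡ P))

    adj≤P₂ : ∀ u v → x₂ u v ≤ P
    adj≤P₂ u v = ≤-trans (*-mono-≤ (m∸n≤m 1 (degᴹ v)) (adj≤P u v)) (≤-reflexive (*-identityˡ P))

    -- Both rounds of signs start from what is already there, initially zero, and each sign adds at
    -- most its own square. By `sq-diff≤` these squares are linear in the adjacencies, which regroup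
    -- into `star hw u`, because every vertex is either an end of one edge of M or unmatched.
    potential : sum (λ u → κ u * sq (imbalance u)) ≤ P * sum (λ u → κ u * star hw u)
    potential = begin
      sum (λ u → κ u * sq (imbalance u))
        ≤⟨ proj₂ second-signs ⟩
      sum (λ u → κ u * sq (imbalance₁ u)) + sum (λ v → sum λ u → κ u * sq (ℤ.+ x₂ u v ℤ.- ℤ.+ y₂ u v))
        ≤⟨ +-monoˡ-≤ _ (proj₂ first-signs) ⟩
      sum (λ u → κ u * 0) + sum (λ i → sum λ u → κ u * sq (ℤ.+ x₁ u i ℤ.- ℤ.+ y₁ u i)) + sum (λ v → sum λ u → κ u * sq (ℤ.+ x₂ u v ℤ.- ℤ.+ y₂ u v))
        ≤⟨ +-mono-≤ (+-mono-≤ (≤-reflexive (sum-zero λ u → *-zeroʳ (κ u)))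
             (sum-mono λ i → sum-mono λ u → *-monoʳ-≤ (κ u) (sq-diff≤ (x₁ u i) (y₁ u i) (adj≤P₁ (M i) u (s i)) (adj≤P₁ (M i) u (t i)))))
             (sum-mono λ v → sum-mono λ u → *-monoʳ-≤ (κ u) (sq-diff≤ (x₂ u v) (y₂ u v) (adj≤P₂ u v) z≤n)) ⟩
      sum (λ i → sum λ u → κ u * (P * (x₁ u i + y₁ u i))) + sum (λ v → sum λ u → κ u * (P * (x₂ u v + 0)))
        ≡⟨ cong₂ _+_ (pull (λ u i → x₁ u i + y₁ u i)) (pull (λ u v → x₂ u v + 0)) ⟩
      sum (λ u → P * κ u * sum (λ i → x₁ u i + y₁ u i)) + sum (λ u → P * κ u * sum (λ v → x₂ u v + 0))
        ≡⟨ ∑-distrib-+ (λ u → P * κ u * sum (λ i → x₁ u i + y₁ u i)) (λ u → P * κ u * sum (λ v → x₂ u v + 0)) ⟨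
      sum (λ u → P * κ u * sum (λ i → x₁ u i + y₁ u i) + P * κ u * sum (λ v → x₂ u v + 0))
        ≡⟨ sum-cong-≗ (λ u → trans (sym (*-distribˡ-+ (P * κ u) _ _)) (trans (cong (P * κ u *_) (recombine u)) (*-assoc P (κ u) _))) ⟩
      sum (λ u → P * (κ u * star hw u))
        ≡⟨ *-distribˡ-sum P (λ u → κ u * star hw u) ⟨
      P * sum (λ u → κ u * star hw u) ∎
      where
      open ≤-Reasoning
      eq : ∀ k p x → k * (p * x) ≡ p * k * x
      eq = solve-∀
      pull : ∀ {k} (x : Fin N → Fin k → ℕ) → sum (λ i → sum λ u → κ u * (P * x u i)) ≡ sum (λ u → P * κ u * sum (x u))
      pull x = trans (∑-comm (λ i u → κ u * (P * x u i)))
        (sum-cong-≗ λ u → trans (sum-cong-≗ λ i → eq (κ u) P (x u i)) (sym (*-distribˡ-sum (P * κ u) (x u))))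
      recombine : ∀ u → sum (λ i → x₁ u i + y₁ u i) + sum (λ v → x₂ u v + 0) ≡ star hw u
      recombine u = trans (cong₂ _+_ (sum-cong-≗ λ i → sym (*-distribˡ-+ (ι (M i)) (adj hw u (s i)) (adj hw u (t i)))) (sum-cong-≗ λ v → +-identityʳ (x₂ u v)))
        (trans (sym (split-by-M (adj hw u))) (adj-row hw u))

-- The approximation for unit capacities

at-most-one : ∀ {n} (f : Fin n → ℕ) → (∀ i → f i ≤ 1) → (∀ {i j} → 0 < f i → 0 < f j → i ≡ j) → sum f ≤ 1
at-most-one {zero}  f f≤1 unique = z≤n
at-most-one {suc n} f f≤1 unique with f fzero in f0≡
... | zero  = at-most-one (f ∘ fsuc) (f≤1 ∘ fsuc) λ 0<fi 0<fj → Fin.suc-injective (unique 0<fi 0<fj)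
... | suc k = ≤-trans (≤-reflexive (trans (cong (suc k +_) rest≡0) (trans (+-identityʳ _) (sym f0≡)))) (f≤1 fzero)
  where
  0<f0 : 0 < f fzero
  0<f0 = subst (0 <_) (sym f0≡) z<s
  rest≡0 : sum (f ∘ fsuc) ≡ 0
  rest≡0 = sum-zero {f = f ∘ fsuc} λ i → n≤0⇒n≡0 (≮⇒≥ λ 0<fi → Fin.0≢1+n (unique 0<f0 0<fi))

*-pos : ∀ m {n} → 0 < m * n → 0 < m × 0 < n
*-pos (suc m) {suc n} _ = z<s , z<s
*-pos (suc m) {zero}  0< = contradiction 0< (<-irrefl (sym (*-zeroʳ m)))

+-pos : ∀ m {n} → 0 < m + n → 0 < m ⊎ 0 < n
+-pos zero    0<n = inj₂ 0<n
+-pos (suc m) _   = inj₁ z<s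

ι-pos : ∀ {b} → 0 < ι b → b ≡ true
ι-pos {true} _ = refl

-- If either price is capped, it alone pays for the edge. The cap supplies the hypothesis `y ≤ W` of
-- `priced-vertex-bound`.
truncated-cover : ∀ {w W} a b → w ≤ W → w ≤ a + b → w ≤ (a ⊓ W) + (b ⊓ W)
truncated-cover {w} {W} a b w≤W w≤a+b with ≤-total a W | ≤-total b W
... | inj₁ a≤W | inj₁ b≤W = ≤-trans w≤a+b (≤-reflexive (sym (cong₂ _+_ (m≤n⇒m⊓n≡m a≤W) (m≤n⇒m⊓n≡m b≤W))))
... | inj₂ W≤a | _        = ≤-trans w≤W (≤-trans (≤-reflexive (sym (m≥n⇒m⊓n≡n W≤a))) (m≤m+n _ _))
... | _        | inj₂ W≤b = ≤-trans w≤W (≤-trans (≤-reflexive (sym (m≥n⇒m⊓n≡n W≤b))) (m≤n+m _ (a ⊓ W)))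

module UnitCapacities {N m : ℕ} (s t : Fin m → Fin N) (w : Fin m → ℕ) (H M : Fin m → Bool) (V B B⁻ p D : ℕ)
  (σ : Fin N → Bool) (e : Fin N → ℕ) where

  open Multigraph s t

  W = suc V
  hw Mk : Fin m → ℕ
  hw f = ι (H f) * w f
  Mk f = ι (M f)
  d = star hw
  wM = sum λ f → Mk f * w f
  -- `4 * W * κ u` is the coefficient of `e u` in `cover-bound`, where the deviations enter as
  -- `8 * W * Eʰ + 4 * W * B * Eᴹ`.
  h κ : Fin N → ℕ
  h u = sum λ v → adj hw u v * star Mk v
  κ u = 2 * h u + B * star Mk u

  cw : Fin m → ℕ
  cw f = ι (σ (s f) xor σ (t f)) * hw f

  F : Fin m → Bool
  F f = H f ∧ (σ (s f) xor σ (t f))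

  l r : Fin m → Fin N
  l f = if σ (s f) then s f else t f
  r f = if σ (s f) then t f else s f

  module _
    (M-disjoint : ∀ u → star Mk u ≤ 1)
    (1≤w : ∀ f → 1 ≤ w f) (w≤W : ∀ f → w f ≤ W)
    (H-edges : ∀ {f} → H f ≡ true → d (s f) + d (t f) ≤ B * w f)
    (G∖H-edges : ∀ {f} → H f ≡ false → B⁻ * w f ≤ d (s f) + d (t f))
    (B-large : 2 * W * W * (D * D) ≤ B * (p * p))
    (gap-small : D * (B ∸ B⁻) ≤ p * B)
    (0<p : 0 < p) (0<B : 0 < B)
    (M-crosses : ∀ {i} → M i ≡ true → σ (t i) ≡ not (σ (s i)))
    (balanced : ∀ u → d u ≤ 2 * star cw u + e u × 2 * star cw u ≤ d u + e u)
    (potential : sum (λ u → κ u * (e u * e u)) ≤ 4 * W * sum (λ u → κ u * d u))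
    (matched-cover : MatchedCover F l r w)
    where

    open MatchedCover matched-cover

    yᵇ y : Fin N → ℕ
    yᵇ v = if σ v then yˡ v else yʳ v
    y v = yᵇ v ⊓ W

    F-orientation : ∀ {f} → F f ≡ true → σ (l f) ≡ true × σ (r f) ≡ false
    F-orientation {f} Ff with H f | σ (s f) in σs | σ (t f) in σt
    ... | true | true  | false = σs , σt
    ... | true | false | true  = σt , σs

    oriented : ∀ f (φ : Fin N → ℕ) → φ (l f) + φ (r f) ≡ φ (s f) + φ (t f)
    oriented f φ with σ (s f)
    ... | true  = refl
    ... | false = +-comm (φ (t f)) (φ (s f))

    F-covered : ∀ {f} → F f ≡ true → w f ≤ y (s f) + y (t f)
    F-covered {f} Ff = ≤-trans (truncated-cover (yᵇ (l f)) (yᵇ (r f)) (w≤W f) covered) (≤-reflexive (oriented f y))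
      where
      covered : w f ≤ yᵇ (l f) + yᵇ (r f)
      covered rewrite proj₁ (F-orientation {f} Ff) | proj₂ (F-orientation {f} Ff) = cover Ff

    -- Injectivity on bidders and on items separately is enough: `l f` and `r f` lie on opposite
    -- sides, so no vertex is a bidder of one edge and an item of another.
    A-disjoint : ∀ u → star (λ f → ι (A f)) u ≤ 1
    A-disjoint u = at-most-one _ each unique
      where
      meets-end : ∀ {f} → F f ≡ true → 0 < δ (s f) u + δ (t f) u → (σ u ≡ true × l f ≡ u) ⊎ (σ u ≡ false × r f ≡ u)
      meets-end {f} Ff meets with +-pos (δ (l f) u) (subst (0 <_) (sym (oriented f λ z → δ z u)) meets)
      ... | inj₁ l-meets with refl ← δ-pos l-meets = inj₁ (proj₁ (F-orientation {f} Ff) , refl)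
      ... | inj₂ r-meets with refl ← δ-pos r-meets = inj₂ (proj₂ (F-orientation {f} Ff) , refl)
      each : ∀ f → ι (A f) * (δ (s f) u + δ (t f) u) ≤ 1
      each f with A f in Af
      ... | false = z≤n
      ... | true  = ≤-trans (≤-reflexive (trans (*-identityˡ _) (sym (oriented f λ z → δ z u)))) one-end
        where
        l≢r : l f ≢ r f
        l≢r l≡r with trans (sym (proj₁ (F-orientation {f} (A⊆F Af)))) (trans (cong σ l≡r) (proj₂ (F-orientation {f} (A⊆F Af))))
        ... | ()
        one-end : δ (l f) u + δ (r f) u ≤ 1
        one-end with l f Fin.≟ u
        ... | yes refl = ≤-reflexive (cong suc (δ-≢ (l≢r ∘ sym)))
        ... | no _     = δ≤1 (r f) u
      unique : ∀ {f g} → 0 < ι (A f) * (δ (s f) u + δ (t f) u) → 0 < ι (A g) * (δ (s g) u + δ (t g) u) → f ≡ g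
      unique {f} {g} pf pg with *-pos (ι (A f)) pf | *-pos (ι (A g)) pg
      ... | ιf , mf | ιg , mg with ι-pos ιf | ι-pos ιg
      ... | Af | Ag with meets-end {f} (A⊆F Af) mf | meets-end {g} (A⊆F Ag) mg
      ... | inj₁ (_ , lf) | inj₁ (_ , lg) = l-inj Af Ag (trans lf (sym lg))
      ... | inj₂ (_ , rf) | inj₂ (_ , rg) = r-inj Af Ag (trans rf (sym rg))
      ... | inj₁ (σ≡t , _) | inj₂ (σ≡f , _) = contradiction (trans (sym σ≡t) σ≡f) λ ()
      ... | inj₂ (σ≡f , _) | inj₁ (σ≡t , _) = contradiction (trans (sym σ≡t) σ≡f) λ ()

    A⊆H : ∀ {f} → A f ≡ true → H f ≡ true
    A⊆H {f} Af with H f | A⊆F Af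
    ... | true | _ = refl

    -- A vertex of positive degree lies on some edge of H, and the condition on that one edge
    -- already bounds its degree.
    d≤BW : ∀ u → d u ≤ B * W
    d≤BW u with d u in d≡
    ... | zero  = z≤n
    ... | suc k with sum-pos (λ f → hw f * (δ (s f) u + δ (t f) u)) (subst (0 <_) (sym d≡) z<s)
    ...   | f , 0<f with *-pos (hw f) 0<f
    ...     | 0<hw , meets = ≤-trans (≤-reflexive (sym d≡)) (≤-trans (end (+-pos (δ (s f) u) meets))
      (≤-trans (H-edges (ι-pos (proj₁ (*-pos (ι (H f)) 0<hw)))) (*-monoʳ-≤ B (w≤W f))))
      where
      end : 0 < δ (s f) u ⊎ 0 < δ (t f) u → d u ≤ d (s f) + d (t f)
      end (inj₁ at-s) with refl ← δ-pos at-s = m≤m+n _ _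
      end (inj₂ at-t) with refl ← δ-pos at-t = m≤n+m _ _

    crossing : ∀ u v → 0 < adj cw u v → d u + d v ≤ B * (y u + y v)
    crossing u v 0<adj with sum-pos (λ f → cw f * (δ (s f) u * δ (t f) v + δ (t f) u * δ (s f) v)) 0<adj
    ... | f , 0<f with *-pos (cw f) 0<f
    ... | 0<cw , joins with *-pos (ι (σ (s f) xor σ (t f))) 0<cw
    ... | 0<χ , 0<hw with ι-pos 0<χ | ι-pos (proj₁ (*-pos (ι (H f)) 0<hw))
    ... | χf | Hf = ends (+-pos (δ (s f) u * δ (t f) v) joins)
      where
      bound : d (s f) + d (t f) ≤ B * (y (s f) + y (t f))
      bound = ≤-trans (H-edges Hf) (*-monoʳ-≤ B (F-covered (cong₂ _∧_ Hf χf)))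
      ends : 0 < δ (s f) u * δ (t f) v ⊎ 0 < δ (t f) u * δ (s f) v → d u + d v ≤ B * (y u + y v)
      ends (inj₁ st) with *-pos (δ (s f) u) st
      ... | su , tv with refl ← δ-pos su | refl ← δ-pos tv = bound
      ends (inj₂ ts) with *-pos (δ (t f) u) ts
      ... | tu , sv with refl ← δ-pos tu | refl ← δ-pos sv =
        ≤-trans (≤-reflexive (+-comm (d (t f)) (d (s f)))) (≤-trans bound (≤-reflexive (cong (B *_) (+-comm (y (s f)) (y (t f))))))

    -- This is what separating the ends of each edge of M is for: if such an edge lies in H, it
    -- crosses and is covered; otherwise the lower degree condition applies.
    M-edges : ∀ i → 0 < Mk i → w i ≤ y (s i) + y (t i) ⊎ B⁻ * w i ≤ d (s i) + d (t i)
    M-edges i 0<Mk with H i in Hi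
    ... | false = inj₂ (G∖H-edges Hi)
    ... | true  = inj₁ (F-covered (cong₂ _∧_ Hi
      (trans (cong (σ (s i) xor_) (M-crosses (ι-pos 0<Mk))) (xor-not (σ (s i))))))
      where
      xor-not : ∀ b → b xor not b ≡ true
      xor-not true  = refl
      xor-not false = refl

    cw≤hw : ∀ f → cw f ≤ hw f
    cw≤hw f = ≤-trans (*-monoˡ-≤ (hw f) (ι≤1 (σ (s f) xor σ (t f)))) (≤-reflexive (*-identityˡ (hw f)))

    Y≤wA : sum y ≤ sum λ f → ι (A f) * w f
    Y≤wA = ≤-trans (sum-mono below) (≤-trans (≤-reflexive (∑-distrib-+ yˡ yʳ)) tight)
      where
      below : ∀ v → y v ≤ yˡ v + yʳ v
      below v with σ v
      ... | true  = ≤-trans (m⊓n≤m (yˡ v) W) (m≤m+n _ _)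
      ... | false = ≤-trans (m⊓n≤m (yʳ v) W) (m≤n+m _ (yˡ v))

    Κ = sum κ
    Eκ = sum λ u → κ u * e u

    cover-bound′ : 2 * W * (B * B) * wM ≤ (4 * V + 3) * (B * B) * sum y + 4 * W * Eκ + 4 * W * B * ((B ∸ B⁻) * wM)
    cover-bound′ = ≤-trans (CoverBound.cover-bound s t V B B⁻ hw cw Mk w y e cw≤hw M-disjoint crossing d≤BW
        (λ u → m⊓n≤n (yᵇ u) W) (λ u → proj₁ (balanced u)) (λ u → proj₂ (balanced u)) M-edges)
      (≤-reflexive (trans (eq₁ ((4 * V + 3) * (B * B) * sum y) (4 * W * B * ((B ∸ B⁻) * wM)) W B _ _)
        (cong (λ z → (4 * V + 3) * (B * B) * sum y + 4 * W * z + 4 * W * B * ((B ∸ B⁻) * wM))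
          (trans (sym (sum-linear (λ u → h u * e u) (λ u → star Mk u * e u) 2 B)) (sum-cong-≗ λ u → eq₂ (h u) (star Mk u) (e u) B)))))
      where
      eq₁ : ∀ x z W B a b → x + 8 * W * a + 4 * W * B * b + z ≡ x + 4 * W * (2 * a + B * b) + z
      eq₁ = solve-∀
      eq₂ : ∀ h m e B → 2 * (h * e) + B * (m * e) ≡ (2 * h + B * m) * e
      eq₂ = solve-∀

    #M≤wM : sum Mk ≤ wM
    #M≤wM = sum-mono λ f → ≤-trans (≤-reflexive (sym (*-identityʳ (Mk f)))) (*-monoʳ-≤ (Mk f) (1≤w f))

    sum-degM : sum (star Mk) ≤ 2 * wM
    sum-degM = begin
      sum (star Mk)              ≡⟨ sum-cong-≗ (λ u → *-identityʳ (star Mk u)) ⟨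
      sum (λ u → star Mk u * 1)  ≡⟨ handshake Mk (λ _ → 1) ⟩
      sum (λ f → Mk f * 2)       ≡⟨ *-distribʳ-sum 2 Mk ⟨
      sum Mk * 2                 ≤⟨ *-monoˡ-≤ 2 #M≤wM ⟩
      wM * 2                     ≡⟨ *-comm wM 2 ⟩
      2 * wM                     ∎
      where open ≤-Reasoning

    sum-h : sum h ≤ B * W * (2 * wM)
    sum-h = begin
      sum (λ u → sum λ v → adj hw u v * star Mk v)
        ≡⟨ ∑-comm (λ u v → adj hw u v * star Mk v) ⟩
      sum (λ v → sum λ u → adj hw u v * star Mk v)
        ≡⟨ sum-cong-≗ (λ v → *-distribʳ-sum (star Mk v) (λ u → adj hw u v)) ⟨
      sum (λ v → sum (λ u → adj hw u v) * star Mk v)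
        ≤⟨ sum-mono (λ v → *-monoˡ-≤ (star Mk v) (≤-trans (≤-reflexive (trans (sum-cong-≗ λ u → adj-sym hw u v) (adj-row hw v))) (d≤BW v))) ⟩
      sum (λ v → B * W * star Mk v)
        ≡⟨ *-distribˡ-sum (B * W) (star Mk) ⟨
      B * W * sum (star Mk)
        ≤⟨ *-monoʳ-≤ (B * W) sum-degM ⟩
      B * W * (2 * wM) ∎
      where open ≤-Reasoning

    -- M has at most `2 * wM` ends. Each adds at most `2 * B * W` through its neighbours and `B` for
    -- itself, and `4W + 2 ≤ 6W`.
    Κ≤ : Κ ≤ 6 * W * B * wM
    Κ≤ = begin
      Κ                                       ≡⟨ sum-linear h (star Mk) 2 B ⟩
      2 * sum h + B * sum (star Mk)           ≤⟨ +-mono-≤ (*-monoʳ-≤ 2 sum-h) (*-monoʳ-≤ B sum-degM) ⟩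
      2 * (B * W * (2 * wM)) + B * (2 * wM)   ≤⟨ m≤m+n _ (2 * V * B * wM) ⟩
      2 * (B * W * (2 * wM)) + B * (2 * wM) + 2 * V * B * wM ≡⟨ eq V B wM ⟩
      6 * W * B * wM                          ∎
      where
      open ≤-Reasoning
      eq : ∀ V B x → 2 * (B * suc V * (2 * x)) + B * (2 * x) + 2 * V * B * x ≡ 6 * suc V * B * x
      eq = solve-∀

    Eκ² : sum (λ u → κ u * (e u * e u)) ≤ 4 * W * W * B * Κ
    Eκ² = begin
      sum (λ u → κ u * (e u * e u))       ≤⟨ potential ⟩
      4 * W * sum (λ u → κ u * d u)       ≤⟨ *-monoʳ-≤ (4 * W) (sum-mono λ u → *-monoʳ-≤ (κ u) (d≤BW u)) ⟩
      4 * W * sum (λ u → κ u * (B * W))   ≡⟨ cong (4 * W *_) (*-distribʳ-sum (B * W) κ) ⟨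
      4 * W * (Κ * (B * W))               ≡⟨ eq W Κ B ⟩
      4 * W * W * B * Κ                   ∎
      where
      open ≤-Reasoning
      eq : ∀ W K B → 4 * W * (K * (B * W)) ≡ 4 * W * W * B * K
      eq = solve-∀

    -- The inequality `2ab ≤ a² + b²` is balanced at `e = λB`, where `λ = p/D`. By `B-large` the
    -- mean square of `e` is at most `2(λB)²`, so the two squares together give 3, and 18 is 3 times
    -- the constant of `Κ≤`.
    Eκ≤ : 2 * D * Eκ ≤ 18 * p * (B * B) * W * wM
    Eκ≤ = *-cancelˡ-≤ (p * B) {{>-nonZero (*-mono-≤ 0<p 0<B)}} (begin
      p * B * (2 * D * Eκ)
        ≡⟨ trans (eq₁ p B D Eκ) (*-distribˡ-sum (2 * p * B * D) (λ u → κ u * e u)) ⟩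
      sum (λ u → 2 * p * B * D * (κ u * e u))
        ≤⟨ sum-mono amgm ⟩
      sum (λ u → D * D * (κ u * (e u * e u)) + p * B * (p * B) * κ u)
        ≡⟨ sum-linear (λ u → κ u * (e u * e u)) κ (D * D) (p * B * (p * B)) ⟩
      D * D * sum (λ u → κ u * (e u * e u)) + p * B * (p * B) * Κ
        ≤⟨ +-monoˡ-≤ (p * B * (p * B) * Κ) (*-monoʳ-≤ (D * D) Eκ²) ⟩
      D * D * (4 * W * W * B * Κ) + p * B * (p * B) * Κ
        ≡⟨ eq₂ D W B Κ p ⟩
      2 * W * W * (D * D) * (2 * B * Κ) + p * B * (p * B) * Κ
        ≤⟨ +-monoˡ-≤ (p * B * (p * B) * Κ) (*-monoˡ-≤ (2 * B * Κ) B-large) ⟩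
      B * (p * p) * (2 * B * Κ) + p * B * (p * B) * Κ
        ≡⟨ eq₃ B p Κ ⟩
      3 * (p * B * (p * B)) * Κ
        ≤⟨ *-monoʳ-≤ (3 * (p * B * (p * B))) Κ≤ ⟩
      3 * (p * B * (p * B)) * (6 * W * B * wM)
        ≡⟨ eq₄ p B W wM ⟩
      p * B * (18 * p * (B * B) * W * wM) ∎)
      where
      open ≤-Reasoning
      eq₁ : ∀ p B D E → p * B * (2 * D * E) ≡ 2 * p * B * D * E
      eq₁ = solve-∀
      eq₂ : ∀ D W B K p → D * D * (4 * W * W * B * K) + p * B * (p * B) * K ≡ 2 * W * W * (D * D) * (2 * B * K) + p * B * (p * B) * K
      eq₂ = solve-∀
      eq₃ : ∀ B p K → B * (p * p) * (2 * B * K) + p * B * (p * B) * K ≡ 3 * (p * B * (p * B)) * K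
      eq₃ = solve-∀
      eq₄ : ∀ p B W w → 3 * (p * B * (p * B)) * (6 * W * B * w) ≡ p * B * (18 * p * (B * B) * W * w)
      eq₄ = solve-∀
      eq₅ : ∀ p B D k e → 2 * p * B * D * (k * e) ≡ k * (2 * (D * e * (p * B)))
      eq₅ = solve-∀
      eq₆ : ∀ p B D k e → k * (D * e * (D * e) + p * B * (p * B)) ≡ D * D * (k * (e * e)) + p * B * (p * B) * k
      eq₆ = solve-∀
      amgm : ∀ u → 2 * p * B * D * (κ u * e u) ≤ D * D * (κ u * (e u * e u)) + p * B * (p * B) * κ u
      amgm u = begin
        2 * p * B * D * (κ u * e u)               ≡⟨ eq₅ p B D (κ u) (e u) ⟩
        κ u * (2 * (D * e u * (p * B)))           ≤⟨ *-monoʳ-≤ (κ u) (2ab≤a²+b² (D * e u) (p * B)) ⟩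
        κ u * (D * e u * (D * e u) + p * B * (p * B)) ≡⟨ eq₆ p B D (κ u) (e u) ⟩
        D * D * (κ u * (e u * e u)) + p * B * (p * B) * κ u ∎

    wA = sum λ f → ι (A f) * w f

    unit-bound : 2 * W * D * wM ≤ (4 * V + 3) * D * wA + 40 * W * W * p * wM
    unit-bound = *-cancelˡ-≤ (B * B) {{>-nonZero (*-mono-≤ 0<B 0<B)}} (begin
      B * B * (2 * W * D * wM)
        ≡⟨ eq₁ B W D wM ⟩
      D * (2 * W * (B * B) * wM)
        ≤⟨ *-monoʳ-≤ D cover-bound′ ⟩
      D * ((4 * V + 3) * (B * B) * sum y + 4 * W * Eκ + 4 * W * B * ((B ∸ B⁻) * wM))
        ≡⟨ eq₂ D ((4 * V + 3) * (B * B)) (sum y) W Eκ B (B ∸ B⁻) wM ⟩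
      D * ((4 * V + 3) * (B * B)) * sum y + 2 * W * (2 * D * Eκ) + 4 * W * B * wM * (D * (B ∸ B⁻))
        ≤⟨ +-mono-≤ (+-mono-≤ (*-monoʳ-≤ (D * ((4 * V + 3) * (B * B))) Y≤wA) (*-monoʳ-≤ (2 * W) Eκ≤)) (*-monoʳ-≤ (4 * W * B * wM) gap-small) ⟩
      D * ((4 * V + 3) * (B * B)) * wA + 2 * W * (18 * p * (B * B) * W * wM) + 4 * W * B * wM * (p * B)
        -- The deviations contribute `36W²` and the gap between `B` and `B⁻` contributes `4W`; the
        -- padding makes the latter `4W²`, for a total of `40W²`.
        ≤⟨ m≤m+n _ (4 * W * V * p * wM * (B * B)) ⟩
      D * ((4 * V + 3) * (B * B)) * wA + 2 * W * (18 * p * (B * B) * W * wM) + 4 * W * B * wM * (p * B) + 4 * W * V * p * wM * (B * B)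
        ≡⟨ eq₃ D V B wA p wM ⟩
      B * B * ((4 * V + 3) * D * wA + 40 * W * W * p * wM) ∎)
      where
      open ≤-Reasoning
      eq₁ : ∀ B W D x → B * B * (2 * W * D * x) ≡ D * (2 * W * (B * B) * x)
      eq₁ = solve-∀
      eq₂ : ∀ D c y W E B g x → D * (c * y + 4 * W * E + 4 * W * B * (g * x)) ≡ D * c * y + 2 * W * (2 * D * E) + 4 * W * B * x * (D * g)
      eq₂ = solve-∀
      eq₃ : ∀ D V B a p x → D * ((4 * V + 3) * (B * B)) * a + 2 * suc V * (18 * p * (B * B) * suc V * x) + 4 * suc V * B * x * (p * B) + 4 * suc V * V * p * x * (B * B)
        ≡ B * B * ((4 * V + 3) * D * a + 40 * suc V * suc V * p * x)
      eq₃ = solve-∀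

record RoundedMatching {N m : ℕ} (s t : Fin m → Fin N) (w : Fin m → ℕ) (H M : Fin m → Bool) (V p D : ℕ) : Set where
  field
    A          : Fin m → Bool
    A⊆H        : ∀ {f} → A f ≡ true → H f ≡ true
    A-disjoint : ∀ u → Multigraph.star s t (λ f → ι (A f)) u ≤ 1
    A-heavy    : 2 * suc V * D * sum (λ f → ι (M f) * w f)
                 ≤ (4 * V + 3) * D * sum (λ f → ι (A f) * w f) + 40 * suc V * suc V * p * sum (λ f → ι (M f) * w f)

unit-capacities : ∀ {N m} (s t : Fin m → Fin N) (w : Fin m → ℕ) (H M : Fin m → Bool) (V B B⁻ p D : ℕ) →
  let open Multigraph s t
      d = star (λ f → ι (H f) * w f) in
  (∀ u → star (λ f → ι (M f)) u ≤ 1) →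
  (∀ u v → adj (λ f → ι (H f) * w f) u v ≤ 4 * suc V) →
  (∀ f → 1 ≤ w f) → (∀ f → w f ≤ suc V) →
  (∀ {f} → H f ≡ true → d (s f) + d (t f) ≤ B * w f) →
  (∀ {f} → H f ≡ false → B⁻ * w f ≤ d (s f) + d (t f)) →
  2 * suc V * suc V * (D * D) ≤ B * (p * p) → D * (B ∸ B⁻) ≤ p * B → 0 < p → 0 < B →
  RoundedMatching s t w H M V p D
unit-capacities {N} s t w H M V B B⁻ p D M-disjoint adj≤4W 1≤w w≤W H-edges G∖H-edges B-large gap-small 0<p 0<B =
  assemble (S.σ M-disjoint adj≤4W) (S.e M-disjoint adj≤4W) (S.M-crosses M-disjoint adj≤4W)
    (S.balanced M-disjoint adj≤4W) (S.potential M-disjoint adj≤4W)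
  where
  open Multigraph s t
  hw : _ → ℕ
  hw f = ι (H f) * w f
  κ : Fin N → ℕ
  κ u = 2 * sum (λ v → adj hw u v * star (λ f → ι (M f)) v) + B * star (λ f → ι (M f)) u
  module S = Sides s t hw M (4 * suc V) κ
  module _ (σ : Fin N → Bool) (e : Fin N → ℕ) (M-crosses : ∀ {i} → M i ≡ true → σ (t i) ≡ not (σ (s i))) where
    module U = UnitCapacities s t w H M V B B⁻ p D σ e
    module _ (balanced : ∀ u → star hw u ≤ 2 * star U.cw u + e u × 2 * star U.cw u ≤ star hw u + e u)
      (potential : sum (λ u → κ u * (e u * e u)) ≤ 4 * suc V * sum (λ u → κ u * star hw u)) where
      round : MatchedCover U.F U.l U.r w → RoundedMatching s t w H M V p D
      round mc = record
        { A = MatchedCover.A mc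
        ; A⊆H = U.A⊆H M-disjoint 1≤w w≤W H-edges G∖H-edges B-large gap-small 0<p 0<B M-crosses balanced potential mc
        ; A-disjoint = U.A-disjoint M-disjoint 1≤w w≤W H-edges G∖H-edges B-large gap-small 0<p 0<B M-crosses balanced potential mc
        ; A-heavy = U.unit-bound M-disjoint 1≤w w≤W H-edges G∖H-edges B-large gap-small 0<p 0<B M-crosses balanced potential mc
        }
      assemble : RoundedMatching s t w H M V p D
      assemble = round (egerváry U.F U.l U.r w)

-- Splitting vertices into unit-capacity copies

Spread : ∀ {b} → ℕ → (Fin b → ℕ) → Set
Spread W L = ∀ i j → L i ≤ L j + W

argmin : ∀ {b} (L : Fin (suc b) → ℕ) → ∃ λ i → ∀ j → L i ≤ L j
argmin {zero}  L = fzero , λ { fzero → ≤-refl }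
argmin {suc b} L with argmin (L ∘ fsuc)
... | i , min with ≤-total (L fzero) (L (fsuc i))
...   | inj₁ L0≤ = fzero , λ { fzero → ≤-refl ; (fsuc j) → ≤-trans L0≤ (min j) }
...   | inj₂ ≤L0 = fsuc i , λ { fzero → ≤L0 ; (fsuc j) → min j }

-- Each item goes to a least loaded copy. That copy then exceeds any other by at most the weight of
-- the item, and all other gaps are as good as before.
greedy : ∀ {b} m W (w : Fin m → ℕ) (L : Fin (suc b) → ℕ) → (∀ f → w f ≤ W) → Spread W L →
  ∃ λ (c : Fin m → Fin (suc b)) → Spread W (λ i → L i + sum (λ f → δ (c f) i * w f))
greedy zero W w L w≤W spread = (λ ()) ,
  λ i j → subst₂ (λ x y → x ≤ y + W) (sym (+-identityʳ (L i))) (sym (+-identityʳ (L j))) (spread i j)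
greedy {b} (suc m) W w L w≤W spread = (λ { fzero → i₀ ; (fsuc f) → c f }) ,
  λ i j → subst₂ (λ x y → x ≤ y + W) (+-assoc (L i) _ _) (+-assoc (L j) _ _) (proj₂ rest i j)
  where
  i₀ = proj₁ (argmin L)
  L′ : Fin (suc b) → ℕ
  L′ i = L i + δ i₀ i * w fzero
  spread′ : Spread W L′
  spread′ i j with i₀ Fin.≟ i
  ... | yes refl = ≤-trans (+-mono-≤ (proj₂ (argmin L) j) (≤-trans (≤-reflexive (*-identityˡ _)) (w≤W fzero))) (+-monoˡ-≤ W (m≤m+n (L j) _))
  ... | no _     = ≤-trans (≤-reflexive (+-identityʳ (L i))) (≤-trans (spread i j) (+-monoˡ-≤ W (m≤m+n (L j) _)))
  rest = greedy m W (w ∘ fsuc) L′ (w≤W ∘ fsuc) spread′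
  c = proj₁ rest

-- All increments are within 2W of one another, and they average at most W.
increment-bound : ∀ {b} W (L g : Fin (suc b) → ℕ) → Spread W L → Spread W (λ i → L i + g i) →
  sum g ≤ suc b * W → ∀ i → g i ≤ 3 * W
increment-bound {b} W L g spread spread′ Σg≤ i = +-cancelˡ-≤ (L i) _ _ (*-cancelˡ-≤ (suc b) (begin
  suc b * (L i + g i)                        ≡⟨ sum-const (suc b) (L i + g i) ⟨
  sum {suc b} (λ j → L i + g i)              ≤⟨ sum-mono bound ⟩
  sum (λ j → L i + 2 * W + g j)              ≡⟨ ∑-distrib-+ {suc b} (λ _ → L i + 2 * W) g ⟩
  sum {suc b} (λ j → L i + 2 * W) + sum g    ≤⟨ +-mono-≤ (≤-reflexive (sum-const (suc b) (L i + 2 * W))) Σg≤ ⟩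
  suc b * (L i + 2 * W) + suc b * W          ≡⟨ eq b (L i) W ⟩
  suc b * (L i + 3 * W)                      ∎))
  where
  open ≤-Reasoning
  eq : ∀ b l W → suc b * (l + 2 * W) + suc b * W ≡ suc b * (l + 3 * W)
  eq = solve-∀
  eq′ : ∀ l W g → l + W + g + W ≡ l + 2 * W + g
  eq′ = solve-∀
  bound : ∀ j → L i + g i ≤ L i + 2 * W + g j
  bound j = begin
    L i + g i         ≤⟨ spread′ i j ⟩
    L j + g j + W     ≤⟨ +-monoˡ-≤ W (+-monoˡ-≤ (g j) (spread j i)) ⟩
    L i + W + g j + W ≡⟨ eq′ (L i) W (g j) ⟩
    L i + 2 * W + g j ∎

-- There is one phase per neighbour `x`. Since loads are within `W` of one another both before and
-- after a phase, no copy can receive much more than its share of the edges to `x`; balancing the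
-- totals alone would not prevent a copy from taking all of them.
phased-greedy : ∀ {b m} k W (w : Fin k → Fin m → ℕ) (L : Fin (suc b) → ℕ) →
  (∀ x f → w x f ≤ W) → (∀ x → sum (w x) ≤ suc b * W) → Spread W L →
  ∃ λ (c : Fin k → Fin m → Fin (suc b)) →
    Spread W (λ i → L i + sum (λ x → sum λ f → δ (c x f) i * w x f)) × (∀ x i → sum (λ f → δ (c x f) i * w x f) ≤ 3 * W)
phased-greedy zero W w L w≤W Σw≤ spread = (λ ()) ,
  (λ i j → subst₂ (λ x y → x ≤ y + W) (sym (+-identityʳ (L i))) (sym (+-identityʳ (L j))) (spread i j)) , λ ()
phased-greedy {b} {m} (suc k) W w L w≤W Σw≤ spread = (λ { fzero → c₀ ; (fsuc x) → c x }) ,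
  (λ i j → subst₂ (λ x y → x ≤ y + W) (+-assoc (L i) _ _) (+-assoc (L j) _ _) (proj₁ (proj₂ rest) i j)) ,
  λ { fzero → increment-bound W L _ spread (proj₂ first) (≤-trans (≤-reflexive (fibre-sum c₀ (w fzero))) (Σw≤ fzero))
    ; (fsuc x) → proj₂ (proj₂ rest) x }
  where
  first = greedy {b} m W (w fzero) L (w≤W fzero) spread
  c₀ = proj₁ first
  rest = phased-greedy k W (w ∘ fsuc) _ (w≤W ∘ fsuc) (Σw≤ ∘ fsuc) (proj₂ first)
  c = proj₁ rest

-- With unit weights the greedy loads differ by at most 1: a copy with two edges would force at
-- least one on every other copy, hence `b + 2` edges in total, more than the capacity `suc b`.
greedy-injective : ∀ {b} m (μ : Fin m → ℕ) → (∀ f → μ f ≤ 1) → sum μ ≤ suc b →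
  ∃ λ (c : Fin m → Fin (suc b)) → ∀ i → sum (λ f → δ (c f) i * μ f) ≤ 1
greedy-injective {b} m μ μ≤1 Σμ≤ = c , λ i → ≮⇒≥ λ 2≤ℓ → <⇒≱ (s≤s Σμ≤) (begin
  suc (suc b)                      ≡⟨ cong suc (sym (trans (sum-const (suc b) 1) (*-identityʳ (suc b)))) ⟩
  1 + sum {suc b} (λ _ → 1)        ≡⟨ cong (_+ sum {suc b} (λ _ → 1)) (sym (trans (sum-cong-≗ λ j → sym (*-identityʳ (δ i j))) (sum-δ i (λ _ → 1)))) ⟩
  sum (δ i) + sum {suc b} (λ _ → 1) ≡⟨ ∑-distrib-+ (δ i) (λ _ → 1) ⟨
  sum (λ j → δ i j + 1)            ≤⟨ sum-mono (above i 2≤ℓ) ⟩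
  sum ℓ                            ≡⟨ fibre-sum c μ ⟩
  sum μ                            ∎)
  where
  open ≤-Reasoning
  colouring = greedy {b} m 1 μ (λ _ → 0) μ≤1 (λ _ _ → z≤n)
  c = proj₁ colouring
  ℓ : Fin (suc b) → ℕ
  ℓ i = sum λ f → δ (c f) i * μ f
  above : ∀ i → 1 < ℓ i → ∀ j → δ i j + 1 ≤ ℓ j
  above i 1<ℓ j with i Fin.≟ j
  ... | yes refl = 1<ℓ
  ... | no _     = s≤s⁻¹ (≤-trans 1<ℓ (≤-trans (proj₂ colouring i j) (≤-reflexive (+-comm (ℓ j) 1))))

-- The split of one vertex of capacity `suc b`: `cᴹ` places its edges of M, `c x` its remaining
-- edges to the neighbour `x`. `μ` counts the incident edges of M, and `hM` is their weight in H,
-- zero for those outside H.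
record VertexSplit {n m : ℕ} (b W : ℕ) (μ hM : Fin m → ℕ) (w : Fin n → Fin m → ℕ) : Set where
  field
    cᴹ     : Fin m → Fin (suc b)
    c      : Fin n → Fin m → Fin (suc b)
    cᴹ-inj : ∀ i → sum (λ f → δ (cᴹ f) i * μ f) ≤ 1
    cᴹ≤W   : ∀ i → sum (λ f → δ (cᴹ f) i * hM f) ≤ W
    c≤3W   : ∀ x i → sum (λ f → δ (c x f) i * w x f) ≤ 3 * W
    spread : Spread W λ i → sum (λ f → δ (cᴹ f) i * hM f) + sum (λ x → sum λ f → δ (c x f) i * w x f)

vertex-split : ∀ {n m b} W (μ hM : Fin m → ℕ) (w : Fin n → Fin m → ℕ) →
  (∀ f → μ f ≤ 1) → sum μ ≤ suc b → (∀ f → hM f ≤ W * μ f) →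
  (∀ x f → w x f ≤ W) → (∀ x → sum (w x) ≤ suc b * W) → VertexSplit b W μ hM w
vertex-split {n} {m} {b} W μ hM w μ≤1 Σμ≤ hM≤ w≤W Σw≤ = record
  { cᴹ = cᴹ ; c = proj₁ phases ; cᴹ-inj = proj₂ matched ; cᴹ≤W = L≤W
  ; c≤3W = proj₂ (proj₂ phases) ; spread = proj₁ (proj₂ phases) }
  where
  matched = greedy-injective {b} m μ μ≤1 Σμ≤
  cᴹ = proj₁ matched
  L : Fin (suc b) → ℕ
  L i = sum λ f → δ (cᴹ f) i * hM f
  eq : ∀ d W μ → d * (W * μ) ≡ W * (d * μ)
  eq = solve-∀
  L≤W : ∀ i → L i ≤ W
  L≤W i = begin
    L i                                ≤⟨ sum-mono (λ f → *-monoʳ-≤ (δ (cᴹ f) i) (hM≤ f)) ⟩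
    sum (λ f → δ (cᴹ f) i * (W * μ f)) ≡⟨ sum-cong-≗ (λ f → eq (δ (cᴹ f) i) W (μ f)) ⟩
    sum (λ f → W * (δ (cᴹ f) i * μ f)) ≡⟨ *-distribˡ-sum W (λ f → δ (cᴹ f) i * μ f) ⟨
    W * sum (λ f → δ (cᴹ f) i * μ f)   ≤⟨ *-monoʳ-≤ W (proj₂ matched i) ⟩
    W * 1                              ≡⟨ *-identityʳ W ⟩
    W                                  ∎
    where open ≤-Reasoning
  -- The loads from the edges of M lie between 0 and `W`, so they satisfy `Spread W` and can serve
  -- as the starting point.
  phases = phased-greedy n W w L w≤W Σw≤ λ i j → ≤-trans (L≤W i) (m≤n+m W (L j))

δ-injective : ∀ {m n} (g : Fin m → Fin n) → (∀ {i j} → g i ≡ g j → i ≡ j) → ∀ i j → δ (g i) (g j) ≡ δ i j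
δ-injective g g-inj i j with i Fin.≟ j
... | yes refl = δ-refl (g i)
... | no i≢j   = δ-≢ (i≢j ∘ g-inj)

δ-combine : ∀ {n k} (u v : Fin n) (i j : Fin k) → δ (combine u i) (combine v j) ≡ δ u v * δ i j
δ-combine u v i j with u Fin.≟ v
... | no u≢v = δ-≢ (u≢v ∘ Fin.combine-injectiveˡ u i v j)
... | yes refl = trans (δ-injective (combine u) (Fin.combine-injectiveʳ u _ u _) i j) (sym (*-identityˡ (δ i j)))

embedded-bound : ∀ {b N m C} (g : Fin b → Fin N) → (∀ {i j} → g i ≡ g j → i ≡ j) → (c : Fin m → Fin b) (φ : Fin m → ℕ) →
  (∀ i → sum (λ f → δ (c f) i * φ f) ≤ C) → ∀ z → sum (λ f → δ (g (c f)) z * φ f) ≤ C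
embedded-bound g g-inj c φ bound z with Fin.any? (λ i → g i Fin.≟ z)
... | yes (i , refl) = ≤-trans (≤-reflexive (sum-cong-≗ λ f → cong (_* φ f) (δ-injective g g-inj (c f) i))) (bound i)
... | no ∉image = ≤-trans (≤-reflexive (sum-zero λ f → cong (_* φ f) (δ-≢ λ gc≡z → ∉image (c f , gc≡z)))) z≤n

module Split {n m : ℕ} (src tgt : Fin m → Fin n) (w : Fin m → ℕ) (H M : Fin m → Bool) (b : Fin n → ℕ) (W : ℕ) where

  module G = Multigraph src tgt

  hw : Fin m → ℕ
  hw f = ι (H f) * w f

  end : Fin n → Fin m → ℕ
  end v f = δ (src f) v + δ (tgt f) v

  μ hM : Fin n → Fin m → ℕ
  μ v f = ι (M f) * end v f
  hM v f = ι (M f) * (hw f * end v f)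

  free : Fin n → Fin n → Fin m → ℕ
  free v x f = ι (not (M f)) * (hw f * (δ (src f) v * δ (tgt f) x + δ (tgt f) v * δ (src f) x))

  -- A common bound on the numbers of copies, which lets a copy be a pair in `Fin (n * N)`. Pairs
  -- outside the range of `embed` are isolated vertices.
  N = sum λ v → suc (b v)

  embed : ∀ v → Fin (suc (b v)) → Fin N
  embed v i = inject≤ i (term≤sum (λ v → suc (b v)) v)

  embed-injective : ∀ v {i j} → embed v i ≡ embed v j → i ≡ j
  embed-injective v = Fin.inject≤-injective _ _ _ _

  module _ (split : ∀ v → VertexSplit (b v) W (μ v) (hM v) (free v)) where

    module VS v = VertexSplit (split v)

    colour : ∀ v → Fin n → Fin m → Fin (suc (b v))
    colour v x f = if M f then VS.cᴹ v f else VS.c v x f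

    copy : Fin n → Fin n → Fin m → Fin N
    copy v x f = embed v (colour v x f)

    s t : Fin m → Fin (n * N)
    s f = combine (src f) (copy (src f) (tgt f) f)
    t f = combine (tgt f) (copy (tgt f) (src f) f)

    module G′ = Multigraph s t

    δ-s : ∀ f v z → δ (s f) (combine v z) ≡ δ (src f) v * δ (copy v (tgt f) f) z
    δ-s f v z = trans (δ-combine (src f) v _ z) (δ-transport (src f) v (λ v → δ (copy v (tgt f) f) z))

    δ-t : ∀ f v z → δ (t f) (combine v z) ≡ δ (tgt f) v * δ (copy v (src f) f) z
    δ-t f v z = trans (δ-combine (tgt f) v _ z) (δ-transport (tgt f) v (λ v → δ (copy v (src f) f) z))

    level : ∀ v → Fin (suc (b v)) → ℕ
    level v i = sum (λ f → δ (VS.cᴹ v f) i * hM v f) + sum (λ x → sum λ f → δ (VS.c v x f) i * free v x f)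

    star-level : ∀ v i → G′.star hw (combine v (embed v i)) ≡ level v i
    star-level v i = begin
      sum (λ f → hw f * (δ (s f) (combine v (embed v i)) + δ (t f) (combine v (embed v i))))
        ≡⟨ sum-cong-≗ edgewise ⟩
      sum (λ f → δ (VS.cᴹ v f) i * hM v f + sum (λ x → δ (VS.c v x f) i * free v x f))
        ≡⟨ ∑-distrib-+ (λ f → δ (VS.cᴹ v f) i * hM v f) (λ f → sum (λ x → δ (VS.c v x f) i * free v x f)) ⟩
      sum (λ f → δ (VS.cᴹ v f) i * hM v f) + sum (λ f → sum (λ x → δ (VS.c v x f) i * free v x f))
        ≡⟨ cong (sum (λ f → δ (VS.cᴹ v f) i * hM v f) +_) (∑-comm (λ f x → δ (VS.c v x f) i * free v x f)) ⟩
      level v i ∎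
      where
      open ≡-Reasoning
      eq₁ : ∀ h a b k → h * (a * k + b * k) ≡ k * (1 * (h * (a + b))) + 0
      eq₁ = solve-∀
      eq₂ : ∀ k h a b x y → k * (1 * (h * (a * x + b * y))) ≡ h * a * (x * k) + h * b * (y * k)
      eq₂ = solve-∀
      eq₃ : ∀ h a b x y → h * a * x + h * b * y ≡ h * (a * x + b * y)
      eq₃ = solve-∀
      edgewise : ∀ f → hw f * (δ (s f) (combine v (embed v i)) + δ (t f) (combine v (embed v i)))
        ≡ δ (VS.cᴹ v f) i * hM v f + sum (λ x → δ (VS.c v x f) i * free v x f)
      edgewise f rewrite δ-s f v (embed v i) | δ-t f v (embed v i)
        | δ-injective (embed v) (embed-injective v) (colour v (tgt f) f) i
        | δ-injective (embed v) (embed-injective v) (colour v (src f) f) i with M f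
      ... | true  = trans (eq₁ (hw f) (δ (src f) v) (δ (tgt f) v) (δ (VS.cᴹ v f) i))
        (cong (δ (VS.cᴹ v f) i * (1 * (hw f * end v f)) +_) (sym (sum-zero λ x → *-zeroʳ (δ (VS.c v x f) i))))
      ... | false = sym (begin
        δ (VS.cᴹ v f) i * 0 + sum (λ x → δ (VS.c v x f) i * (1 * (hw f * (δ (src f) v * δ (tgt f) x + δ (tgt f) v * δ (src f) x))))
          ≡⟨ cong (_+ sum (λ x → δ (VS.c v x f) i * (1 * (hw f * (δ (src f) v * δ (tgt f) x + δ (tgt f) v * δ (src f) x))))) (*-zeroʳ (δ (VS.cᴹ v f) i)) ⟩
        sum (λ x → δ (VS.c v x f) i * (1 * (hw f * (δ (src f) v * δ (tgt f) x + δ (tgt f) v * δ (src f) x))))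
          ≡⟨ sum-cong-≗ (λ x → eq₂ (δ (VS.c v x f) i) (hw f) (δ (src f) v) (δ (tgt f) v) (δ (tgt f) x) (δ (src f) x)) ⟩
        sum (λ x → hw f * δ (src f) v * (δ (tgt f) x * δ (VS.c v x f) i) + hw f * δ (tgt f) v * (δ (src f) x * δ (VS.c v x f) i))
          ≡⟨ sum-linear (λ x → δ (tgt f) x * δ (VS.c v x f) i) (λ x → δ (src f) x * δ (VS.c v x f) i) (hw f * δ (src f) v) (hw f * δ (tgt f) v) ⟩
        hw f * δ (src f) v * sum (λ x → δ (tgt f) x * δ (VS.c v x f) i) + hw f * δ (tgt f) v * sum (λ x → δ (src f) x * δ (VS.c v x f) i)
          ≡⟨ cong₂ (λ a b → hw f * δ (src f) v * a + hw f * δ (tgt f) v * b) (sum-δ (tgt f) (λ x → δ (VS.c v x f) i)) (sum-δ (src f) (λ x → δ (VS.c v x f) i)) ⟩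
        hw f * δ (src f) v * δ (VS.c v (tgt f) f) i + hw f * δ (tgt f) v * δ (VS.c v (src f) f) i
          ≡⟨ eq₃ (hw f) (δ (src f) v) (δ (tgt f) v) _ _ ⟩
        hw f * (δ (src f) v * δ (VS.c v (tgt f) f) i + δ (tgt f) v * δ (VS.c v (src f) f) i) ∎)

    -- Every edge end at `v` lands in exactly one copy. Taken with the weights of H this yields the
    -- averages of the copies; taken with a matching of the copies it yields a b-matching of the
    -- original graph.
    unsplit : ∀ (ν : Fin m → ℕ) v → sum (λ i → G′.star ν (combine v (embed v i))) ≡ G.star ν v
    unsplit ν v = begin
      sum (λ i → sum λ f → ν f * (δ (s f) (combine v (embed v i)) + δ (t f) (combine v (embed v i))))
        ≡⟨ ∑-comm (λ i f → ν f * (δ (s f) (combine v (embed v i)) + δ (t f) (combine v (embed v i)))) ⟩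
      sum (λ f → sum λ i → ν f * (δ (s f) (combine v (embed v i)) + δ (t f) (combine v (embed v i))))
        ≡⟨ sum-cong-≗ edgewise ⟩
      sum (λ f → ν f * (δ (src f) v + δ (tgt f) v)) ∎
      where
      open ≡-Reasoning
      eq : ∀ h a b x y → h * (a * x + b * y) ≡ h * a * (x * 1) + h * b * (y * 1)
      eq = solve-∀
      eq′ : ∀ h a b → h * a * 1 + h * b * 1 ≡ h * (a + b)
      eq′ = solve-∀
      edgewise : ∀ f → sum (λ i → ν f * (δ (s f) (combine v (embed v i)) + δ (t f) (combine v (embed v i)))) ≡ ν f * (δ (src f) v + δ (tgt f) v)
      edgewise f = begin
        sum (λ i → ν f * (δ (s f) (combine v (embed v i)) + δ (t f) (combine v (embed v i))))
          ≡⟨ sum-cong-≗ (λ i → trans (cong₂ (λ a b → ν f * (a + b))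
               (trans (δ-s f v (embed v i)) (cong (δ (src f) v *_) (δ-injective (embed v) (embed-injective v) _ i)))
               (trans (δ-t f v (embed v i)) (cong (δ (tgt f) v *_) (δ-injective (embed v) (embed-injective v) _ i))))
               (eq (ν f) (δ (src f) v) (δ (tgt f) v) (δ (colour v (tgt f) f) i) (δ (colour v (src f) f) i))) ⟩
        sum (λ i → ν f * δ (src f) v * (δ (colour v (tgt f) f) i * 1) + ν f * δ (tgt f) v * (δ (colour v (src f) f) i * 1))
          ≡⟨ sum-linear (λ i → δ (colour v (tgt f) f) i * 1) (λ i → δ (colour v (src f) f) i * 1) (ν f * δ (src f) v) (ν f * δ (tgt f) v) ⟩
        ν f * δ (src f) v * sum (λ i → δ (colour v (tgt f) f) i * 1) + ν f * δ (tgt f) v * sum (λ i → δ (colour v (src f) f) i * 1)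
          ≡⟨ cong₂ (λ a b → ν f * δ (src f) v * a + ν f * δ (tgt f) v * b) (sum-δ (colour v (tgt f) f) (λ _ → 1)) (sum-δ (colour v (src f) f) (λ _ → 1)) ⟩
        ν f * δ (src f) v * 1 + ν f * δ (tgt f) v * 1
          ≡⟨ eq′ (ν f) (δ (src f) v) (δ (tgt f) v) ⟩
        ν f * (δ (src f) v + δ (tgt f) v) ∎

    level-sum : ∀ v → sum (level v) ≡ G.star hw v
    level-sum v = trans (sum-cong-≗ λ i → sym (star-level v i)) (unsplit hw v)

    -- Comparing one copy with all the others and summing: a load within `W` of every load is within
    -- `W` of their average.
    average-above : ∀ v i → suc (b v) * level v i ≤ G.star hw v + suc (b v) * W
    average-above v i = begin
      suc (b v) * level v i                ≡⟨ sum-const (suc (b v)) (level v i) ⟨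
      sum {suc (b v)} (λ _ → level v i)    ≤⟨ sum-mono (VS.spread v i) ⟩
      sum (λ j → level v j + W)            ≡⟨ ∑-distrib-+ (level v) (λ _ → W) ⟩
      sum (level v) + sum {suc (b v)} (λ _ → W) ≡⟨ cong₂ _+_ (level-sum v) (sum-const (suc (b v)) W) ⟩
      G.star hw v + suc (b v) * W          ∎
      where open ≤-Reasoning

    average-below : ∀ v i → G.star hw v ≤ suc (b v) * (level v i + W)
    average-below v i = begin
      G.star hw v                           ≡⟨ level-sum v ⟨
      sum (level v)                         ≤⟨ sum-mono (λ j → VS.spread v j i) ⟩
      sum {suc (b v)} (λ _ → level v i + W) ≡⟨ sum-const (suc (b v)) (level v i + W) ⟩
      suc (b v) * (level v i + W)           ∎
      where open ≤-Reasoning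

    by-copies : ∀ {P : Fin (n * N) → Set} → (∀ v z → P (combine v z)) → ∀ u → P u
    by-copies {P} P-combine u = subst P (Fin.combine-remQuot {n} N u) (P-combine (proj₁ (remQuot {n} N u)) (proj₂ (remQuot {n} N u)))

    M-disjoint : ∀ u → G′.star (λ f → ι (M f)) u ≤ 1
    M-disjoint = by-copies λ v z → ≤-trans (≤-reflexive (sum-cong-≗ (edgewise v z)))
      (embedded-bound (embed v) (embed-injective v) (VS.cᴹ v) (μ v) (VS.cᴹ-inj v) z)
      where
      eq : ∀ a b k → 1 * (a * k + b * k) ≡ k * (1 * (a + b))
      eq = solve-∀
      edgewise : ∀ v z f → ι (M f) * (δ (s f) (combine v z) + δ (t f) (combine v z)) ≡ δ (embed v (VS.cᴹ v f)) z * μ v f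
      edgewise v z f rewrite δ-s f v z | δ-t f v z with M f
      ... | false = sym (*-zeroʳ (δ (embed v (VS.cᴹ v f)) z))
      ... | true  = eq (δ (src f) v) (δ (tgt f) v) (δ (embed v (VS.cᴹ v f)) z)

    -- Which copy of `x` an edge reaches is ignored. A single copy of `v` carries weight at most `W`
    -- from the edges of M, and at most `3W` from the phase of the neighbour `x`.
    adj≤4W : ∀ u u′ → G′.adj hw u u′ ≤ 4 * W
    adj≤4W = by-copies λ v z → by-copies λ x z′ → begin
      G′.adj hw (combine v z) (combine x z′)
        ≤⟨ sum-mono (edgewise v z x z′) ⟩
      sum (λ f → δ (embed v (VS.cᴹ v f)) z * hM v f + δ (embed v (VS.c v x f)) z * free v x f)
        ≡⟨ ∑-distrib-+ (λ f → δ (embed v (VS.cᴹ v f)) z * hM v f) (λ f → δ (embed v (VS.c v x f)) z * free v x f) ⟩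
      sum (λ f → δ (embed v (VS.cᴹ v f)) z * hM v f) + sum (λ f → δ (embed v (VS.c v x f)) z * free v x f)
        ≤⟨ +-mono-≤ (embedded-bound (embed v) (embed-injective v) (VS.cᴹ v) (hM v) (VS.cᴹ≤W v) z)
             (embedded-bound (embed v) (embed-injective v) (VS.c v x) (free v x) (VS.c≤3W v x) z) ⟩
      W + 3 * W ∎
      where
      open ≤-Reasoning
      edgewise : ∀ v z x z′ f → hw f * (δ (s f) (combine v z) * δ (t f) (combine x z′) + δ (t f) (combine v z) * δ (s f) (combine x z′))
        ≤ δ (embed v (VS.cᴹ v f)) z * hM v f + δ (embed v (VS.c v x f)) z * free v x f
      edgewise v z x z′ f = begin
        hw f * (δ (s f) (combine v z) * δ (t f) (combine x z′) + δ (t f) (combine v z) * δ (s f) (combine x z′))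
          ≤⟨ *-monoʳ-≤ (hw f) (+-mono-≤
               (*-mono-≤ (≤-reflexive (δ-s f v z)) (drop (δ-t f x z′)))
               (*-mono-≤ (≤-reflexive (δ-t f v z)) (drop (δ-s f x z′)))) ⟩
        hw f * (δ (src f) v * δ (copy v (tgt f) f) z * δ (tgt f) x + δ (tgt f) v * δ (copy v (src f) f) z * δ (src f) x)
          ≡⟨ cong (hw f *_) (cong₂ _+_ (relabel (tgt f) (δ (src f) v)) (relabel (src f) (δ (tgt f) v))) ⟩
        hw f * (δ (src f) v * (δ (tgt f) x * δ (copy v x f) z) + δ (tgt f) v * (δ (src f) x * δ (copy v x f) z))
          ≤⟨ by-kind ⟩
        δ (embed v (VS.cᴹ v f)) z * hM v f + δ (embed v (VS.c v x f)) z * free v x f ∎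
        where
        drop : ∀ {a} {b c : Fin n} {y : Fin N} → a ≡ δ b c * δ y z′ → a ≤ δ b c
        drop {b = b} {c} {y} refl = ≤-trans (*-monoʳ-≤ (δ b c) (δ≤1 y z′)) (≤-reflexive (*-identityʳ (δ b c)))
        move : ∀ a k d → a * k * d ≡ a * (d * k)
        move = solve-∀
        relabel : ∀ q a → a * δ (copy v q f) z * δ q x ≡ a * (δ q x * δ (copy v x f) z)
        relabel q a = trans (move a (δ (copy v q f) z) (δ q x)) (cong (a *_) (δ-transport q x (λ x → δ (copy v x f) z)))
        eq₁ : ∀ h a b k → h * (a * (1 * k) + b * (1 * k)) ≡ k * (1 * (h * (a + b)))
        eq₁ = solve-∀
        eq₂ : ∀ h a b k x y → h * (a * (x * k) + b * (y * k)) ≡ k * (1 * (h * (a * x + b * y)))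
        eq₂ = solve-∀
        by-kind : hw f * (δ (src f) v * (δ (tgt f) x * δ (copy v x f) z) + δ (tgt f) v * (δ (src f) x * δ (copy v x f) z))
          ≤ δ (embed v (VS.cᴹ v f)) z * hM v f + δ (embed v (VS.c v x f)) z * free v x f
        by-kind with M f
        ... | true = ≤-trans (*-monoʳ-≤ (hw f) (+-mono-≤ (*-monoʳ-≤ (δ (src f) v) (*-monoˡ-≤ (δ (embed v (VS.cᴹ v f)) z) (δ≤1 (tgt f) x)))
                                                         (*-monoʳ-≤ (δ (tgt f) v) (*-monoˡ-≤ (δ (embed v (VS.cᴹ v f)) z) (δ≤1 (src f) x)))))
          (≤-trans (≤-reflexive (eq₁ (hw f) (δ (src f) v) (δ (tgt f) v) (δ (embed v (VS.cᴹ v f)) z))) (m≤m+n _ _))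
        ... | false = ≤-trans (≤-reflexive (eq₂ (hw f) (δ (src f) v) (δ (tgt f) v) (δ (embed v (VS.c v x f)) z) (δ (tgt f) x) (δ (src f) x))) (m≤n+m _ (δ (embed v (VS.cᴹ v f)) z * 0))

  module _ (src≢tgt : ∀ f → src f ≢ tgt f) (w≤W : ∀ f → w f ≤ W)
    (M-matching : ∀ v → G.star (λ f → ι (M f)) v ≤ suc (b v))
    (multiplicity≤ : ∀ u v → G.adj (λ _ → 1) u v ≤ suc (b u)) where

    ends≤1 : ∀ v f → end v f ≤ 1
    ends≤1 v f with src f Fin.≟ v
    ... | yes refl = ≤-reflexive (cong suc (δ-≢ (src≢tgt f ∘ sym)))
    ... | no _     = δ≤1 (tgt f) v

    hw≤W : ∀ f → hw f ≤ W
    hw≤W f = ≤-trans (*-mono-≤ (ι≤1 (H f)) (w≤W f)) (≤-reflexive (*-identityˡ W))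

    vertex-splits : ∀ v → VertexSplit (b v) W (μ v) (hM v) (free v)
    vertex-splits v = vertex-split W (μ v) (hM v) (free v)
      (λ f → *-mono-≤ (ι≤1 (M f)) (ends≤1 v f)) (M-matching v)
      (λ f → ≤-trans (*-monoʳ-≤ (ι (M f)) (*-monoˡ-≤ (end v f) (hw≤W f))) (≤-reflexive (eq (ι (M f)) W (end v f))))
      free≤W Σfree≤
      where
      open ≤-Reasoning
      eq : ∀ i W e → i * (W * e) ≡ W * (i * e)
      eq = solve-∀
      pair : Fin n → Fin m → ℕ
      pair x f = δ (src f) v * δ (tgt f) x + δ (tgt f) v * δ (src f) x
      pair≤1 : ∀ x f → pair x f ≤ 1
      pair≤1 x f = ≤-trans (+-mono-≤ (shrink (δ (src f) v) (tgt f)) (shrink (δ (tgt f) v) (src f))) (ends≤1 v f)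
        where
        shrink : ∀ a q → a * δ q x ≤ a
        shrink a q = ≤-trans (*-monoʳ-≤ a (δ≤1 q x)) (≤-reflexive (*-identityʳ a))
      free≤ : ∀ x f → free v x f ≤ W * (1 * pair x f)
      free≤ x f = ≤-trans (*-mono-≤ (ι≤1 (not (M f))) (*-monoˡ-≤ (pair x f) (hw≤W f)))
        (≤-reflexive (trans (*-identityˡ (W * pair x f)) (cong (W *_) (sym (*-identityˡ (pair x f))))))
      free≤W : ∀ x f → free v x f ≤ W
      free≤W x f = ≤-trans (free≤ x f) (≤-trans (*-monoʳ-≤ W (*-monoʳ-≤ 1 (pair≤1 x f))) (≤-reflexive (*-identityʳ W)))
      -- The bound on parallel edges enters here: with at most one edge to `x` per copy on average,
      -- each of weight at most `W`, a phase adds at most `W` per copy on average.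
      Σfree≤ : ∀ x → sum (free v x) ≤ suc (b v) * W
      Σfree≤ x = begin
        sum (free v x)                     ≤⟨ sum-mono (free≤ x) ⟩
        sum (λ f → W * (1 * pair x f))     ≡⟨ *-distribˡ-sum W (λ f → 1 * pair x f) ⟨
        W * G.adj (λ _ → 1) v x            ≤⟨ *-monoʳ-≤ W (multiplicity≤ v x) ⟩
        W * suc (b v)                      ≡⟨ *-comm W (suc (b v)) ⟩
        suc (b v) * W                      ∎

-- A-heavy says (1 - 20Wλ) w(M) ≤ (2 - 1/(2W)) w(A) for W = V + 1 and λ = p/D.
record HeavyMatching {n m : ℕ} (src tgt : Fin m → Fin n) (w : Fin m → ℕ) (H M : Fin m → Bool) (b : Fin n → ℕ) (V p D : ℕ) : Set where
  field
    A          : Fin m → Bool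
    A⊆H        : ∀ {f} → A f ≡ true → H f ≡ true
    A-matching : ∀ v → Multigraph.star src tgt (λ f → ι (A f)) v ≤ suc (b v)
    A-heavy    : 2 * suc V * D * sum (λ f → ι (M f) * w f)
                 ≤ (4 * V + 3) * D * sum (λ f → ι (A f) * w f) + 40 * suc V * suc V * p * sum (λ f → ι (M f) * w f)

-- Only the weighted degrees per unit of capacity enter the conditions on the edges: x and y are the
-- weighted degrees of the two copies joined by f, which differ from the averages by at most W = V + 1.
general-capacities : ∀ {n m} (src tgt : Fin m → Fin n) (w : Fin m → ℕ) (H M : Fin m → Bool) (b : Fin n → ℕ) (V B B⁻ p D : ℕ) →
  let open Multigraph src tgt
      d = star (λ f → ι (H f) * w f)
      W = suc V in
  (∀ f → src f ≢ tgt f) → (∀ f → 1 ≤ w f) → (∀ f → w f ≤ W) →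
  (∀ v → star (λ f → ι (M f)) v ≤ suc (b v)) → (∀ u v → adj (λ _ → 1) u v ≤ suc (b u)) →
  (∀ {f} → H f ≡ true → ∀ {x y} → suc (b (src f)) * x ≤ d (src f) + suc (b (src f)) * W →
    suc (b (tgt f)) * y ≤ d (tgt f) + suc (b (tgt f)) * W → x + y ≤ B * w f) →
  (∀ {f} → H f ≡ false → ∀ {x y} → d (src f) ≤ suc (b (src f)) * (x + W) →
    d (tgt f) ≤ suc (b (tgt f)) * (y + W) → B⁻ * w f ≤ x + y) →
  2 * W * W * (D * D) ≤ B * (p * p) → D * (B ∸ B⁻) ≤ p * B → 0 < p → 0 < B →
  HeavyMatching src tgt w H M b V p D
general-capacities {n} {m} src tgt w H M b V B B⁻ p D src≢tgt 1≤w w≤W M-matching multiplicity≤ H-edges G∖H-edges B-large gap-small 0<p 0<B =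
  merge (S.vertex-splits src≢tgt w≤W M-matching multiplicity≤)
  where
  W = suc V
  module S = Split src tgt w H M b W
  merge : (∀ v → VertexSplit (b v) W (S.μ v) (S.hM v) (S.free v)) → HeavyMatching src tgt w H M b V p D
  merge split = from-copies (unit-capacities s t w H M V B B⁻ p D (S.M-disjoint split) (S.adj≤4W split) 1≤w w≤W
      (λ {f} Hf → subst₂ (λ x y → x + y ≤ B * w f) (sym (S.star-level split _ _)) (sym (S.star-level split _ _))
        (H-edges Hf (S.average-above split (src f) _) (S.average-above split (tgt f) _)))
      (λ {f} Hf → subst₂ (λ x y → B⁻ * w f ≤ x + y) (sym (S.star-level split _ _)) (sym (S.star-level split _ _))
        (G∖H-edges Hf (S.average-below split (src f) _) (S.average-below split (tgt f) _)))
      B-large gap-small 0<p 0<B)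
    where
    s = S.s split
    t = S.t split
    from-copies : RoundedMatching s t w H M V p D → HeavyMatching src tgt w H M b V p D
    from-copies R = record { A = A ; A⊆H = A⊆H ; A-heavy = A-heavy ; A-matching = λ v → begin
        Multigraph.star src tgt (λ f → ι (A f)) v
          ≡⟨ S.unsplit split (λ f → ι (A f)) v ⟨
        sum (λ i → Multigraph.star s t (λ f → ι (A f)) (combine v (S.embed v i)))
          ≤⟨ sum-mono (λ i → A-disjoint (combine v (S.embed v i))) ⟩
        sum {suc (b v)} (λ _ → 1)
          ≡⟨ trans (sum-const (suc (b v)) 1) (*-identityʳ (suc (b v))) ⟩
        suc (b v) ∎ }
      where
      open ≤-Reasoning
      open RoundedMatching R

-- Rational parameters

toℚᵘ-/ : ∀ a d → ℚ.toℚᵘ (ℤ.+ a ℚ./ suc d) ℚᵘ.≃ mkℚᵘ (ℤ.+ a) d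
toℚᵘ-/ a d = ℚ.toℚᵘ-fromℚᵘ (mkℚᵘ (ℤ.+ a) d)

toℚ-+ : ∀ a b → toℚ (a + b) ≡ toℚ a ℚ.+ toℚ b
toℚ-+ a b = ℚ.toℚᵘ-injective (ℚᵘ.≃-trans (toℚᵘ-/ (a + b) 0) (ℚᵘ.≃-sym
  (ℚᵘ.≃-trans (ℚ.toℚᵘ-homo-+ (toℚ a) (toℚ b)) (ℚᵘ.≃-trans (ℚᵘ.+-cong (toℚᵘ-/ a 0) (toℚᵘ-/ b 0))
    (ℚᵘ.*≡* (trans (eq (ℤ.+ a) (ℤ.+ b)) (cong (ℤ._* ℤ.+ 1) (sym (ℤ.pos-+ a b)))))))))
  where
  eq : ∀ x y → (x ℤ.* ℤ.+ 1 ℤ.+ y ℤ.* ℤ.+ 1) ℤ.* ℤ.+ 1 ≡ (x ℤ.+ y) ℤ.* ℤ.+ 1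
  eq = ℤ-Solver.solve-∀

toℚ-* : ∀ a b → toℚ (a * b) ≡ toℚ a ℚ.* toℚ b
toℚ-* a b = ℚ.toℚᵘ-injective (ℚᵘ.≃-trans (toℚᵘ-/ (a * b) 0) (ℚᵘ.≃-sym
  (ℚᵘ.≃-trans (ℚ.toℚᵘ-homo-* (toℚ a) (toℚ b)) (ℚᵘ.≃-trans (ℚᵘ.*-cong (toℚᵘ-/ a 0) (toℚᵘ-/ b 0))
    (ℚᵘ.*≡* (cong (ℤ._* ℤ.+ 1) (sym (ℤ.pos-* a b))))))))

fraction-cancel : ∀ {x a d} → ℚ.toℚᵘ x ℚᵘ.≃ mkℚᵘ (ℤ.+ a) d → x ℚ.* toℚ (suc d) ≡ toℚ a
fraction-cancel {x} {a} {d} x≃ = ℚ.toℚᵘ-injective (ℚᵘ.≃-trans (ℚ.toℚᵘ-homo-* x (toℚ (suc d)))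
  (ℚᵘ.≃-trans (ℚᵘ.*-cong x≃ (toℚᵘ-/ (suc d) 0)) (ℚᵘ.≃-trans
    (ℚᵘ.*≡* (trans (eq (ℤ.+ a) (ℤ.+ suc d)) (cong (λ z → ℤ.+ a ℤ.* ℤ.+ z) (sym (*-identityʳ (suc d)))))) (ℚᵘ.≃-sym (toℚᵘ-/ a 0)))))
  where
  eq : ∀ x y → x ℤ.* y ℤ.* ℤ.+ 1 ≡ x ℤ.* y
  eq = ℤ-Solver.solve-∀

ratio-cancel : ∀ a {d} → 1 ≤ d → ratio a d ℚ.* toℚ d ≡ toℚ a
ratio-cancel a {suc d} _ = fraction-cancel (toℚᵘ-/ a d)

toℚ-mono : ∀ {a b} → a ≤ b → toℚ a ℚ.≤ toℚ b
toℚ-mono {a} {b} a≤b = ℚ.toℚᵘ-cancel-≤ (ℚᵘ.≤-respˡ-≃ (ℚᵘ.≃-sym (toℚᵘ-/ a 0)) (ℚᵘ.≤-respʳ-≃ (ℚᵘ.≃-sym (toℚᵘ-/ b 0))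
  (ℚᵘ.*≤* (ℤ.*-monoʳ-≤-nonNeg (ℤ.+ 1) (ℤ.+≤+ a≤b)))))

toℚ-cancel : ∀ {a b} → toℚ a ℚ.≤ toℚ b → a ≤ b
toℚ-cancel {a} {b} a≤b with ℚᵘ.≤-respˡ-≃ (toℚᵘ-/ a 0) (ℚᵘ.≤-respʳ-≃ (toℚᵘ-/ b 0) (ℚ.toℚᵘ-mono-≤ a≤b))
... | ℚᵘ.*≤* le = ℤ.drop‿+≤+ (ℤ.*-cancelʳ-≤-pos (ℤ.+ a) (ℤ.+ b) (ℤ.+ 1) le)

scale : ∀ k {x y} → x ℚ.≤ y → x ℚ.* toℚ k ℚ.≤ y ℚ.* toℚ k
scale k = ℚ.*-monoʳ-≤-nonNeg (toℚ k) {{ℚ.nonNegative (toℚ-mono {0} {k} z≤n)}}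

unscale : ∀ {k x y} → 1 ≤ k → x ℚ.* toℚ k ℚ.≤ y ℚ.* toℚ k → x ℚ.≤ y
unscale {suc k} _ = ℚ.*-cancelʳ-≤-pos (toℚ (suc k)) {{ℚ.normalize-pos (suc k) 1}}

numeral : ∀ {ε} → ℚ.0ℚ ℚ.< ε → ∃ λ p → ∃ λ q → 1 ≤ p × 1 ≤ q × ε ℚ.* toℚ q ≡ toℚ p
numeral {ε@(mkℚ (ℤ.+ suc p) d c)} _ = suc p , suc d , s≤s z≤n , s≤s z≤n , fraction-cancel {ε} {suc p} {d} ℚᵘ.≃-refl
numeral {mkℚ (ℤ.+ zero) d c} 0<ε with ℚ.positive 0<ε
... | ()
numeral {mkℚ ℤ.-[1+ n ] d c} 0<ε with ℚ.positive 0<ε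
... | ()

0≤toℚ : ∀ k → ℚ.0ℚ ℚ.≤ toℚ k
0≤toℚ k = toℚ-mono {0} {k} z≤n

mul-mono : ∀ {a x y} → ℚ.0ℚ ℚ.≤ a → x ℚ.≤ y → a ℚ.* x ℚ.≤ a ℚ.* y
mul-mono {a} 0≤a = ℚ.*-monoˡ-≤-nonNeg a {{ℚ.nonNegative 0≤a}}

mul-nonneg : ∀ {a b} → ℚ.0ℚ ℚ.≤ a → ℚ.0ℚ ℚ.≤ b → ℚ.0ℚ ℚ.≤ a ℚ.* b
mul-nonneg {a} {b} 0≤a 0≤b = subst (ℚ._≤ a ℚ.* b) (ℚ.*-zeroʳ a) (mul-mono 0≤a 0≤b)

module _ (t : ℚ) (0≤t : ℚ.0ℚ ℚ.≤ t) (t≤1 : t ℚ.≤ ℚ.1ℚ) where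

  0≤1/ : ∀ i → ℚ.0ℚ ℚ.≤ ratio 1 (suc i)
  0≤1/ i = unscale {suc i} (s≤s z≤n) (subst₂ ℚ._≤_ (sym (ℚ.*-zeroˡ (toℚ (suc i)))) (sym (ratio-cancel 1 {suc i} (s≤s z≤n))) (0≤toℚ 1))

  0≤expTerm : ∀ i → ℚ.0ℚ ℚ.≤ expTerm t i
  0≤expTerm zero    = 0≤toℚ 1
  0≤expTerm (suc i) = mul-nonneg (mul-nonneg (0≤expTerm i) 0≤t) (0≤1/ i)

  expTerm-halves : ∀ i → expTerm t (2 + i) ℚ.+ expTerm t (2 + i) ℚ.≤ expTerm t (suc i)
  expTerm-halves i = begin
    T ℚ.* t ℚ.* r ℚ.+ T ℚ.* t ℚ.* r ≡⟨ sym (ℚ.*-distribˡ-+ (T ℚ.* t) r r) ⟩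
    T ℚ.* t ℚ.* (r ℚ.+ r)           ≤⟨ mul-mono (mul-nonneg (0≤expTerm (suc i)) 0≤t) r+r≤1 ⟩
    T ℚ.* t ℚ.* ℚ.1ℚ                ≡⟨ ℚ.*-identityʳ (T ℚ.* t) ⟩
    T ℚ.* t                         ≤⟨ mul-mono (0≤expTerm (suc i)) t≤1 ⟩
    T ℚ.* ℚ.1ℚ                      ≡⟨ ℚ.*-identityʳ T ⟩
    T                               ∎
    where
    open ℚ.≤-Reasoning
    T = expTerm t (suc i)
    r = ratio 1 (2 + i)
    r+r≤1 : r ℚ.+ r ℚ.≤ ℚ.1ℚ
    r+r≤1 = unscale {2 + i} (s≤s z≤n) (begin
      (r ℚ.+ r) ℚ.* toℚ (2 + i)                 ≡⟨ ℚ.*-distribʳ-+ (toℚ (2 + i)) r r ⟩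
      r ℚ.* toℚ (2 + i) ℚ.+ r ℚ.* toℚ (2 + i)   ≡⟨ cong₂ ℚ._+_ (ratio-cancel 1 {2 + i} (s≤s z≤n)) (ratio-cancel 1 {2 + i} (s≤s z≤n)) ⟩
      toℚ 2                                     ≤⟨ toℚ-mono {2} {2 + i} (s≤s (s≤s z≤n)) ⟩
      toℚ (2 + i)                               ≡⟨ ℚ.*-identityˡ (toℚ (2 + i)) ⟨
      ℚ.1ℚ ℚ.* toℚ (2 + i)                      ∎)

  -- A geometric tail bound: for `t ≤ 1` the terms at least halve from the linear one on, so partial
  -- sum plus twice the next term never increases. It starts at `1 + 2t ≤ 3`.
  expPartial-invariant : ∀ k → expPartial t (suc k) ℚ.+ (expTerm t (suc k) ℚ.+ expTerm t (suc k)) ℚ.≤ toℚ 3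
  expPartial-invariant zero = ℚ.+-monoʳ-≤ ℚ.1ℚ (ℚ.+-mono-≤ T₁≤1 T₁≤1)
    where
    T₁≤1 : expTerm t 1 ℚ.≤ ℚ.1ℚ
    T₁≤1 = ℚ.≤-trans (ℚ.≤-reflexive (trans (ℚ.*-identityʳ (ℚ.1ℚ ℚ.* t)) (ℚ.*-identityˡ t))) t≤1
  expPartial-invariant (suc k) = begin
    P ℚ.+ T ℚ.+ (T′ ℚ.+ T′) ≤⟨ ℚ.+-monoʳ-≤ (P ℚ.+ T) (expTerm-halves k) ⟩
    P ℚ.+ T ℚ.+ T           ≡⟨ ℚ.+-assoc P T T ⟩
    P ℚ.+ (T ℚ.+ T)         ≤⟨ expPartial-invariant k ⟩
    toℚ 3                   ∎
    where
    open ℚ.≤-Reasoning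
    P = expPartial t (suc k)
    T = expTerm t (suc k)
    T′ = expTerm t (2 + k)

  expPartial≤3 : ∀ k → expPartial t k ℚ.≤ toℚ 3
  expPartial≤3 zero    = 0≤toℚ 3
  expPartial≤3 (suc k) = ℚ.≤-trans (subst (ℚ._≤ P ℚ.+ (T ℚ.+ T)) (ℚ.+-identityʳ P)
    (ℚ.+-monoʳ-≤ P (ℚ.+-mono-≤ (0≤expTerm (suc k)) (0≤expTerm (suc k))))) (expPartial-invariant k)
    where
    P = expPartial t (suc k)
    T = expTerm t (suc k)

-- Nothing more of the logarithmic hypothesis is needed.
LnLe⇒1≤ : ∀ {n t} → 4 ≤ n → ℚ.0ℚ ℚ.≤ t → LnLe (toℚ n) t → ℚ.1ℚ ℚ.≤ t
LnLe⇒1≤ {n} {t} 4≤n 0≤t (k , n≤exp) with ℚ.≤-total t ℚ.1ℚ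
... | inj₂ 1≤t = 1≤t
... | inj₁ t≤1 = contradiction (toℚ-cancel {4} {3} (ℚ.≤-trans (toℚ-mono 4≤n) (ℚ.≤-trans n≤exp (expPartial≤3 t 0≤t t≤1 k)))) λ { (s≤s (s≤s (s≤s ()))) }

module Parameters (ε : ℚ) (p q : ℕ) (εq≡p : ε ℚ.* toℚ q ≡ toℚ p) (V β β⁻ : ℕ) where

  W D X : ℕ
  W = suc V
  -- The denominator for which `lam = p / D`, given `ε = p / q`.
  D = 100 * W * q
  X = β + 6 * W

  lam x t : ℚ
  lam = ε ℚ.* ratio 1 (100 * W)
  x = toℚ X
  t = x ℚ.* lam ℚ.* lam ℚ.* ratio 1 (2 * W * W)

  lam-D : lam ℚ.* toℚ D ≡ toℚ p
  lam-D = begin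
    lam ℚ.* toℚ (100 * W * q)
      ≡⟨ cong (lam ℚ.*_) (toℚ-* (100 * W) q) ⟩
    ε ℚ.* ratio 1 (100 * W) ℚ.* (toℚ (100 * W) ℚ.* toℚ q)
      ≡⟨ solve 4 (λ a b c d → a :* b :* (c :* d) := (a :* d) :* (b :* c)) refl ε (ratio 1 (100 * W)) (toℚ (100 * W)) (toℚ q) ⟩
    ε ℚ.* toℚ q ℚ.* (ratio 1 (100 * W) ℚ.* toℚ (100 * W))
      ≡⟨ cong₂ ℚ._*_ εq≡p (ratio-cancel 1 {100 * W} (s≤s z≤n)) ⟩
    toℚ p ℚ.* ℚ.1ℚ
      ≡⟨ ℚ.*-identityʳ (toℚ p) ⟩
    toℚ p ∎
    where open ≡-Reasoning

  t-scaled : t ℚ.* toℚ (2 * W * W * (D * D)) ≡ toℚ (X * (p * p))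
  t-scaled = begin
    t ℚ.* toℚ (2 * W * W * (D * D))
      ≡⟨ cong (t ℚ.*_) (trans (toℚ-* (2 * W * W) (D * D)) (cong (toℚ (2 * W * W) ℚ.*_) (toℚ-* D D))) ⟩
    x ℚ.* lam ℚ.* lam ℚ.* ratio 1 (2 * W * W) ℚ.* (toℚ (2 * W * W) ℚ.* (toℚ D ℚ.* toℚ D))
      ≡⟨ solve 5 (λ x l r k d → x :* l :* l :* r :* (k :* (d :* d)) := x :* ((l :* d) :* (l :* d)) :* (r :* k)) refl
           x lam (ratio 1 (2 * W * W)) (toℚ (2 * W * W)) (toℚ D) ⟩
    x ℚ.* ((lam ℚ.* toℚ D) ℚ.* (lam ℚ.* toℚ D)) ℚ.* (ratio 1 (2 * W * W) ℚ.* toℚ (2 * W * W))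
      ≡⟨ cong₂ (λ a b → x ℚ.* (a ℚ.* a) ℚ.* b) lam-D (ratio-cancel 1 {2 * W * W} (s≤s z≤n)) ⟩
    x ℚ.* (toℚ p ℚ.* toℚ p) ℚ.* ℚ.1ℚ
      ≡⟨ ℚ.*-identityʳ _ ⟩
    x ℚ.* (toℚ p ℚ.* toℚ p)
      ≡⟨ trans (toℚ-* X (p * p)) (cong (x ℚ.*_) (toℚ-* p p)) ⟨
    toℚ (X * (p * p)) ∎
    where open ≡-Reasoning

  -- By `t-scaled`, `t` is the quotient of the right side by the left. As `4 ≤ X` while `exp t ≤ 3`
  -- for `t ≤ 1`, the logarithmic condition gives `1 ≤ t`.
  X-large : 4 ≤ X → 1 ≤ q → LnLe x t → 2 * W * W * (D * D) ≤ X * (p * p)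
  X-large 4≤X 1≤q ln = toℚ-cancel (begin
    toℚ Z          ≡⟨ ℚ.*-identityˡ (toℚ Z) ⟨
    ℚ.1ℚ ℚ.* toℚ Z ≤⟨ scale Z (LnLe⇒1≤ 4≤X 0≤t ln) ⟩
    t ℚ.* toℚ Z    ≡⟨ t-scaled ⟩
    toℚ (X * (p * p)) ∎)
    where
    open ℚ.≤-Reasoning
    Z = 2 * W * W * (D * D)
    1≤D : 1 ≤ D
    1≤D = *-mono-≤ {1} {100 * W} (s≤s z≤n) 1≤q
    0≤t : ℚ.0ℚ ℚ.≤ t
    0≤t = unscale {Z} (*-mono-≤ {1} {2 * W * W} (s≤s z≤n) (*-mono-≤ 1≤D 1≤D))
      (subst₂ ℚ._≤_ (sym (ℚ.*-zeroˡ (toℚ Z))) (sym t-scaled) (0≤toℚ (X * (p * p))))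

  -- After multiplication by `D` the subtracted terms are moved across before passing to natural
  -- numbers; the truncation in `β⁻ ∸ 6 * W` then goes in the right direction.
  gap-small : (ℚ.1ℚ ℚ.- lam) ℚ.* x ℚ.≤ toℚ β⁻ ℚ.- toℚ (6 * W) → D * (X ∸ (β⁻ ∸ 6 * W)) ≤ p * X
  gap-small gap = ≤-trans (≤-reflexive (*-distribˡ-∸ D X (β⁻ ∸ 6 * W)))
    (m≤n+o⇒m∸n≤o (D * X) (D * (β⁻ ∸ 6 * W)) (+-cancelʳ-≤ (6 * W * D) _ _ (begin
      D * X + 6 * W * D                            ≤⟨ toℚ-cancel cleared ⟩
      β⁻ * D + p * X                               ≤⟨ +-monoˡ-≤ (p * X) (*-monoˡ-≤ D (≤-trans (m≤n+m∸n β⁻ (6 * W)) (≤-reflexive (+-comm (6 * W) _)))) ⟩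
      (β⁻ ∸ 6 * W + 6 * W) * D + p * X             ≡⟨ eq (β⁻ ∸ 6 * W) (6 * W) D (p * X) ⟩
      D * (β⁻ ∸ 6 * W) + p * X + 6 * W * D         ∎)))
    where
    open ≤-Reasoning
    eq : ∀ a c D y → (a + c) * D + y ≡ D * a + y + c * D
    eq = solve-∀
    toℚ-+* : ∀ a b c d → toℚ (a * b + c * d) ≡ toℚ a ℚ.* toℚ b ℚ.+ toℚ c ℚ.* toℚ d
    toℚ-+* a b c d = trans (toℚ-+ (a * b) (c * d)) (cong₂ ℚ._+_ (toℚ-* a b) (toℚ-* c d))
    cleared : toℚ (D * X + 6 * W * D) ℚ.≤ toℚ (β⁻ * D + p * X)
    cleared = subst₂ ℚ._≤_
      (trans (solve 5 (λ u l x d c → (u :- l) :* x :* d :+ ((l :* d) :* x :+ c :* d) := d :* (u :* x) :+ c :* d) refl ℚ.1ℚ lam x (toℚ D) (toℚ (6 * W)))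
        (trans (cong (λ z → toℚ D ℚ.* z ℚ.+ toℚ (6 * W) ℚ.* toℚ D) (ℚ.*-identityˡ x)) (sym (toℚ-+* D X (6 * W) D))))
      (trans (solve 4 (λ b c d y → (b :- c) :* d :+ (y :+ c :* d) := b :* d :+ y) refl (toℚ β⁻) (toℚ (6 * W)) (toℚ D) (lam ℚ.* toℚ D ℚ.* x))
        (trans (cong (λ z → toℚ β⁻ ℚ.* toℚ D ℚ.+ z ℚ.* x) lam-D) (sym (toℚ-+* β⁻ D p X))))
      (ℚ.+-monoˡ-≤ (lam ℚ.* toℚ D ℚ.* x ℚ.+ toℚ (6 * W) ℚ.* toℚ D) (scale D gap))

  2p≤q : ε ℚ.< (ℤ.+ 1 ℚ./ 2) → 2 * p ≤ q
  2p≤q ε<½ = toℚ-cancel (begin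
    toℚ (2 * p)                            ≡⟨ toℚ-* 2 p ⟩
    toℚ 2 ℚ.* toℚ p                        ≡⟨ cong (toℚ 2 ℚ.*_) εq≡p ⟨
    toℚ 2 ℚ.* (ε ℚ.* toℚ q)                ≤⟨ mul-mono (0≤toℚ 2) (scale q (ℚ.<⇒≤ ε<½)) ⟩
    toℚ 2 ℚ.* (ℤ.+ 1 ℚ./ 2 ℚ.* toℚ q)      ≡⟨ ℚ.*-assoc (toℚ 2) (ℤ.+ 1 ℚ./ 2) (toℚ q) ⟨
    ℚ.1ℚ ℚ.* toℚ q                         ≡⟨ ℚ.*-identityˡ (toℚ q) ⟩
    toℚ q                                  ∎)
    where open ℚ.≤-Reasoning

  -- With r = 5q - p the hypothesis reads 2W r wM ≤ 5q(4W - 1) wA.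
  simplified : 2 * p ≤ q → 1 ≤ q → ∀ wM wA →
    2 * W * D * wM ≤ (4 * V + 3) * D * wA + 40 * W * W * p * wM →
    2 * W * q * wM ≤ ((4 * V + 3) * q + 2 * W * p) * wA
  simplified 2p≤q 1≤q wM wA heavy = *-cancelˡ-≤ r {{>-nonZero 1≤r}} (begin
    r * (2 * W * q * wM)          ≡⟨ eq₁ r W q wM ⟩
    q * (2 * W * r * wM)          ≤⟨ *-monoʳ-≤ q r-heavy ⟩
    q * (5 * q * (4 * V + 3) * wA) ≡⟨ eq₂ q V wA ⟩
    5 * q * ((4 * V + 3) * q) * wA ≤⟨ *-monoˡ-≤ wA coefficient ⟩
    r * C * wA                    ≡⟨ *-assoc r C wA ⟩
    r * (C * wA)                  ∎)
    where
    open ≤-Reasoning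
    C = (4 * V + 3) * q + 2 * W * p
    r = 5 * q ∸ p
    p≤q : p ≤ q
    p≤q = ≤-trans (m≤m+n p (p + 0)) 2p≤q
    p+r≡5q : p + r ≡ 5 * q
    p+r≡5q = m+[n∸m]≡n (≤-trans p≤q (m≤m+n q (4 * q)))
    1≤r : 1 ≤ r
    1≤r = +-cancelˡ-≤ p _ _ (begin
      p + 1     ≤⟨ +-mono-≤ p≤q 1≤q ⟩
      q + q     ≤⟨ +-monoʳ-≤ q (m≤m+n q (3 * q)) ⟩
      5 * q     ≡⟨ p+r≡5q ⟨
      p + r     ∎)
    eq₁ : ∀ r W q m → r * (2 * W * q * m) ≡ q * (2 * W * r * m)
    eq₁ = solve-∀
    eq₂ : ∀ q V a → q * (5 * q * (4 * V + 3) * a) ≡ 5 * q * ((4 * V + 3) * q) * a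
    eq₂ = solve-∀
    eq₃ : ∀ W p r m → 20 * W * (2 * W * r * m + 2 * W * p * m) ≡ 40 * W * W * (p + r) * m
    eq₃ = solve-∀
    eq₄ : ∀ W q m → 40 * W * W * (5 * q) * m ≡ 2 * W * (100 * W * q) * m
    eq₄ = solve-∀
    eq₅ : ∀ V W q p m a → (4 * V + 3) * (100 * W * q) * a + 40 * W * W * p * m ≡ 20 * W * (5 * q * (4 * V + 3) * a + 2 * W * p * m)
    eq₅ = solve-∀
    r-heavy : 2 * W * r * wM ≤ 5 * q * (4 * V + 3) * wA
    r-heavy = +-cancelʳ-≤ (2 * W * p * wM) _ _ (*-cancelˡ-≤ (20 * W) (begin
      20 * W * (2 * W * r * wM + 2 * W * p * wM) ≡⟨ eq₃ W p r wM ⟩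
      40 * W * W * (p + r) * wM                  ≡⟨ cong (λ z → 40 * W * W * z * wM) p+r≡5q ⟩
      40 * W * W * (5 * q) * wM                  ≡⟨ eq₄ W q wM ⟩
      2 * W * D * wM                             ≤⟨ heavy ⟩
      (4 * V + 3) * D * wA + 40 * W * W * p * wM ≡⟨ eq₅ V W q p wM wA ⟩
      20 * W * (5 * q * (4 * V + 3) * wA + 2 * W * p * wM) ∎))
    eq₆ : ∀ V q p → p * ((4 * V + 3) * q + 2 * suc V * p) ≡ p * (4 * V + 3) * q + suc V * p * (2 * p)
    eq₆ = solve-∀
    eq₇ : ∀ V q p → p * (4 * V + 3) * q + suc V * p * q + (5 * V * p * q + 6 * p * q) ≡ 5 * q * (2 * suc V * p)
    eq₇ = solve-∀
    eq₈ : ∀ V q p r → 5 * q * ((4 * V + 3) * q) + 5 * q * (2 * suc V * p) ≡ 5 * q * ((4 * V + 3) * q + 2 * suc V * p)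
    eq₈ = solve-∀
    -- This is `2 - 1/(2W) ≤ (1 - ε/5)(2 - 1/(2W) + ε)` with denominators cleared. Cancelling common
    -- terms leaves `p * C ≤ 10 * W * q * p`, which follows from `2 * p ≤ q`.
    coefficient : 5 * q * ((4 * V + 3) * q) ≤ r * C
    coefficient = +-cancelʳ-≤ (p * C) _ _ (begin
      5 * q * ((4 * V + 3) * q) + p * C
        ≡⟨ cong (5 * q * ((4 * V + 3) * q) +_) (eq₆ V q p) ⟩
      5 * q * ((4 * V + 3) * q) + (p * (4 * V + 3) * q + W * p * (2 * p))
        ≤⟨ +-monoʳ-≤ (5 * q * ((4 * V + 3) * q)) (≤-trans (+-monoʳ-≤ (p * (4 * V + 3) * q) (*-monoʳ-≤ (W * p) 2p≤q)) (m≤m+n _ (5 * V * p * q + 6 * p * q))) ⟩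
      5 * q * ((4 * V + 3) * q) + (p * (4 * V + 3) * q + W * p * q + (5 * V * p * q + 6 * p * q))
        ≡⟨ cong (5 * q * ((4 * V + 3) * q) +_) (eq₇ V q p) ⟩
      5 * q * ((4 * V + 3) * q) + 5 * q * (2 * W * p)
        ≡⟨ eq₈ V q p r ⟩
      5 * q * C
        ≡⟨ cong (_* C) p+r≡5q ⟨
      (p + r) * C
        ≡⟨ trans (*-distribʳ-+ C p r) (+-comm (p * C) (r * C)) ⟩
      r * C + p * C ∎)

  ratio-bound : 1 ≤ q → ∀ wM wA → 2 * W * q * wM ≤ ((4 * V + 3) * q + 2 * W * p) * wA →
    toℚ wM ℚ.≤ (toℚ 2 ℚ.- ratio 1 (2 * W) ℚ.+ ε) ℚ.* toℚ wA
  ratio-bound 1≤q wM wA bound = unscale {2 * W * q} (*-mono-≤ {1} {2 * W} (s≤s z≤n) 1≤q) (begin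
    toℚ wM ℚ.* toℚ (2 * W * q)     ≡⟨ toℚ-* wM (2 * W * q) ⟨
    toℚ (wM * (2 * W * q))         ≤⟨ toℚ-mono (≤-trans (≤-reflexive (*-comm wM (2 * W * q))) bound) ⟩
    toℚ (C * wA)                   ≡⟨ toℚ-* C wA ⟩
    toℚ C ℚ.* A
      ≡⟨ cong (ℚ._* A) (trans (toℚ-+ ((4 * V + 3) * q) (2 * W * p)) (cong₂ ℚ._+_ (toℚ-* (4 * V + 3) q) (toℚ-* (2 * W) p))) ⟩
    (toℚ (4 * V + 3) ℚ.* toℚ q ℚ.+ k ℚ.* toℚ p) ℚ.* A
      ≡⟨ cong (λ z → (z ℚ.* toℚ q ℚ.+ k ℚ.* toℚ p) ℚ.* A) c≡ ⟩
    ((two ℚ.* k ℚ.- ℚ.1ℚ) ℚ.* toℚ q ℚ.+ k ℚ.* toℚ p) ℚ.* A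
      ≡⟨ cong₂ (λ a b → ((two ℚ.* k ℚ.- a) ℚ.* toℚ q ℚ.+ k ℚ.* b) ℚ.* A) (ratio-cancel 1 {2 * W} (s≤s z≤n)) εq≡p ⟨
    ((two ℚ.* k ℚ.- ρ ℚ.* k) ℚ.* toℚ q ℚ.+ k ℚ.* (ε ℚ.* toℚ q)) ℚ.* A
      ≡⟨ solve 6 (λ d k r e q a → ((d :* k :- r :* k) :* q :+ k :* (e :* q)) :* a := (d :- r :+ e) :* a :* (k :* q)) refl two k ρ ε (toℚ q) A ⟩
    (two ℚ.- ρ ℚ.+ ε) ℚ.* A ℚ.* (k ℚ.* toℚ q)
      ≡⟨ cong ((two ℚ.- ρ ℚ.+ ε) ℚ.* A ℚ.*_) (toℚ-* (2 * W) q) ⟨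
    (two ℚ.- ρ ℚ.+ ε) ℚ.* A ℚ.* toℚ (2 * W * q) ∎)
    where
    open ℚ.≤-Reasoning
    C = (4 * V + 3) * q + 2 * W * p
    A = toℚ wA
    k = toℚ (2 * W)
    ρ = ratio 1 (2 * W)
    two = toℚ 2
    eq : ∀ V → 4 * V + 3 + 1 ≡ 2 * (2 * suc V)
    eq = solve-∀
    c≡ : toℚ (4 * V + 3) ≡ two ℚ.* k ℚ.- ℚ.1ℚ
    c≡ = trans (solve 2 (λ c u → c := c :+ u :- u) refl (toℚ (4 * V + 3)) ℚ.1ℚ)
      (cong (ℚ._- ℚ.1ℚ) (trans (sym (toℚ-+ (4 * V + 3) 1)) (trans (cong toℚ (eq V)) (toℚ-* 2 (2 * W)))))

-- From the given graph and EDCS to the theorem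

maximiser : ∀ {m} {P : Subset m → Set} → (∀ M → Dec (P M)) → (φ : Subset m → ℕ) → ∀ {T} → (∀ M → φ M ≤ T) →
  ∃ P → ∃ λ M → P M × (∀ M′ → P M′ → φ M′ ≤ φ M)
maximiser {m} {P} P? φ {T} φ≤T (M₀ , PM₀) = climb T M₀ PM₀ (m≤n+m T (φ M₀))
  where
  climb : ∀ k M → P M → T ≤ φ M + k → ∃ λ M → P M × (∀ M′ → P M′ → φ M′ ≤ φ M)
  climb k M PM T≤ with anySubset? (λ M′ → P? M′ ×-dec (φ M <? φ M′))
  ... | no none = M , PM , λ M′ PM′ → ≮⇒≥ λ better → none (M′ , PM′ , better)
  climb zero    M PM T≤ | yes (M′ , _ , better) =
    contradiction (≤-trans better (φ≤T M′)) (≤⇒≯ (≤-trans T≤ (≤-reflexive (+-identityʳ (φ M)))))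
  climb (suc k) M PM T≤ | yes (M′ , PM′ , better) =
    climb k M′ PM′ (≤-trans T≤ (≤-trans (≤-reflexive (+-suc (φ M) k)) (+-monoˡ-≤ k better)))

copy-above : ∀ {x a b W} → 1 ≤ b → suc (pred b) * x ≤ a + suc (pred b) * W → toℚ x ℚ.≤ ratio a b ℚ.+ toℚ W
copy-above {x} {a} {suc b} {W} 1≤b bx≤ = unscale {suc b} 1≤b (begin
  toℚ x ℚ.* toℚ (suc b)                                 ≡⟨ toℚ-* x (suc b) ⟨
  toℚ (x * suc b)                                       ≤⟨ toℚ-mono (≤-trans (≤-reflexive (*-comm x (suc b))) bx≤) ⟩
  toℚ (a + suc b * W)                                   ≡⟨ trans (cong (λ z → toℚ (a + z)) (*-comm (suc b) W)) (toℚ-+ a (W * suc b)) ⟩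
  toℚ a ℚ.+ toℚ (W * suc b)                             ≡⟨ cong₂ ℚ._+_ (sym (ratio-cancel a {suc b} 1≤b)) (toℚ-* W (suc b)) ⟩
  ratio a (suc b) ℚ.* toℚ (suc b) ℚ.+ toℚ W ℚ.* toℚ (suc b) ≡⟨ ℚ.*-distribʳ-+ (toℚ (suc b)) (ratio a (suc b)) (toℚ W) ⟨
  (ratio a (suc b) ℚ.+ toℚ W) ℚ.* toℚ (suc b)           ∎)
  where open ℚ.≤-Reasoning

copy-below : ∀ {x a b W} → 1 ≤ b → a ≤ suc (pred b) * (x + W) → ratio a b ℚ.≤ toℚ (x + W)
copy-below {x} {a} {suc b} {W} 1≤b a≤ = unscale {suc b} 1≤b (begin
  ratio a (suc b) ℚ.* toℚ (suc b) ≡⟨ ratio-cancel a {suc b} 1≤b ⟩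
  toℚ a                           ≤⟨ toℚ-mono (≤-trans a≤ (≤-reflexive (*-comm (suc b) (x + W)))) ⟩
  toℚ ((x + W) * suc b)           ≡⟨ toℚ-* (x + W) (suc b) ⟩
  toℚ (x + W) ℚ.* toℚ (suc b)     ∎)
  where open ℚ.≤-Reasoning

-- The copies at the two ends of an edge together deviate from their averages by at most `2W`. As
-- `w ≥ 1`, the shift of β and β⁻ by `6W` absorbs this even after multiplication by `w`.
2W≤6Ww : ∀ W {w} → 1 ≤ w → W + W ≤ 6 * W * w
2W≤6Ww W 1≤w = ≤-trans (+-monoʳ-≤ W (m≤m+n W (4 * W))) (≤-trans (≤-reflexive (sym (*-identityʳ (6 * W)))) (*-monoʳ-≤ (6 * W) 1≤w))

load-above : ∀ {x y a b c d W w} β → 1 ≤ b → 1 ≤ d → 1 ≤ w → ratio a b ℚ.+ ratio c d ℚ.≤ toℚ (β * w) →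
  suc (pred b) * x ≤ a + suc (pred b) * W → suc (pred d) * y ≤ c + suc (pred d) * W → x + y ≤ (β + 6 * W) * w
load-above {x} {y} {a} {b} {c} {d} {W} {w} β 1≤b 1≤d 1≤w load≤ bx≤ dy≤ = ≤-trans (toℚ-cancel (begin
  toℚ (x + y)                                              ≡⟨ toℚ-+ x y ⟩
  toℚ x ℚ.+ toℚ y                                          ≤⟨ ℚ.+-mono-≤ (copy-above {x} {a} {b} {W} 1≤b bx≤) (copy-above {y} {c} {d} {W} 1≤d dy≤) ⟩
  (ratio a b ℚ.+ toℚ W) ℚ.+ (ratio c d ℚ.+ toℚ W)          ≡⟨ solve 3 (λ p q w → (p :+ w) :+ (q :+ w) := (p :+ q) :+ (w :+ w)) refl (ratio a b) (ratio c d) (toℚ W) ⟩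
  (ratio a b ℚ.+ ratio c d) ℚ.+ (toℚ W ℚ.+ toℚ W)          ≤⟨ ℚ.+-mono-≤ load≤ (ℚ.≤-reflexive (sym (toℚ-+ W W))) ⟩
  toℚ (β * w) ℚ.+ toℚ (W + W)                              ≡⟨ toℚ-+ (β * w) (W + W) ⟨
  toℚ (β * w + (W + W))                                    ∎))
  (≤-trans (+-monoʳ-≤ (β * w) (2W≤6Ww W 1≤w)) (≤-reflexive (sym (*-distribʳ-+ w β (6 * W)))))
  where open ℚ.≤-Reasoning

load-below : ∀ {x y a b c d W w} β⁻ → 1 ≤ b → 1 ≤ d → 1 ≤ w → toℚ (β⁻ * w) ℚ.≤ ratio a b ℚ.+ ratio c d →
  a ≤ suc (pred b) * (x + W) → c ≤ suc (pred d) * (y + W) → (β⁻ ∸ 6 * W) * w ≤ x + y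
load-below {x} {y} {a} {b} {c} {d} {W} {w} β⁻ 1≤b 1≤d 1≤w ≤load a≤ c≤ =
  ≤-trans (≤-reflexive (*-distribʳ-∸ w β⁻ (6 * W))) (m≤n+o⇒m∸n≤o (β⁻ * w) (6 * W * w)
    (≤-trans (toℚ-cancel below) (≤-trans (≤-reflexive (eq x y W)) (+-monoˡ-≤ (x + y) (2W≤6Ww W 1≤w)))))
  where
  open ℚ.≤-Reasoning
  eq : ∀ x y W → x + W + (y + W) ≡ W + W + (x + y)
  eq = solve-∀
  below : toℚ (β⁻ * w) ℚ.≤ toℚ (x + W + (y + W))
  below = begin
    toℚ (β⁻ * w)                  ≤⟨ ≤load ⟩
    ratio a b ℚ.+ ratio c d       ≤⟨ ℚ.+-mono-≤ (copy-below {x} {a} {b} {W} 1≤b a≤) (copy-below {y} {c} {d} {W} 1≤d c≤) ⟩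
    toℚ (x + W) ℚ.+ toℚ (y + W)   ≡⟨ toℚ-+ (x + W) (y + W) ⟨
    toℚ (x + W + (y + W))         ∎

module Encoding {n m : ℕ} (E : Fin m → Edge n) (loopless : ∀ i → src (E i) ≢ tgt (E i)) where

  open Multigraph (src ∘ E) (tgt ∘ E)

  w : Fin m → ℕ
  w = weight ∘ E

  totalWeight≡ : ∀ S → totalWeight E S ≡ sum (λ f → ι (lookup S f) * w f)
  totalWeight≡ S = trans (sumFin≡sum (λ f → if lookup S f then w f else 0)) (sum-cong-≗ λ f → term (lookup S f) (w f))
    where
    term : ∀ b k → (if b then k else 0) ≡ ι b * k
    term true  k = sym (*-identityˡ k)
    term false k = refl

  -- `incident` is a disjunction and counts an edge once, whereas `star` adds over both ends; the
  -- absence of loops reconciles them. The same holds for the two orientations in `multiplicity≡`.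
  incidence : ∀ f v h k → (if h ∧ incident (E f) v then k else 0) ≡ ι h * k * (δ (src (E f)) v + δ (tgt (E f)) v)
  incidence f v false k = refl
  incidence f v true  k with src (E f) Fin.≟ v | tgt (E f) Fin.≟ v
  ... | yes refl | yes t≡s = contradiction (sym t≡s) (loopless f)
  ... | yes _    | no _    = sym (trans (*-identityʳ (1 * k)) (*-identityˡ k))
  ... | no _     | yes _   = sym (trans (*-identityʳ (1 * k)) (*-identityˡ k))
  ... | no _     | no _    = sym (*-zeroʳ (1 * k))

  wdeg≡ : ∀ S v → wdeg E S v ≡ star (λ f → ι (lookup S f) * w f) v
  wdeg≡ S v = trans (sumFin≡sum (λ f → if lookup S f ∧ incident (E f) v then w f else 0)) (sum-cong-≗ λ f → incidence f v (lookup S f) (w f))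

  deg≡ : ∀ S v → deg E S v ≡ star (λ f → ι (lookup S f)) v
  deg≡ S v = trans (sumFin≡sum (λ f → if lookup S f ∧ incident (E f) v then 1 else 0)) (sum-cong-≗ λ f → trans (incidence f v (lookup S f) 1)
    (cong (_* (δ (src (E f)) v + δ (tgt (E f)) v)) (*-identityʳ (ι (lookup S f)))))

  multiplicity≡ : ∀ u v → multiplicity E u v ≡ adj (λ _ → 1) u v
  multiplicity≡ u v = trans (sumFin≡sum (λ f → if joins (E f) u v then 1 else 0)) (sum-cong-≗ term)
    where
    term : ∀ f → (if joins (E f) u v then 1 else 0) ≡ 1 * (δ (src (E f)) u * δ (tgt (E f)) v + δ (tgt (E f)) u * δ (src (E f)) v)
    term f with src (E f) Fin.≟ u | tgt (E f) Fin.≟ v | src (E f) Fin.≟ v | tgt (E f) Fin.≟ u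
    ... | yes refl | yes refl | yes s≡t | _        = contradiction s≡t (loopless f)
    ... | yes refl | yes refl | no _    | yes t≡s  = contradiction (sym t≡s) (loopless f)
    ... | yes _    | yes _    | no _    | no _     = refl
    ... | yes _    | no _     | yes _   | yes _    = refl
    ... | yes _    | no _     | yes _   | no _     = refl
    ... | yes _    | no _     | no _    | yes _    = refl
    ... | yes _    | no _     | no _    | no _     = refl
    ... | no _     | yes _    | yes _   | yes _    = refl
    ... | no _     | yes _    | yes _   | no _     = refl
    ... | no _     | yes _    | no _    | yes _    = refl
    ... | no _     | yes _    | no _    | no _     = refl
    ... | no _     | no _     | yes _   | yes _    = refl
    ... | no _     | no _     | yes _   | no _     = refl
    ... | no _     | no _     | no _    | yes _    = refl
    ... | no _     | no _     | no _    | no _     = refl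

  -- The matching in H has to be chosen before `MG` is given. It is built from one fixed maximum
  -- weight matching, which weighs at least as much as any `MG`.
  max-matching : ∀ b → ∃ (IsMaxWeightBMatching E b)
  max-matching b with maximiser (λ M → Fin.all? λ v → deg E M v ≤? b v) (totalWeight E) total≤ (⊥ , ⊥-matching)
    where
    total≤ : ∀ M → totalWeight E M ≤ sum w
    total≤ M = ≤-trans (≤-reflexive (totalWeight≡ M)) (sum-mono λ f → ≤-trans (*-monoˡ-≤ (w f) (ι≤1 (lookup M f))) (≤-reflexive (*-identityˡ (w f))))
    ⊥-matching : IsBMatching E b ⊥
    ⊥-matching v = ≤-trans (≤-reflexive (trans (deg≡ ⊥ v) (sum-zero λ f → cong (λ z → ι z * (δ (src (E f)) v + δ (tgt (E f)) v)) (lookup-replicate f false)))) z≤n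
  ... | M , M-matching , M-max = M , M-matching , M-max

Approximable : ∀ {n m} → ℚ → ℕ → (Fin m → Edge n) → (Fin n → ℕ) → Subset m → Set
Approximable {n} {m} ε W E b H = Σ (Subset m) λ MH → MH ⊆ H × IsBMatching E b MH ×
  ((MG : Subset m) → IsMaxWeightBMatching E b MG →
    toℚ (totalWeight E MG) ℚ.≤ (toℚ 2 ℚ.- ratio 1 (2 * W) ℚ.+ ε) ℚ.* toℚ (totalWeight E MH))

module Approximation (ε : ℚ) (ε<½ : ε ℚ.< (ℤ.+ 1 ℚ./ 2)) (p q : ℕ) (1≤p : 1 ≤ p) (1≤q : 1 ≤ q) (εq≡p : ε ℚ.* toℚ q ≡ toℚ p)
  (V β β⁻ : ℕ) {n m : ℕ} (E : Fin m → Edge n) (b : Fin n → ℕ) (graph : IsWeightedMultiGraph E (suc V) b) (H : Subset m) where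

  open Encoding E (proj₁ graph)
  open Parameters ε p q εq≡p V β β⁻

  private
    weights = proj₁ (proj₂ graph)
    1≤b = proj₁ (proj₂ (proj₂ graph))
    multiplicity≤ = proj₂ (proj₂ (proj₂ graph))

    d : Fin n → ℕ
    d = Multigraph.star (src ∘ E) (tgt ∘ E) (λ f → ι (lookup H f) * w f)

    suc-pred-b : ∀ v → suc (pred (b v)) ≡ b v
    suc-pred-b v = suc-pred (b v) {{>-nonZero (1≤b v)}}

  Heavy : Subset m → Set
  Heavy M = HeavyMatching (src ∘ E) (tgt ∘ E) w (lookup H) (lookup M) (pred ∘ b) V p D

  heavy-matching : 3 ≤ β → LnLe x t → (ℚ.1ℚ ℚ.- lam) ℚ.* x ℚ.≤ toℚ β⁻ ℚ.- toℚ (6 * W) → IsEDCS E β β⁻ b H →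
    ∀ M → IsBMatching E b M → Heavy M
  heavy-matching 3≤β ln gap (H-edges , G∖H-edges) M M-matching =
    general-capacities (src ∘ E) (tgt ∘ E) w (lookup H) (lookup M) (pred ∘ b) V X (β⁻ ∸ 6 * W) p D
      (proj₁ graph) (proj₁ ∘ weights) (proj₂ ∘ weights)
      (λ v → subst₂ _≤_ (deg≡ M v) (sym (suc-pred-b v)) (M-matching v))
      (λ u v → subst₂ _≤_ (multiplicity≡ u v) (sym (suc-pred-b u)) (≤-trans (multiplicity≤ u v) (m⊓n≤m (b u) (b v))))
      H-edges′ G∖H-edges′ (X-large 4≤X 1≤q ln) (gap-small gap) 1≤p (≤-trans (s≤s z≤n) 4≤X)
    where
    4≤X : 4 ≤ X
    4≤X = +-mono-≤ {3} {β} {1} 3≤β (s≤s z≤n)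
    H-edges′ : ∀ {f} → lookup H f ≡ true → ∀ {x y} → suc (pred (b (src (E f)))) * x ≤ d (src (E f)) + suc (pred (b (src (E f)))) * W →
      suc (pred (b (tgt (E f)))) * y ≤ d (tgt (E f)) + suc (pred (b (tgt (E f)))) * W → x + y ≤ X * w f
    H-edges′ {f} Hf {x} {y} = load-above {x} {y} {d u} {b u} {d v} {b v} {W} {w f} β (1≤b u) (1≤b v) (proj₁ (weights f))
      (subst₂ (λ a c → ratio a (b u) ℚ.+ ratio c (b v) ℚ.≤ toℚ (β * w f)) (wdeg≡ H u) (wdeg≡ H v) (H-edges f Hf))
      where
      u = src (E f)
      v = tgt (E f)
    G∖H-edges′ : ∀ {f} → lookup H f ≡ false → ∀ {x y} → d (src (E f)) ≤ suc (pred (b (src (E f)))) * (x + W) →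
      d (tgt (E f)) ≤ suc (pred (b (tgt (E f)))) * (y + W) → (β⁻ ∸ 6 * W) * w f ≤ x + y
    G∖H-edges′ {f} ¬Hf {x} {y} = load-below {x} {y} {d u} {b u} {d v} {b v} {W} {w f} β⁻ (1≤b u) (1≤b v) (proj₁ (weights f))
      (subst₂ (λ a c → toℚ (β⁻ * w f) ℚ.≤ ratio a (b u) ℚ.+ ratio c (b v)) (wdeg≡ H u) (wdeg≡ H v) (G∖H-edges f ¬Hf))
      where
      u = src (E f)
      v = tgt (E f)

  approximating : ∀ M → IsMaxWeightBMatching E b M → Heavy M → Approximable ε W E b H
  approximating M (_ , M-max) heavy = MH , MH⊆H , MH-matching , λ MG MG-max → begin
      toℚ (totalWeight E MG)
        ≤⟨ toℚ-mono (M-max MG (proj₁ MG-max)) ⟩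
      toℚ (totalWeight E M)
        ≡⟨ cong toℚ (totalWeight≡ M) ⟩
      toℚ (sum (λ f → ι (lookup M f) * w f))
        ≤⟨ ratio-bound 1≤q wM wA (simplified (2p≤q ε<½) 1≤q wM wA A-heavy) ⟩
      (toℚ 2 ℚ.- ratio 1 (2 * W) ℚ.+ ε) ℚ.* toℚ (sum (λ f → ι (A f) * w f))
        ≡⟨ cong (λ z → (toℚ 2 ℚ.- ratio 1 (2 * W) ℚ.+ ε) ℚ.* toℚ z) (sym wA≡) ⟩
      (toℚ 2 ℚ.- ratio 1 (2 * W) ℚ.+ ε) ℚ.* toℚ (totalWeight E MH) ∎
    where
    open ℚ.≤-Reasoning
    open HeavyMatching heavy
    wM = sum (λ f → ι (lookup M f) * w f)
    wA = sum (λ f → ι (A f) * w f)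
    MH : Subset m
    MH = tabulate A
    MH⊆H : MH ⊆ H
    MH⊆H {f} f∈MH = lookup⇒[]= f H (A⊆H (trans (sym (lookup∘tabulate A f)) ([]=⇒lookup f∈MH)))
    MH-matching : IsBMatching E b MH
    MH-matching v = ≤-trans (≤-reflexive (trans (deg≡ MH v) (sum-cong-≗ λ f →
      cong (λ a → ι a * (δ (src (E f)) v + δ (tgt (E f)) v)) (lookup∘tabulate A f))))
      (≤-trans (A-matching v) (≤-reflexive (suc-pred-b v)))
    wA≡ : totalWeight E MH ≡ sum (λ f → ι (A f) * w f)
    wA≡ = trans (totalWeight≡ MH) (sum-cong-≗ λ f → cong (λ a → ι a * w f) (lookup∘tabulate A f))

theorem4 : (ε : ℚ) → (ℤ.+ 0 ℚ./ 1) ℚ.< ε → ε ℚ.< (ℤ.+ 1 ℚ./ 2) →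
    (W : ℕ) → 1 ≤ W →
    (β β⁻ : ℕ) → 3 ≤ β → β⁻ ≤ β ∸ 2 →
    -- λ = ε / (100 W);  (β + 6W) / ln(β + 6W) ≥ 2 W² λ⁻², i.e. ln(β + 6W) ≤ (β + 6W) λ² / (2 W²)
    let lam = ε ℚ.* ratio 1 (100 * W) in
    let x = toℚ (β + 6 * W) in
    LnLe x (x ℚ.* lam ℚ.* lam ℚ.* ratio 1 (2 * W * W)) →
    -- β⁻ − 6W ≥ (1 − λ)(β + 6W)
    ((ℤ.+ 1 ℚ./ 1) ℚ.- lam) ℚ.* x ℚ.≤ (toℚ β⁻ ℚ.- toℚ (6 * W)) →
    (n m : ℕ) (E : Fin m → Edge n) (b : Fin n → ℕ) →
    IsWeightedMultiGraph E W b →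
    (H : Subset m) → IsEDCS E β β⁻ b H →
    Σ (Subset m) (λ MH → MH ⊆ H × IsBMatching E b MH ×
    ((MG : Subset m) → IsMaxWeightBMatching E b MG →
    toℚ (totalWeight E MG) ℚ.≤ ((ℤ.+ 2 ℚ./ 1) ℚ.- ratio 1 (2 * W) ℚ.+ ε) ℚ.* toℚ (totalWeight E MH)))
theorem4 ε 0<ε ε<½ (suc V) _ β β⁻ 3≤β _ ln gap n m E b graph H edcs =
  approximate (numeral 0<ε) (Encoding.max-matching E (proj₁ graph) b)
  where
  approximate : (∃ λ p → ∃ λ q → 1 ≤ p × 1 ≤ q × ε ℚ.* toℚ q ≡ toℚ p) → ∃ (IsMaxWeightBMatching E b) → Approximable ε (suc V) E b H
  approximate (p , q , 1≤p , 1≤q , εq≡p) (M , M-max) =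
    approximating M M-max (heavy-matching 3≤β ln gap edcs M (proj₁ M-max))
    where open Approximation ε ε<½ p q 1≤p 1≤q εq≡p V β β⁻ E b graph H
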